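{- Let $\alpha=(\alpha_1,\dots,\alpha_k)$ be a peak composition. Then $\tilde{Q}_\alpha=\tilde{S}_\alpha$, i.e. the quasisymmetric Schur $Q$-function indexed by $\alpha$ is precisely the peak Young quasisymmetric Schur function indexed by $\alpha$, if and only if either $\alpha=(2,\dots,2,\alpha_k)$ or $\alpha=(2,\dots,2,\alpha_{k-1},1)$.
   Context: In the forms $(2,\dots,2,\alpha_k)$ and $(2,\dots,2,\alpha_{k-1},1)$ the number of initial $2$'s (namely $k-1$, respectively $k-2$) may be zero. Let $n$ be a positive integer, $[n]=\{1,\dots,n\}$. A composition $\alpha=(\alpha_1,\dots,\alpha_k)$ of $n$ (written $\alpha\vDash n$) is a finite sequence of positive integers summing to $n$. It is a peak composition if all parts except possibly the last are greater than $1$. Put $\mathrm{set}(\alpha)=\{\alpha_1,\alpha_1+\alpha_2,\dots,\alpha_1+\cdots+\alpha_{k-1}\}\subseteq[n-1]$. For $X=\{x_1<\dots<x_r\}\subseteq[n-1]$, $\mathrm{comp}_n(X)=(x_1,x_2-x_1,\dots,x_r-x_{r-1},n-x_r)$. A composition $\beta$ refines $\alpha$ if $\alpha$ can be obtained by summing consecutive entries of $\beta$. For $X\subseteq[n]$, $\mathrm{Peak}(X)=\{i\in X: i-1\notin X,\ i\neq 1\}$, and $\mathrm{Peak}(\alpha)=\mathrm{Peak}(\mathrm{set}(\alpha))$. Functions: formal power series in $x_1,x_2,\dots$. $M_\alpha=\sum_{1\le i_1<\cdots<i_k}x_{i_1}^{\alpha_1}\cdots x_{i_k}^{\alpha_k}$;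 $F_\alpha=\sum_{\beta\text{ refines }\alpha}M_\beta$. For a peak composition $\alpha$ of $n$, the peak function is $K_\alpha=2^{|\mathrm{Peak}(\alpha)|+1}\sum F_\beta$, the sum over $\beta\vDash n$ with $\mathrm{Peak}(\alpha)\subseteq \mathrm{set}(\beta)\,\triangle\,(\mathrm{set}(\beta)+1)$, where $\mathrm{set}(\beta)+1=\{i+1:i\in\mathrm{set}(\beta)\}$ and $\triangle$ is symmetric difference. Diagrams: the diagram $D_\alpha$ is the left-justified array of boxes whose $i$th row from the bottom has $\alpha_i$ boxes; $(c,r)$ denotes the box in column $c$ (leftmost is 1) and row $r$ (bottom is 1). A filling $T$ of $D_\alpha$ assigns an entry $T(c,r)$ to each box. Marked peak composition tableaux: for a peak composition $\alpha$ of $n$, a marked peak composition tableau of shape $\alpha$ is a filling $T$ of $D_\alpha$ with entries from the ordered alphabet $1'<1<2'<2<\cdots$ (primed entries are called marked) such that: (1) entries in each row weakly increase left to right, with no repeated marked entries in a row; (2) entries in the first column strictly increase from bottom to top; (3) for any $k\le n$, the boxes with entries in $\{1',1,\dots,k',k\}$ form the diagram of a peak composition; (4) if an unmarked entry $i$ is in box $(2,r)$ for some row $r$, then neither $i$ nor $i'$ is in box $(1,r+1)$. The weight $\mathrm{wt}(T)$ has $i$th entry equal to the number of occurrences of $i$ or $i'$. $\mathrm{MPCT}(\alpha)$ is the set of such tableaux of shape $\alpha$ whose weight has no zero entry to the left of a nonzero entry (so $\mathrm{wt}(T)$, omitting trailing zeros, is a composition of $n$). The quasisymmetric Schur $Q$-function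 is $\tilde{Q}_\alpha=\sum_{T\in\mathrm{MPCT}(\alpha)}M_{\mathrm{wt}(T)}$. Standard peak Young composition tableaux: for a peak composition $\alpha$ of $n$, $\mathrm{SPYCT}(\alpha)$ is the set of fillings $T$ of $D_\alpha$ with entries from $[n]$, each used once, such that: (1) entries in each row increase left to right; (2) entries in the first column increase from bottom to top; (3) for all $k\le n$, the boxes with entries at most $k$ form the diagram of a peak composition; (4) if $T(c,r)<T(c+1,r')$ for some $c$ and some $r'<r$, then box $(c+1,r)$ is in $T$ and $T(c+1,r)<T(c+1,r')$. For such $T$, $\mathrm{Des}_{\leftarrow}(T)=\{i\in[n-1]: i+1\text{ is weakly left of } i\text{ in }T\}$ and $\mathrm{Peak}_{\leftarrow}(T)=\mathrm{Peak}(\mathrm{Des}_{\leftarrow}(T))$. The peak Young quasisymmetric Schur function is $\tilde{S}_\alpha=\sum_{T\in\mathrm{SPYCT}(\alpha)}K_{\mathrm{comp}_n(\mathrm{Peak}_{\leftarrow}(T))}$. -}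

module Defs where

open import Data.Empty using (⊥-elim)
open import Data.Fin.Base using (Fin; zero; suc; toℕ; fromℕ)
import Data.Fin.Properties as Fin
open import Data.List.Base
  using (List; []; _∷_; _++_; map; concatMap; cartesianProductWith; filter; length;
         lookup; sum; applyUpTo; upTo; allFin)
import Data.List.Membership.DecPropositional as DecMembership
open import Data.List.Membership.Propositional using (_∈_; lose)
open import Data.List.Membership.Propositional.Properties using (∈-cartesianProductWith⁺; ∈-upTo⁺)
import Data.List.Properties as List
open import Data.List.Relation.Unary.All using (All; []; _∷_)
import Data.List.Relation.Unary.All as All
open import Data.List.Relation.Unary.AllPairs using (AllPairs; allPairs?)
open import Data.List.Relation.Unary.Any using (here; there)
import Data.List.Relation.Unary.Any as Any
open import Data.Nat
  using (ℕ; zero; suc; _+_; _*_; _∸_; _^_; _≤_; _<_; _≤?_; _<?_; _≟_; s≤s; s≤s⁻¹)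
open import Data.Nat.Properties using (allUpTo?; suc-injective)
open import Data.Product using (_×_; _,_; proj₁; proj₂; ∃; ∃-syntax; ∃!)
open import Data.Product.Properties using (≡-dec)
open import Data.Vec.Base using (Vec; []; _∷_)
import Data.Vec.Base as Vec
open import Relation.Binary.PropositionalEquality
  using (_≡_; _≢_; refl; trans; cong; cong₂; subst)
open import Relation.Nullary using (¬_; Dec; yes; no; ¬?; map′; _×-dec_; _→-dec_)
open import Relation.Unary using (Decidable)

open DecMembership _≟_ using (_∈?_; _∉?_)

[1⋯_] : ℕ → List ℕ
[1⋯ n ] = applyUpTo suc n

-- The empty list is the composition of 0.
Composition : List ℕ → Set
Composition α = All (0 <_) α

PeakComposition : List ℕ → Set
PeakComposition α =
  Composition α × (∀ (i : Fin (length α)) → suc (toℕ i) < length α → 1 < lookup α i)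

peakComposition? : Decidable PeakComposition
peakComposition? α =
  All.all? (0 <?_) α
    ×-dec Fin.all? (λ i → (suc (toℕ i) <? length α) →-dec (1 <? lookup α i))

incrementFirst : List ℕ → List ℕ
incrementFirst []      = []
incrementFirst (a ∷ α) = suc a ∷ α

-- All compositions of n, each listed once: those of n + 2 either start with a part 1, or
-- arise from a composition of n + 1 by increasing its first part.
compositions : ℕ → List (List ℕ)
compositions zero          = [] ∷ []
compositions (suc zero)    = (1 ∷ []) ∷ []
compositions (suc (suc n)) =
  map (1 ∷_) (compositions (suc n)) ++ map incrementFirst (compositions (suc n))

-- Finite sets of naturals are represented by duplicate-free lists.
set : List ℕ → List ℕ
set []          = []
set (a ∷ [])    = []
set (a ∷ b ∷ α) = a ∷ map (a +_) (set (b ∷ α))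

-- X is expected in increasing order.
comp : ℕ → List ℕ → List ℕ
comp n X = go 0 X
  where
  go : ℕ → List ℕ → List ℕ
  go previous []      = (n ∸ previous) ∷ []
  go previous (x ∷ X) = (x ∸ previous) ∷ go x X

Peak : List ℕ → List ℕ
Peak X = filter (λ i → (i ∸ 1 ∉? X) ×-dec ¬? (i ≟ 1)) X

_△_ : List ℕ → List ℕ → List ℕ
X △ Y = filter (_∉? Y) X ++ filter (_∉? X) Y

-- β Refines α: α is obtained from β by summing consecutive entries.
data _Refines_ : List ℕ → List ℕ → Set where
  done  : [] Refines []
  keep  : ∀ {a β α} → β Refines α → (a ∷ β) Refines (a ∷ α)
  merge : ∀ {b c β α} → ((b + c) ∷ β) Refines α → (b ∷ c ∷ β) Refines α

refines? : ∀ β α → Dec (β Refines α)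
refines? []      []      = yes done
refines? []      (a ∷ α) = no λ ()
refines? (b ∷ β) α       = go b β α
  where
  go : ∀ b β α → Dec ((b ∷ β) Refines α)
  go b [] []      = no λ ()
  go b [] (a ∷ α) with b ≟ a
  ... | no b≢a = no λ { (keep _) → b≢a refl }
  ... | yes refl with α
  ...   | []    = yes (keep done)
  ...   | _ ∷ _ = no λ { (keep ()) }
  go b (c ∷ β) α with go (b + c) β α
  ... | yes m = yes (merge m)
  go b (c ∷ β) [] | no ¬m = no λ { (merge m) → ¬m m }
  go b (c ∷ β) (a ∷ α) | no ¬m with b ≟ a
  ... | no b≢a = no λ { (keep _) → b≢a refl ; (merge m) → ¬m m }
  ... | yes refl = map′ keep (λ { (keep k) → k ; (merge m) → ⊥-elim (¬m m) }) (go c β α)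

-- f (e₁ ∷ … ∷ eₘ ∷ []) is the coefficient of x₁^e₁ ⋯ xₘ^eₘ in f.  A monomial has several
-- exponent lists, differing by trailing zeros; the series below do not distinguish them.
-- All series that occur have coefficients in ℕ.
Series : Set
Series = List ℕ → ℕ

infix 4 _≈_
_≈_ : Series → Series → Set
f ≈ g = ∀ e → f e ≡ g e

infixr 7 _·_
_·_ : ℕ → Series → Series
(c · f) e = c * f e

∑ : {A : Set} → List A → (A → Series) → Series
∑ xs f e = sum (map (λ x → f x e) xs)

-- The exponent lists (of length m) of the monomials x_{i₁}^α₁ ⋯ x_{iₖ}^αₖ, one for each
-- choice of 1 ≤ i₁ < ⋯ < iₖ ≤ m: either no iⱼ is 1, or i₁ = 1.
monomials : (m : ℕ) → List ℕ → List (List ℕ)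
monomials zero    []      = [] ∷ []
monomials zero    (a ∷ α) = []
monomials (suc m) []      = map (0 ∷_) (monomials m [])
monomials (suc m) (a ∷ α) = map (0 ∷_) (monomials m (a ∷ α)) ++ map (a ∷_) (monomials m α)

-- For α a composition, terms with some iⱼ > length e do not contribute to the coefficient
-- of x^e, since αⱼ > 0.
M : List ℕ → Series
M α e = length (filter (List.≡-dec _≟_ e) (monomials (length e) α))

F : List ℕ → Series
F α = ∑ (filter (λ β → refines? β α) (compositions (sum α))) M

K : List ℕ → Series
K α = 2 ^ (length P + 1) ·
      ∑ (filter (λ β → All.all? (_∈? (set β △ map suc (set β))) P) (compositions (sum α))) F
  where P = Peak (set α)

-- Boxes of D_α.  The underlying Fin indices start at 0, rows being indexed from the bottom;
-- `row` and `col` are the usual 1-based coordinates.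
record Box (α : List ℕ) : Set where
  constructor box
  field
    rowIndex : Fin (length α)
    colIndex : Fin (lookup α rowIndex)

row col : ∀ {α} → Box α → ℕ
row (box r c) = suc (toℕ r)
col (box r c) = suc (toℕ c)

position : ∀ {α} → Box α → ℕ × ℕ
position b = col b , row b

Filling : Set → List ℕ → Set
Filling A α = All (Vec A) α

infixl 9 _!_
_!_ : ∀ {A α} → Filling A α → Box α → A
(v ∷ T) ! box zero    c = Vec.lookup v c
(v ∷ T) ! box (suc r) c = T ! box r c

vectors : {A : Set} → List A → (n : ℕ) → List (Vec A n)
vectors xs zero    = [] ∷ []
vectors xs (suc n) = cartesianProductWith _∷_ xs (vectors xs n)

fillings : {A : Set} → List A → (α : List ℕ) → List (Filling A α)
fillings xs []      = [] ∷ []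
fillings xs (a ∷ α) = cartesianProductWith _∷_ (vectors xs a) (fillings xs α)

allBoxes : (α : List ℕ) → List (Box α)
allBoxes α = concatMap (λ r → map (box r) (allFin (lookup α r))) (allFin (length α))

∀Box? : ∀ {α} {P : Box α → Set} → Decidable P → Dec (∀ b → P b)
∀Box? P? = map′ (λ h (box r c) → h r c) (λ h r c → h (box r c))
                (Fin.all? λ r → Fin.all? λ c → P? (box r c))

∃Box? : ∀ {α} {P : Box α → Set} → Decidable P → Dec (∃ P)
∃Box? P? = map′ (λ (r , c , p) → box r c , p) (λ (box r c , p) → r , c , p)
                (Fin.any? λ r → Fin.any? λ c → P? (box r c))

box-≟ : ∀ {α} (b b′ : Box α) → Dec (b ≡ b′)
box-≟ (box r c) (box r′ c′) with r Fin.≟ r′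
... | no r≢r′  = no λ { refl → r≢r′ refl }
... | yes refl = map′ (cong (box r)) (λ { refl → refl }) (c Fin.≟ c′)

-- The boxes of D_α satisfying P form the diagram D_β.
FormDiagram : ∀ {α} → (Box α → Set) → List ℕ → Set
FormDiagram {α} P β =
    (∀ (b : Box α) → P b → ∃[ d ] (position {β} d ≡ position b))
  × (∀ (d : Box β) → ∃[ b ] (P b × position {α} b ≡ position d))

FormPeakDiagram : ∀ {α} → (Box α → Set) → Set
FormPeakDiagram P = ∃[ β ] (PeakComposition β × FormDiagram P β)

formDiagram? : ∀ {α} {P : Box α → Set} → Decidable P → ∀ β → Dec (FormDiagram P β)
formDiagram? P? β =
    ∀Box? (λ b → P? b →-dec ∃Box? (λ d → ≡-dec _≟_ _≟_ (position d) (position b)))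
  ×-dec
    ∀Box? (λ d → ∃Box? (λ b → P? b ×-dec ≡-dec _≟_ _≟_ (position b) (position d)))

-- Decidability of FormPeakDiagram: any witness has its diagram inside D_α, so it is in this list.
private
  subdiagrams : List ℕ → List (List ℕ)
  subdiagrams []      = [] ∷ []
  subdiagrams (a ∷ α) = [] ∷ cartesianProductWith _∷_ (upTo (suc a)) (subdiagrams α)

  Inside : List ℕ → List ℕ → Set
  Inside β α = ∀ (d : Box β) → ∃[ b ] (position {α} b ≡ position d)

  inside-[] : ∀ α → [] ∈ subdiagrams α
  inside-[] []      = here refl
  inside-[] (a ∷ α) = here refl

  ∈-subdiagrams : ∀ α β → Composition β → Inside β α → β ∈ subdiagrams α
  ∈-subdiagrams α       []          _         _  = inside-[] α
  ∈-subdiagrams []      (b ∷ β)     (s≤s _ ∷ _) in⊆ with in⊆ (box zero zero)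
  ... | box () _ , _
  ∈-subdiagrams (a ∷ α) (suc b ∷ β) (_ ∷ β>0) in⊆ =
    there (∈-cartesianProductWith⁺ _∷_ (∈-upTo⁺ (s≤s b<a)) (∈-subdiagrams α β β>0 in⊆′))
    where
    b<a : b < a
    b<a with in⊆ (box zero (fromℕ b))
    ... | box zero c , eq =
      subst (_< a) (trans (suc-injective (cong proj₁ eq)) (Fin.toℕ-fromℕ b)) (Fin.toℕ<n c)
    ... | box (suc r) c , eq with cong proj₂ eq
    ...   | ()

    in⊆′ : Inside β α
    in⊆′ (box r c) with in⊆ (box (suc r) c)
    ... | box (suc r′) c′ , eq =
      box r′ c′ , cong₂ _,_ (cong proj₁ eq) (suc-injective (cong proj₂ eq))
    ... | box zero c′ , eq with cong proj₂ eq
    ...   | ()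

formPeakDiagram? : ∀ {α} {P : Box α → Set} → Decidable P → Dec (FormPeakDiagram P)
formPeakDiagram? {α} P? =
  map′ (λ h → Any.satisfied h)
       (λ (β , p , fd) →
          lose (∈-subdiagrams α β (proj₁ p) (λ d → let (b , _ , eq) = proj₂ fd d in b , eq)) (p , fd))
       (Any.any? (λ β → peakComposition? β ×-dec formDiagram? P? β) (subdiagrams α))

∀≤? : ∀ {P : ℕ → Set} → Decidable P → ∀ n → Dec (∀ k → k ≤ n → P k)
∀≤? P? n with allUpTo? P? (suc n)
... | yes h = yes λ k k≤n → h (s≤s k≤n)
... | no ¬h = no λ h → ¬h λ k<1+n → h _ (s≤s⁻¹ k<1+n)

data Letter : Set where
  marked unmarked : ℕ → Letter

index : Letter → ℕ
index (marked i)   = i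
index (unmarked i) = i

data IsMarked : Letter → Set where
  marked : ∀ {i} → IsMarked (marked i)

isMarked? : Decidable IsMarked
isMarked? (marked i)   = yes marked
isMarked? (unmarked i) = no λ ()

letter-≟ : (x y : Letter) → Dec (x ≡ y)
letter-≟ (marked i)   (marked j)   = map′ (cong marked) (cong index) (i ≟ j)
letter-≟ (unmarked i) (unmarked j) = map′ (cong unmarked) (cong index) (i ≟ j)
letter-≟ (marked i)   (unmarked j) = no λ ()
letter-≟ (unmarked i) (marked j)   = no λ ()

-- Realises the order 1′ < 1 < 2′ < 2 < ⋯.
rank : Letter → ℕ
rank (marked i)   = 2 * i
rank (unmarked i) = suc (2 * i)

infix 4 _≤ᴸ_ _<ᴸ_
_≤ᴸ_ _<ᴸ_ : Letter → Letter → Set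
x ≤ᴸ y = rank x ≤ rank y
x <ᴸ y = rank x < rank y

letters : ℕ → List Letter
letters n = concatMap (λ i → marked i ∷ unmarked i ∷ []) [1⋯ n ]

record IsMarkedPeakTableau {α : List ℕ} (T : Filling Letter α) : Set where
  field
    rows-weak   : ∀ (b b′ : Box α) → row b ≡ row b′ → col b < col b′ → T ! b ≤ᴸ T ! b′
    rows-marked : ∀ (b b′ : Box α) → row b ≡ row b′ → col b < col b′ →
                  T ! b ≡ T ! b′ → ¬ IsMarked (T ! b)
    column      : ∀ (b b′ : Box α) → col b ≡ 1 → col b′ ≡ 1 → row b < row b′ → T ! b <ᴸ T ! b′
    peak        : ∀ k → k ≤ sum α → FormPeakDiagram {α} (λ b → index (T ! b) ≤ k)
    unmarked-2  : ∀ (b b′ : Box α) → col b ≡ 2 → col b′ ≡ 1 → row b′ ≡ suc (row b) →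
                  ¬ IsMarked (T ! b) → index (T ! b′) ≢ index (T ! b)

isMarkedPeakTableau? : ∀ {α} → Decidable (IsMarkedPeakTableau {α})
isMarkedPeakTableau? {α} T =
  map′ (λ (p , q , r , s , t) → record
          { rows-weak = p ; rows-marked = q ; column = r ; peak = s ; unmarked-2 = t })
       (λ h → let open IsMarkedPeakTableau h in rows-weak , rows-marked , column , peak , unmarked-2)
       ((∀Box? λ b → ∀Box? λ b′ → (row b ≟ row b′) →-dec (col b <? col b′) →-dec
            (rank (T ! b) ≤? rank (T ! b′)))
        ×-dec
        (∀Box? λ b → ∀Box? λ b′ → (row b ≟ row b′) →-dec (col b <? col b′) →-dec
            letter-≟ (T ! b) (T ! b′) →-dec ¬? (isMarked? (T ! b)))
        ×-dec
        (∀Box? λ b → ∀Box? λ b′ → (col b ≟ 1) →-dec (col b′ ≟ 1) →-dec (row b <? row b′) →-dec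
            (rank (T ! b) <? rank (T ! b′)))
        ×-dec
        ∀≤? (λ k → formPeakDiagram? (λ b → index (T ! b) ≤? k)) (sum α)
        ×-dec
        (∀Box? λ b → ∀Box? λ b′ → (col b ≟ 2) →-dec (col b′ ≟ 1) →-dec (row b′ ≟ suc (row b)) →-dec
            ¬? (isMarked? (T ! b)) →-dec ¬? (index (T ! b′) ≟ index (T ! b))))

-- First n entries of the weight, n the number of boxes.
wt : ∀ {α} → Filling Letter α → List ℕ
wt {α} T = map (λ i → length (filter (λ b → index (T ! b) ≟ i) (allBoxes α))) [1⋯ sum α ]

NoInternalZeros : List ℕ → Set
NoInternalZeros = AllPairs (λ u v → ¬ (u ≡ 0 × v ≢ 0))

noInternalZeros? : Decidable NoInternalZeros
noInternalZeros? = allPairs? (λ u v → ¬? ((u ≟ 0) ×-dec ¬? (v ≟ 0)))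

-- A tableau with n boxes whose weight has no zero before a nonzero entry uses only letters
-- of index at most n.
MPCT : (α : List ℕ) → List (Filling Letter α)
MPCT α = filter (λ T → isMarkedPeakTableau? T ×-dec noInternalZeros? (wt T))
                (fillings (letters (sum α)) α)

-- On MPCT α the zeros of the weight are all trailing.
omitZeros : List ℕ → List ℕ
omitZeros = filter (λ u → ¬? (u ≟ 0))

Q̃ : List ℕ → Series
Q̃ α = ∑ (MPCT α) (λ T → M (omitZeros (wt T)))

record IsStandardPeakYoungTableau {α : List ℕ} (T : Filling ℕ α) : Set where
  field
    standard : ∀ (b : Box α) → 1 ≤ T ! b × T ! b ≤ sum α
    once     : All (λ i → ∃! _≡_ (λ b → T ! b ≡ i)) [1⋯ sum α ]
    rows     : ∀ (b b′ : Box α) → row b ≡ row b′ → col b < col b′ → T ! b < T ! b′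
    column   : ∀ (b b′ : Box α) → col b ≡ 1 → col b′ ≡ 1 → row b < row b′ → T ! b < T ! b′
    peak     : ∀ k → k ≤ sum α → FormPeakDiagram {α} (λ b → T ! b ≤ k)
    triple   : ∀ (b b′ : Box α) → col b′ ≡ suc (col b) → row b′ < row b → T ! b < T ! b′ →
               ∃[ d ] (row d ≡ row b × col d ≡ suc (col b) × T ! d < T ! b′)

isStandardPeakYoungTableau? : ∀ {α} → Decidable (IsStandardPeakYoungTableau {α})
isStandardPeakYoungTableau? {α} T =
  map′ (λ (p , q , r , s , t , u) → record
          { standard = p ; once = q ; rows = r ; column = s ; peak = t ; triple = u })
       (λ h → let open IsStandardPeakYoungTableau h in standard , once , rows , column , peak , triple)
       ((∀Box? λ b → (1 ≤? T ! b) ×-dec (T ! b ≤? sum α))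
        ×-dec
        All.all? (λ i → ∃Box? λ b → (T ! b ≟ i) ×-dec
            map′ (λ h {b′} → h b′) (λ h b′ → h {b′}) (∀Box? λ b′ → (T ! b′ ≟ i) →-dec box-≟ b b′))
          [1⋯ sum α ]
        ×-dec
        (∀Box? λ b → ∀Box? λ b′ → (row b ≟ row b′) →-dec (col b <? col b′) →-dec (T ! b <? T ! b′))
        ×-dec
        (∀Box? λ b → ∀Box? λ b′ → (col b ≟ 1) →-dec (col b′ ≟ 1) →-dec (row b <? row b′) →-dec
            (T ! b <? T ! b′))
        ×-dec
        ∀≤? (λ k → formPeakDiagram? (λ b → T ! b ≤? k)) (sum α)
        ×-dec
        (∀Box? λ b → ∀Box? λ b′ → (col b′ ≟ suc (col b)) →-dec (row b′ <? row b) →-dec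
            (T ! b <? T ! b′) →-dec
            ∃Box? λ d → (row d ≟ row b) ×-dec (col d ≟ suc (col b)) ×-dec (T ! d <? T ! b′)))

SPYCT : (α : List ℕ) → List (Filling ℕ α)
SPYCT α = filter isStandardPeakYoungTableau? (fillings [1⋯ sum α ] α)

Descent← : ∀ {α} → Filling ℕ α → ℕ → Set
Descent← {α} T i =
  ∃[ b ] ∃[ b′ ] (T ! b ≡ i × T ! b′ ≡ suc i × col {α} b′ ≤ col {α} b)

descent←? : ∀ {α} (T : Filling ℕ α) → Decidable (Descent← T)
descent←? T i =
  ∃Box? λ b → ∃Box? λ b′ → (T ! b ≟ i) ×-dec (T ! b′ ≟ suc i) ×-dec (col b′ ≤? col b)

Des← : ∀ {α} → Filling ℕ α → List ℕ
Des← {α} T = filter (descent←? T) [1⋯ sum α ∸ 1 ]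

Peak← : ∀ {α} → Filling ℕ α → List ℕ
Peak← T = Peak (Des← T)

S̃ : List ℕ → Series
S̃ α = ∑ (SPYCT α) (λ T → K (comp (sum α) (Peak← T)))

{-# OPTIONS --safe #-}
module Submission where

-- For a set D of gaps with peaks P, and a composition γ, the coefficient of M_γ in K_(comp P) is
-- the number of markings of the sorted word of weight γ that make it an enriched word with
-- descents D (Stembridge); so the coefficient of S̃ counts pairs of a standard filling T and an
-- enriched word for Des←(T).  A marked tableau is a filling in which each row weakly increases
-- with only unmarked repetitions, and in which the letter in column 2 is at most the first
-- letter of the next row, with equality only between marked letters; composing T with an
-- enriched word for Des←(T) gives such a tableau.  If no row of length at least 2 lies above
-- one of length at least 3, the triple condition is vacuous and standardization inverts this
-- map, so the two series agree.  Otherwise some filling satisfies all conditions on SPYCT but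
-- the triple one, and its 2ⁿ relabellings make the coefficient of x₁⋯xₙ larger in Q̃ than in S̃.

open import Defs
open import Data.Bool.Base using (Bool; true; false; not; _∧_; _∨_; _xor_; if_then_else_)
import Data.Bool.Properties as Bool
open import Data.Empty using (⊥)
open import Data.Fin.Base using (Fin; zero; suc; toℕ; fromℕ<)
open import Data.Fin.Properties using (toℕ-injective; toℕ-fromℕ<; toℕ<n)
open import Data.Integer.Base as ℤ using (ℤ)
import Data.Integer.Properties as ℤ
open import Data.List.Base
  using (List; []; _∷_; _++_; map; concatMap; cartesianProduct; filter; length; lookup; sum;
         applyUpTo; allFin; drop; replicate; zip)
import Data.List.Membership.DecPropositional as DecMembership
open import Data.List.Membership.Propositional using (_∈_; _∉_)
open import Data.List.Membership.Propositional.Properties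
import Data.List.Properties as List
open import Data.List.Relation.Unary.All as All using (All; []; _∷_)
import Data.List.Relation.Unary.All.Properties as All
open import Data.List.Relation.Unary.AllPairs as AllPairs using (AllPairs; []; _∷_)
import Data.List.Relation.Unary.AllPairs.Properties as AllPairs
open import Data.List.Relation.Unary.Any using (here; there)
open import Data.List.Relation.Unary.Unique.Propositional using (Unique)
import Data.List.Relation.Unary.Unique.Propositional.Properties as Unique
open import Data.Nat.Base hiding (_!; compare)
open import Data.Nat.Properties
open import Data.Nat.Solver using (module +-*-Solver)
open import Data.Product using (_×_; _,_; proj₁; proj₂; ∃-syntax)
open import Data.Product.Relation.Binary.Lex.Strict using (×-strictTotalOrder)
open import Data.Sum.Base using (_⊎_; inj₁; inj₂)
open import Data.Vec.Base using (Vec; []; _∷_)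
import Data.Vec.Base as Vec
import Data.Vec.Properties as Vec
open import Function.Base using (_∘_; id; const)
open import Function.Bundles using (_⇔_; mk⇔)
open import Relation.Binary.Bundles using (StrictTotalOrder)
open import Relation.Binary.Definitions using (tri<; tri≈; tri>)
open import Relation.Binary.PropositionalEquality
open import Relation.Nullary using (¬_; Dec; yes; no; does; contradiction; _×-dec_; ¬?)
open import Relation.Nullary.Decidable using (dec-true; dec-false)
open import Relation.Unary using (Decidable)

open Box
open DecMembership _≟_ using (_∈?_; _∉?_)

-- Shape matters only through ties. Standardization needs a total order on the boxes carrying equal
-- letters: marked ones are read from right to left, unmarked ones from left to right, and ties
-- within a column go by row. In columns 1 and 2 the conditions on both kinds of tableaux already
-- order the rows from bottom to top; from column 3 on a marked tableau leaves different rows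
-- unrelated. Narrowness resolves this, since it puts all boxes from column 3 on into a single row.
--
-- For K, compositions of n become bit lists of length n - 1, so that peaks, refinement and
-- symmetric differences turn into local conditions at the gaps. The two counts to be compared then
-- obey recursions along the gaps, but equality of the totals is not inductive by itself: it is
-- refined by the state at the boundary, namely whether the last gap was a descent, the last bit of
-- the set, and the marking of the current letter. The state before the first gap counts as a
-- descent, because 1 is never a peak.

private variable
  A B : Set
  α : List ℕ

-- Counting in lists without repetitions

ind : Bool → ℕ
ind true  = 1
ind false = 0

# : (A → Bool) → List A → ℕ
# p []       = 0
# p (x ∷ xs) = ind (p x) + # p xs

length-filter-# : {P : A → Set} (P? : Decidable P) → ∀ xs → length (filter P? xs) ≡ # (does ∘ P?) xs
length-filter-# P? []       = refl
length-filter-# P? (x ∷ xs) with does (P? x)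
... | true  = cong suc (length-filter-# P? xs)
... | false = length-filter-# P? xs

#-cong : {p q : A → Bool} → ∀ xs → (∀ {x} → x ∈ xs → p x ≡ q x) → # p xs ≡ # q xs
#-cong []       eq = refl
#-cong (x ∷ xs) eq = cong₂ _+_ (cong ind (eq (here refl))) (#-cong xs (eq ∘ there))

#-map : (p : B → Bool) (f : A → B) → ∀ xs → # p (map f xs) ≡ # (p ∘ f) xs
#-map p f []       = refl
#-map p f (x ∷ xs) = cong (ind (p (f x)) +_) (#-map p f xs)

#-++ : (p : A → Bool) → ∀ xs ys → # p (xs ++ ys) ≡ # p xs + # p ys
#-++ p []       ys = refl
#-++ p (x ∷ xs) ys = trans (cong (ind (p x) +_) (#-++ p xs ys)) (sym (+-assoc (ind (p x)) _ _))

#-none : (p : A → Bool) → ∀ xs → (∀ {x} → x ∈ xs → p x ≡ false) → # p xs ≡ 0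
#-none p []       eq = refl
#-none p (x ∷ xs) eq rewrite eq (here refl) = #-none p xs (eq ∘ there)

#-≤-length : (p : A → Bool) → ∀ xs → # p xs ≤ length xs
#-≤-length p []       = z≤n
#-≤-length p (x ∷ xs) with p x
... | true  = s≤s (#-≤-length p xs)
... | false = m≤n⇒m≤1+n (#-≤-length p xs)

-- The instance p = const true compares lengths.
#-⊆ : (p : A → Bool) → ∀ {xs ys} → Unique xs → (∀ {x} → x ∈ xs → x ∈ ys) → # p xs ≤ # p ys
#-⊆ p {[]}     _            _  = z≤n
#-⊆ p {x ∷ xs} (x∉xs ∷ xs!) xs⊆ with ∈-∃++ (xs⊆ (here refl))
... | as , bs , refl = begin
    ind (p x) + # p xs               ≤⟨ +-monoʳ-≤ (ind (p x)) (#-⊆ p xs! xs⊆′) ⟩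
    ind (p x) + # p (as ++ bs)       ≡⟨ cong (ind (p x) +_) (#-++ p as bs) ⟩
    ind (p x) + (# p as + # p bs)    ≡⟨ +-assoc (ind (p x)) (# p as) _ ⟨
    ind (p x) + # p as + # p bs      ≡⟨ cong (_+ # p bs) (+-comm (ind (p x)) _) ⟩
    # p as + ind (p x) + # p bs      ≡⟨ +-assoc (# p as) _ _ ⟩
    # p as + # p (x ∷ bs)            ≡⟨ #-++ p as (x ∷ bs) ⟨
    # p (as ++ x ∷ bs)               ∎
  where
  open ≤-Reasoning
  xs⊆′ : ∀ {y} → y ∈ xs → y ∈ as ++ bs
  xs⊆′ y∈xs with ∈-++⁻ as (xs⊆ (there y∈xs))
  ... | inj₁ y∈as         = ∈-++⁺ˡ y∈as
  ... | inj₂ (here refl)  = contradiction refl (All.lookup x∉xs y∈xs)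
  ... | inj₂ (there y∈bs) = ∈-++⁺ʳ as y∈bs

#-true : (xs : List A) → # (const true) xs ≡ length xs
#-true []       = refl
#-true (x ∷ xs) = cong suc (#-true xs)

length-⊆ : {xs ys : List A} → Unique xs → (∀ {x} → x ∈ xs → x ∈ ys) → length xs ≤ length ys
length-⊆ {xs = xs} {ys} xs! xs⊆ys =
  subst₂ _≤_ (#-true xs) (#-true ys) (#-⊆ (const true) xs! xs⊆ys)

#-set : (p : A → Bool) {xs ys : List A} → Unique xs → Unique ys →
        (∀ {x} → x ∈ xs → x ∈ ys) → (∀ {x} → x ∈ ys → x ∈ xs) → # p xs ≡ # p ys
#-set p xs! ys! xs⊆ys ys⊆xs = ≤-antisym (#-⊆ p xs! xs⊆ys) (#-⊆ p ys! ys⊆xs)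

-- A missing y could be put in front of xs, giving a duplicate-free list inside ys that is longer
-- than ys.
unique-full : {xs ys : List A} → (∀ (x y : A) → Dec (x ≡ y)) → Unique xs →
              (∀ {x} → x ∈ xs → x ∈ ys) → length ys ≤ length xs → ∀ {y} → y ∈ ys → y ∈ xs
unique-full {xs = xs} {ys} _≟′_ xs! xs⊆ys len {y} y∈ys with y ∈?′ xs
  where open import Data.List.Membership.DecPropositional _≟′_ renaming (_∈?_ to _∈?′_)
... | yes y∈xs = y∈xs
... | no  y∉xs = contradiction (≤-trans (length-⊆ (All.¬Any⇒All¬ xs y∉xs ∷ xs!) y∷xs⊆ys) len) (n≮n _)
  where
  y∷xs⊆ys : ∀ {x} → x ∈ y ∷ xs → x ∈ ys
  y∷xs⊆ys (here refl) = y∈ys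
  y∷xs⊆ys (there x∈)  = xs⊆ys x∈

map-unique : (f : A → B) {xs : List A} → Unique xs →
             (∀ {x y} → x ∈ xs → y ∈ xs → f x ≡ f y → x ≡ y) → Unique (map f xs)
map-unique f {[]}     _            inj = []
map-unique f {x ∷ xs} (x∉xs ∷ xs!) inj =
  All.map⁺ (All.tabulate λ y∈xs eq →
    All.lookup x∉xs y∈xs (inj (here refl) (there y∈xs) eq))
  ∷ map-unique f xs! (λ x∈ y∈ → inj (there x∈) (there y∈))

length-injection : (f : A → B) {xs : List A} {ys : List B} → Unique xs →
                   (∀ {x} → x ∈ xs → f x ∈ ys) →
                   (∀ {x y} → x ∈ xs → y ∈ xs → f x ≡ f y → x ≡ y) → length xs ≤ length ys
length-injection f {xs} xs! into inj =
  subst (_≤ _) (List.length-map f xs) (length-⊆ (map-unique f xs! inj) λ y∈ →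
    let x , x∈xs , eq = ∈-map⁻ f y∈ in subst (_∈ _) (sym eq) (into x∈xs))

length-bijection : (f : A → B) {xs : List A} {ys : List B} → Unique xs → Unique ys →
                   (∀ {x} → x ∈ xs → f x ∈ ys) →
                   (∀ {x y} → x ∈ xs → y ∈ xs → f x ≡ f y → x ≡ y) →
                   (∀ {y} → y ∈ ys → ∃[ x ] (x ∈ xs × y ≡ f x)) → length xs ≡ length ys
length-bijection f {xs} xs! ys! into inj onto =
  ≤-antisym (length-injection f xs! into inj)
    (subst (_ ≤_) (List.length-map f xs) (length-⊆ ys! λ y∈ →
      let x , x∈xs , eq = onto y∈ in subst (_∈ _) (sym eq) (∈-map⁺ f x∈xs)))

#-cartesianProduct : (p : A × B → Bool) → ∀ xs ys →
                     # p (cartesianProduct xs ys) ≡ sum (map (λ x → # (λ y → p (x , y)) ys) xs)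
#-cartesianProduct p []       ys = refl
#-cartesianProduct p (x ∷ xs) ys =
  trans (#-++ p (map (x ,_) ys) _)
        (cong₂ _+_ (#-map p (x ,_) ys) (#-cartesianProduct p xs ys))

sum-ind : (p : A → Bool) → ∀ xs → sum (map (ind ∘ p) xs) ≡ # p xs
sum-ind p []       = refl
sum-ind p (x ∷ xs) = cong (ind (p x) +_) (sum-ind p xs)

#-filter : {P : A → Set} (P? : Decidable P) (p : A → Bool) → ∀ xs →
           # p (filter P? xs) ≡ # (λ x → does (P? x) ∧ p x) xs
#-filter P? p []       = refl
#-filter P? p (x ∷ xs) with does (P? x)
... | true  = cong (ind (p x) +_) (#-filter P? p xs)
... | false = #-filter P? p xs

#-singleton : (p : A → Bool) → ∀ {xs z} → Unique xs → z ∈ xs → p z ≡ true →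
              (∀ {x} → x ∈ xs → p x ≡ true → x ≡ z) → # p xs ≡ 1
#-singleton p (x∉xs ∷ xs!) (here {xs = xs} refl) pz only rewrite pz =
  cong suc (#-none p _ λ {y} y∈ → none y∈)
  where
  none : ∀ {y} → y ∈ xs → p y ≡ false
  none {y} y∈ with p y in eq
  ... | false = refl
  ... | true  = contradiction (sym (only (there y∈) eq)) (All.lookup x∉xs y∈)
#-singleton p {x ∷ xs} (x∉xs ∷ xs!) (there z∈xs) pz only with p x in eq
... | true  = contradiction (only (here refl) eq) (All.lookup x∉xs z∈xs)
... | false = #-singleton p xs! z∈xs pz (only ∘ there)

-- Compositions as bit lists

-- The default `false` beyond the end lets conditions over all positions, such as `Compatible`, hold
-- there without a bound on the position.
at : List Bool → ℕ → Bool
at []      _       = false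
at (x ∷ b) zero    = x
at (x ∷ b) (suc i) = at b i

at-ext : ∀ {b c} → length b ≡ length c → (∀ i → i < length b → at b i ≡ at c i) → b ≡ c
at-ext {[]}    {[]}    _  _  = refl
at-ext {x ∷ b} {y ∷ c} eq h  =
  cong₂ _∷_ (h 0 (s≤s z≤n)) (at-ext (suc-injective eq) (λ i i< → h (suc i) (s≤s i<)))

at-beyond : ∀ b {i} → length b ≤ i → at b i ≡ false
at-beyond []      _       = refl
at-beyond (x ∷ b) (s≤s l) = at-beyond b l

at-applyUpTo : ∀ f m {i} → i < m → at (applyUpTo f m) i ≡ f i
at-applyUpTo f (suc m) {zero}  _        = refl
at-applyUpTo f (suc m) {suc i} (s≤s i<) = at-applyUpTo (f ∘ suc) m i<

bits : ℕ → List (List Bool)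
bits zero    = [] ∷ []
bits (suc m) = map (true ∷_) (bits m) ++ map (false ∷_) (bits m)

∈-bits⁺ : ∀ b → b ∈ bits (length b)
∈-bits⁺ []          = here refl
∈-bits⁺ (true ∷ b)  = ∈-++⁺ˡ (∈-map⁺ (true ∷_) (∈-bits⁺ b))
∈-bits⁺ (false ∷ b) = ∈-++⁺ʳ (map (true ∷_) (bits (length b))) (∈-map⁺ (false ∷_) (∈-bits⁺ b))

∈-bits⁻ : ∀ m {b} → b ∈ bits m → length b ≡ m
∈-bits⁻ zero    (here refl) = refl
∈-bits⁻ (suc m) b∈ with ∈-++⁻ (map (true ∷_) (bits m)) b∈
... | inj₁ b∈′ with ∈-map⁻ (true ∷_) b∈′
...   | _ , c∈ , refl = cong suc (∈-bits⁻ m c∈)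
∈-bits⁻ (suc m) b∈ | inj₂ b∈′ with ∈-map⁻ (false ∷_) b∈′
...   | _ , c∈ , refl = cong suc (∈-bits⁻ m c∈)

bits-unique : ∀ m → Unique (bits m)
bits-unique zero    = [] ∷ []
bits-unique (suc m) =
  Unique.++⁺ (Unique.map⁺ List.∷-injectiveʳ (bits-unique m))
      (Unique.map⁺ List.∷-injectiveʳ (bits-unique m))
    λ { (p , q) → case (∈-map⁻ (true ∷_) p) (∈-map⁻ (false ∷_) q) }
  where
  case : ∀ {v : List Bool} → ∃[ x ] (x ∈ bits m × v ≡ true ∷ x) → ∃[ x ] (x ∈ bits m × v ≡ false ∷ x) →
         ⊥
  case (_ , _ , refl) (_ , _ , ())

-- The composition of length b + 1 in which bit i of b (counted from 0) tells whether
-- i + 1 belongs to its set.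
decode : List Bool → List ℕ
decode []          = 1 ∷ []
decode (true  ∷ b) = 1 ∷ decode b
decode (false ∷ b) = incrementFirst (decode b)

decode-∷ : ∀ b → ∃[ a ] ∃[ r ] (decode b ≡ suc a ∷ r)
decode-∷ []          = 0 , [] , refl
decode-∷ (true ∷ b)  = 0 , decode b , refl
decode-∷ (false ∷ b) with decode b | decode-∷ b
... | _ | a , r , refl = suc a , r , refl

compositions-decode : ∀ m → compositions (suc m) ≡ map decode (bits m)
compositions-decode zero    = refl
compositions-decode (suc m) rewrite compositions-decode m =
  trans (cong₂ _++_ (shift (1 ∷_) (true ∷_) (λ _ → refl))
      (shift incrementFirst (false ∷_) (λ _ → refl)))
        (sym (List.map-++ decode (map (true ∷_) (bits m)) _))
  where
  shift : ∀ f g → (∀ b → f (decode b) ≡ decode (g b)) → map f (map decode (bits m)) ≡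
          map decode (map g (bits m))
  shift f g eq = trans (sym (List.map-∘ (bits m)))
      (trans (List.map-cong eq (bits m)) (List.map-∘ (bits m)))

decode-composition : ∀ b → Composition (decode b)
decode-composition []          = s≤s z≤n ∷ []
decode-composition (true ∷ b)  = s≤s z≤n ∷ decode-composition b
decode-composition (false ∷ b) with decode b | decode-composition b
... | []    | []     = []
... | _ ∷ _ | _ ∷ ps = s≤s z≤n ∷ ps

sum-decode : ∀ b → sum (decode b) ≡ suc (length b)
sum-decode []          = refl
sum-decode (true ∷ b)  = cong suc (sum-decode b)
sum-decode (false ∷ b) with decode b | decode-∷ b | sum-decode b
... | _ | _ , _ , refl | eq = cong suc eq

decode-surjective : ∀ m {γ} → Composition γ → sum γ ≡ suc m → ∃[ g ] (length g ≡ m × decode g ≡ γ)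
decode-surjective m       {suc zero ∷ []}           _            refl = [] , refl , refl
decode-surjective (suc m) {suc zero ∷ γ@(_ ∷ _)}    (_ ∷ γ>0)    eq   =
  let g , len , dec = decode-surjective m γ>0 (suc-injective eq)
  in  true ∷ g , cong suc len , cong (1 ∷_) dec
decode-surjective zero    {suc zero ∷ suc _ ∷ _}    _            ()
decode-surjective zero    {suc zero ∷ zero ∷ _}     (_ ∷ () ∷ _) _
decode-surjective zero    {suc (suc a) ∷ γ}         _            ()
decode-surjective zero    {zero ∷ _}                (() ∷ _)     _
decode-surjective (suc m) {suc (suc a) ∷ γ}         (_ ∷ γ>0)    eq   =
  let g , len , dec = decode-surjective m {suc a ∷ γ} (s≤s z≤n ∷ γ>0) (suc-injective eq)
  in  false ∷ g , cong suc len , cong incrementFirst dec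

pos : List Bool → List ℕ
pos []          = []
pos (true ∷ b)  = 1 ∷ map suc (pos b)
pos (false ∷ b) = map suc (pos b)

set-incrementFirst : ∀ a α → set (suc a ∷ α) ≡ map suc (set (a ∷ α))
set-incrementFirst a []      = refl
set-incrementFirst a (b ∷ α) = cong (suc a ∷_) (List.map-∘ (set (b ∷ α)))

set-decode : ∀ b → set (decode b) ≡ pos b
set-decode []          = refl
set-decode (true ∷ b) with decode b | decode-∷ b | set-decode b
... | _ | _ , _ , refl | eq = cong (λ X → 1 ∷ map suc X) eq
set-decode (false ∷ b) with decode b | decode-∷ b | set-decode b
... | _ | a , r , refl | eq = trans (set-incrementFirst (suc a) r) (cong (map suc) eq)

∈-pos⁺ : ∀ b i → at b i ≡ true → suc i ∈ pos b
∈-pos⁺ (true ∷ b)  zero    _  = here refl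
∈-pos⁺ (true ∷ b)  (suc i) eq = there (∈-map⁺ suc (∈-pos⁺ b i eq))
∈-pos⁺ (false ∷ b) (suc i) eq = ∈-map⁺ suc (∈-pos⁺ b i eq)

0∉pos : ∀ b → 0 ∉ pos b
0∉pos (true ∷ b)  (there 0∈) with ∈-map⁻ suc 0∈
... | _ , _ , ()
0∉pos (false ∷ b) 0∈ with ∈-map⁻ suc 0∈
... | _ , _ , ()

∈-pos⁻ : ∀ b i → suc i ∈ pos b → at b i ≡ true
∈-pos⁻ (true ∷ b) zero i∈ = refl
∈-pos⁻ (true ∷ b) (suc i) (there i∈) with ∈-map⁻ suc i∈
... | _ , j∈ , refl = ∈-pos⁻ b i j∈
∈-pos⁻ (false ∷ b) i i∈ with ∈-map⁻ suc i∈
∈-pos⁻ (false ∷ b) zero    i∈ | _ , j∈ , refl = contradiction j∈ (0∉pos b)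
∈-pos⁻ (false ∷ b) (suc i) i∈ | _ , j∈ , refl = ∈-pos⁻ b i j∈

filter-map : {A B : Set} {P : B → Set} (P? : Decidable P) (f : A → B) → ∀ xs →
             filter P? (map f xs) ≡ map f (filter (P? ∘ f) xs)
filter-map P? f []       = refl
filter-map P? f (x ∷ xs) with does (P? (f x))
... | true  = cong (f x ∷_) (filter-map P? f xs)
... | false = filter-map P? f xs

filter-pos : {P : ℕ → Set} (P? : Decidable P) → ∀ m →
             filter P? [1⋯ m ] ≡ pos (applyUpTo (does ∘ P? ∘ suc) m)
filter-pos P? zero    = refl
filter-pos P? (suc m)
  with does (P? 1)
     | trans (cong (filter P?) (sym (List.map-applyUpTo suc suc m)))
             (trans (filter-map P? suc [1⋯ m ]) (cong (map suc) (filter-pos (P? ∘ suc) m)))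
... | true  | eq = cong (1 ∷_) eq
... | false | eq = eq

-- Refinement as inclusion of sets

Refines-sum : ∀ {β α} → β Refines α → sum β ≡ sum α
Refines-sum done                          = refl
Refines-sum (keep {a} r)                  = cong (a +_) (Refines-sum r)
Refines-sum (merge {b} {c} {β} r)         = trans (sym (+-assoc b c (sum β))) (Refines-sum r)

Refines-head : ∀ {b β a α} → (b ∷ β) Refines (a ∷ α) → b ≤ a
Refines-head (keep r)            = ≤-refl
Refines-head (merge {b} {c} r)   = ≤-trans (m≤m+n b c) (Refines-head r)

Refines-increment⁺ : ∀ {b β a α} → (b ∷ β) Refines (a ∷ α) → (suc b ∷ β) Refines (suc a ∷ α)
Refines-increment⁺ (keep r)  = keep r
Refines-increment⁺ (merge r) = merge (Refines-increment⁺ r)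

Refines-increment⁻ : ∀ {b β a α} → (suc b ∷ β) Refines (suc a ∷ α) → (b ∷ β) Refines (a ∷ α)
Refines-increment⁻ (keep r)  = keep r
Refines-increment⁻ (merge r) = merge (Refines-increment⁻ r)

-- A part 1 opened by g either is opened by b as well (`keep`) or is absorbed into the first part of
-- the coarser composition (`merge`). If neither list opens a part, both first parts grow by 1.
Refines-decode⁺ : ∀ g b → length g ≡ length b → (∀ i → at b i ≡ true → at g i ≡ true) →
                  decode g Refines decode b
Refines-decode⁺ []          []          _   _ = keep done
Refines-decode⁺ (true ∷ g)  (true ∷ b)  len h = keep (Refines-decode⁺ g b (suc-injective len) (h ∘ suc))
Refines-decode⁺ (true ∷ g)  (false ∷ b) len h
  with decode g | decode-∷ g | decode b | decode-∷ b | Refines-decode⁺ g b (suc-injective len) (h ∘ suc)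
... | _ | _ , _ , refl | _ | _ , _ , refl | r = merge (Refines-increment⁺ r)
Refines-decode⁺ (false ∷ g) (true ∷ b)  len h = contradiction (h 0 refl) λ ()
Refines-decode⁺ (false ∷ g) (false ∷ b) len h
  with decode g | decode-∷ g | decode b | decode-∷ b | Refines-decode⁺ g b (suc-injective len) (h ∘ suc)
... | _ | _ , _ , refl | _ | _ , _ , refl | r = Refines-increment⁺ r

Refines-decode⁻ : ∀ g b → length g ≡ length b → decode g Refines decode b →
                  ∀ i → at b i ≡ true → at g i ≡ true
Refines-decode⁻ (true ∷ g)  (y ∷ b)     len r         zero    eq = refl
Refines-decode⁻ (true ∷ g)  (true ∷ b)  len r         (suc i) eq =
  Refines-decode⁻ g b (suc-injective len) (drop-1 r) i eq
  where
  drop-1 : (1 ∷ decode g) Refines (1 ∷ decode b) → decode g Refines decode b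
  drop-1 r with decode g | decode-∷ g
  drop-1 (keep r)  | _ | _ , _ , refl = r
  drop-1 (merge r) | _ | _ , _ , refl with Refines-head r
  ... | s≤s ()
Refines-decode⁻ (true ∷ g)  (false ∷ b) len r         (suc i) eq =
  Refines-decode⁻ g b (suc-injective len) (drop-1 r) i eq
  where
  drop-1 : (1 ∷ decode g) Refines incrementFirst (decode b) → decode g Refines decode b
  drop-1 r with decode g | decode-∷ g | decode b | decode-∷ b
  drop-1 (merge r) | _ | _ , _ , refl | _ | _ , _ , refl = Refines-increment⁻ r
Refines-decode⁻ (false ∷ g) (true ∷ b)  len r         i       eq
  with decode g | decode-∷ g
... | _ | _ , _ , refl with Refines-head r
...   | s≤s ()
Refines-decode⁻ (false ∷ g) (false ∷ b) len r         (suc i) eq =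
  Refines-decode⁻ g b (suc-injective len) (drop-increment r) i eq
  where
  drop-increment : incrementFirst (decode g) Refines incrementFirst (decode b) →
                   decode g Refines decode b
  drop-increment r with decode g | decode-∷ g | decode b | decode-∷ b
  ... | _ | _ , _ , refl | _ | _ , _ , refl = Refines-increment⁻ r

-- Comparing sets with markings along the gaps

-- Gaps between consecutive letters of a word: whether the gap is a descent, and whether
-- the index of the letters increases there.
Gaps : Set
Gaps = List (Bool × Bool)

-- Bit lists below the second components that change at each peak of the descents,
-- given the descent bit d and the bit s preceding the first gap.
toggles : Bool → Bool → Gaps → List Bool → Bool
toggles d s ((d′ , g) ∷ gs) (x ∷ b) = (not x ∨ g) ∧ (not d′ ∨ d ∨ (x xor s)) ∧ toggles d′ x gs b
toggles d s _               _       = true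

-- Where the index stays constant, a descent must follow a marked letter and an ascent
-- must precede an unmarked one.
chain : Bool → Gaps → List Bool → Bool
chain u ((d , g) ∷ gs) (u′ ∷ us) = (g ∨ (if d then u else not u′)) ∧ chain u′ gs us
chain u _              _         = true

peaks : Bool → Gaps → ℕ
peaks d []              = 0
peaks d ((d′ , _) ∷ gs) = ind (d′ ∧ not d) + peaks d′ gs

#-bits-suc : (p : List Bool → Bool) → ∀ m →
             # p (bits (suc m)) ≡ # (p ∘ (true ∷_)) (bits m) + # (p ∘ (false ∷_)) (bits m)
#-bits-suc p m = trans (#-++ p (map (true ∷_) (bits m)) _)
                       (cong₂ _+_ (#-map p (true ∷_) (bits m)) (#-map p (false ∷_) (bits m)))

#-false : {A : Set} (xs : List A) → # (const false) xs ≡ 0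
#-false xs = #-none (const false) xs (λ _ → refl)

-- t counts the sets occurring in the definition of K, up to a factor 2 for each peak, and c
-- the markings.
record Transfer (gs : Gaps) : Set where
  private
    t : Bool → Bool → ℕ
    t d s = # (toggles d s gs) (bits (length gs))
    c : Bool → ℕ
    c u = # (chain u gs) (bits (length gs))
  field
    after-descent : ∀ s → 2 * (2 ^ peaks true gs * t true s) ≡ c true + c false
    after-ascent  : 2 ^ peaks false gs * t false false ≡ c false
    after-ascents : 2 ^ peaks false gs * (t false false + t false true) ≡ c true + c false

open Transfer

-- Induction from the last gap backwards. Where the index increases, consecutive markings are
-- independent. Where it stays constant, the bit of the set is 0 and one marking is forced: the left
-- one at a descent, the right one at an ascent. At a peak the bit is determined by its predecessor,
-- and the factor 2 for the peak replaces the lost choice. After an ascent the next gap may be a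
-- peak, so the count depends on the preceding bit and two identities are carried.
transfer : ∀ gs → Transfer gs
transfer [] = record { after-descent = λ _ → refl ; after-ascent = refl ; after-ascents = refl }
transfer ((d , g) ∷ gs) = record
  { after-descent = λ s →
      subst₂ (λ x y → 2 * (2 ^ peaks true ((d , g) ∷ gs) * x) ≡ y)
        (sym (#-bits-suc (toggles true s ((d , g) ∷ gs)) m))
        (sym (cong₂ _+_ (#-bits-suc (chain true ((d , g) ∷ gs)) m)
            (#-bits-suc (chain false ((d , g) ∷ gs)) m)))
        (descent d g (transfer gs) s)
  ; after-ascent =
      subst₂ (λ x y → 2 ^ peaks false ((d , g) ∷ gs) * x ≡ y)
        (sym (#-bits-suc (toggles false false ((d , g) ∷ gs)) m))
        (sym (#-bits-suc (chain false ((d , g) ∷ gs)) m))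
        (ascent d g (transfer gs))
  ; after-ascents =
      subst₂ (λ x y → 2 ^ peaks false ((d , g) ∷ gs) * x ≡ y)
        (sym (cong₂ _+_ (#-bits-suc (toggles false false ((d , g) ∷ gs)) m)
                        (#-bits-suc (toggles false true ((d , g) ∷ gs)) m)))
        (sym (cong₂ _+_ (#-bits-suc (chain true ((d , g) ∷ gs)) m)
            (#-bits-suc (chain false ((d , g) ∷ gs)) m)))
        (ascents d g (transfer gs))
  }
  where
  open +-*-Solver
  m = length gs
  bs = bits m

  t : Bool → Bool → Bool → Bool → Bool → ℕ
  t d g d₀ s x = # (toggles d₀ s ((d , g) ∷ gs) ∘ (x ∷_)) bs
  c : Bool → Bool → Bool → Bool → ℕ
  c d g u x = # (chain u ((d , g) ∷ gs) ∘ (x ∷_)) bs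

  twice : ∀ k a b c → 2 * (k * a) ≡ c → 2 * (k * b) ≡ c → 2 * (k * (a + b)) ≡ c + c
  twice k a b c p q =
    trans (solve 3 (λ k a b → con 2 :* (k :* (a :+ b)) := con 2 :* (k :* a) :+ con 2 :* (k :* b)) refl k
        a b)
          (cong₂ _+_ p q)

  double : ∀ k a c → k * a ≡ c → 2 * (k * a) ≡ c + c
  double k a c p = trans (cong (2 *_) p) (cong (c +_) (+-identityʳ c))

  descent : ∀ d g → Transfer gs → ∀ s →
            2 * (2 ^ peaks true ((d , g) ∷ gs) * (t d g true s true + t d g true s false)) ≡
            (c d g true true + c d g true false) + (c d g false true + c d g false false)
  descent true true  tr s =
    twice (2 ^ peaks true gs) _ _ _ (after-descent tr true) (after-descent tr false)
  descent true false tr s rewrite #-false bs = trans (after-descent tr false) (sym (+-identityʳ _))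
  descent false true tr s =
    double (2 ^ peaks false gs) _ _
        (trans (cong (2 ^ peaks false gs *_) (+-comm (# (toggles false true gs) bs) _))
            (after-ascents tr))
  descent false false tr s rewrite #-false bs = double (2 ^ peaks false gs) _ _ (after-ascent tr)

  ascent : ∀ d g → Transfer gs →
           2 ^ peaks false ((d , g) ∷ gs) * (t d g false false true + t d g false false false) ≡
           c d g false true + c d g false false
  ascent true true  tr rewrite #-false bs | +-identityʳ (# (toggles true true gs) bs) =
    trans (*-assoc 2 (2 ^ peaks true gs) _) (after-descent tr true)
  ascent true false tr rewrite #-false bs = *-zeroʳ (2 ^ suc (peaks true gs))
  ascent false true tr =
    trans (cong (2 ^ peaks false gs *_) (+-comm (# (toggles false true gs) bs) _)) (after-ascents tr)
  ascent false false tr rewrite #-false bs = after-ascent tr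

  ascents : ∀ d g → Transfer gs →
            2 ^ peaks false ((d , g) ∷ gs) * ((t d g false false true + t d g false false false) +
                                              (t d g false true true + t d g false true false)) ≡
            (c d g true true + c d g true false) + (c d g false true + c d g false false)
  ascents true true  tr rewrite #-false bs | +-identityʳ (# (toggles true true gs) bs) =
    trans (*-assoc 2 (2 ^ peaks true gs) _)
          (twice (2 ^ peaks true gs) _ _ _ (after-descent tr true) (after-descent tr false))
  ascents true false tr rewrite #-false bs =
    trans (*-assoc 2 (2 ^ peaks true gs) _) (trans (after-descent tr false) (sym (+-identityʳ _)))
  ascents false true tr =
    trans (*-distribˡ-+ (2 ^ peaks false gs)
        (# (toggles false true gs) bs + # (toggles false false gs) bs) _)
          (cong₂ _+_ eq eq)
    where eq = trans (cong (2 ^ peaks false gs *_) (+-comm (# (toggles false true gs) bs) _))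
            (after-ascents tr)
  ascents false false tr rewrite #-false bs =
    trans (*-distribˡ-+ (2 ^ peaks false gs) (# (toggles false false gs) bs) _)
          (cong₂ _+_ (after-ascent tr) (after-ascent tr))

#-chains : ∀ gs → 2 * (2 ^ peaks true gs * # (toggles true true gs) (bits (length gs))) ≡
           # (chain true gs) (bits (length gs)) + # (chain false gs) (bits (length gs))
#-chains gs = after-descent (transfer gs) true

-- Peaks and symmetric differences of bit lists

bool-ext : ∀ {a b} → (a ≡ true → b ≡ true) → (b ≡ true → a ≡ true) → a ≡ b
bool-ext {true}  f g = sym (f refl)
bool-ext {false} {false} f g = refl
bool-ext {false} {true}  f g = g refl

does⁻ : {P : Set} (P? : Dec P) → does P? ≡ true → P
does⁻ (yes p) _ = p

∧⁻ : ∀ {a b} → a ∧ b ≡ true → a ≡ true × b ≡ true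
∧⁻ {true} eq = refl , eq

∧⁺ : ∀ {a b} → a ≡ true → b ≡ true → a ∧ b ≡ true
∧⁺ refl refl = refl

toggles⁺ : ∀ d s ds g b → length ds ≡ length g → length b ≡ length g →
           (∀ i → at b i ≡ true → at g i ≡ true) →
           (∀ i → at ds i ≡ true → at (d ∷ ds) i ≡ false → at b i ≢ at (s ∷ b) i) →
           toggles d s (zip ds g) b ≡ true
toggles⁺ d s []        []       b       _  _   _ _ = refl
toggles⁺ d s (d′ ∷ ds) (g ∷ gs) (x ∷ b) l₁ l₂ p q =
  ∧⁺ (below x g (p 0)) (∧⁺ (toggle d′ d x s (q 0))
    (toggles⁺ d′ x ds gs b (suc-injective l₁) (suc-injective l₂) (p ∘ suc) (q ∘ suc)))
  where
  below : ∀ x g → (x ≡ true → g ≡ true) → not x ∨ g ≡ true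
  below true  g h = h refl
  below false g h = refl
  toggle : ∀ d′ d x s → (d′ ≡ true → d ≡ false → x ≢ s) → not d′ ∨ d ∨ (x xor s) ≡ true
  toggle false d     x     s     h = refl
  toggle true  true  x     s     h = refl
  toggle true  false true  true  h = contradiction refl (h refl refl)
  toggle true  false true  false h = refl
  toggle true  false false true  h = refl
  toggle true  false false false h = contradiction refl (h refl refl)

toggles⁻ : ∀ d s ds g b → length ds ≡ length g → length b ≡ length g →
           toggles d s (zip ds g) b ≡ true →
           (∀ i → at b i ≡ true → at g i ≡ true) ×
           (∀ i → at ds i ≡ true → at (d ∷ ds) i ≡ false → at b i ≢ at (s ∷ b) i)
toggles⁻ d s []        []       []      _  _  _  = (λ _ ()) , (λ _ ())
toggles⁻ d s (d′ ∷ ds) (g ∷ gs) (x ∷ b) l₁ l₂ eq =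
  (λ { zero → below x g (proj₁ (∧⁻ eq)) ; (suc i) → proj₁ rec i }) ,
  (λ { zero → toggle d′ d x s (proj₁ (∧⁻ (proj₂ (∧⁻ {not x ∨ g} eq)))) ; (suc i) → proj₂ rec i })
  where
  rec = toggles⁻ d′ x ds gs b (suc-injective l₁) (suc-injective l₂)
          (proj₂ (∧⁻ {not d′ ∨ d ∨ (x xor s)} (proj₂ (∧⁻ {not x ∨ g} eq))))
  below : ∀ x g → not x ∨ g ≡ true → x ≡ true → g ≡ true
  below true g h _ = h
  toggle : ∀ d′ d x s → not d′ ∨ d ∨ (x xor s) ≡ true → d′ ≡ true → d ≡ false → x ≢ s
  toggle true false true  .true  () refl refl refl
  toggle true false false .false () refl refl refl

chain⁺ : ∀ u ds g us → length ds ≡ length g → length us ≡ length g →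
         (∀ i → at g i ≡ false → (at ds i ≡ true → at (u ∷ us) i ≡ true) ×
                                 (at ds i ≡ false → at us i ≡ false)) →
         chain u (zip ds g) us ≡ true
chain⁺ u []       []       us        _  _  h = refl
chain⁺ u (d ∷ ds) (g ∷ gs) (u′ ∷ us) l₁ l₂ h =
  ∧⁺ (step g d u u′ (h 0)) (chain⁺ u′ ds gs us (suc-injective l₁) (suc-injective l₂) (h ∘ suc))
  where
  step : ∀ g d u u′ → (g ≡ false → (d ≡ true → u ≡ true) × (d ≡ false → u′ ≡ false)) →
         g ∨ (if d then u else not u′) ≡ true
  step true  d     u u′ h = refl
  step false true  u u′ h = proj₁ (h refl) refl
  step false false u u′ h = cong not (proj₂ (h refl) refl)

chain⁻ : ∀ u ds g us → length ds ≡ length g → length us ≡ length g →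
         chain u (zip ds g) us ≡ true →
         ∀ i → at g i ≡ false → (at ds i ≡ true → at (u ∷ us) i ≡ true) ×
                                (at ds i ≡ false → at us i ≡ false)
chain⁻ u []       []       []        _  _  _  i       _  = (λ ()) , λ _ → refl
chain⁻ u (d ∷ ds) (g ∷ gs) (u′ ∷ us) l₁ l₂ eq zero    g≡ = step g d u u′ (proj₁ (∧⁻ eq)) g≡
  where
  step : ∀ g d u u′ → g ∨ (if d then u else not u′) ≡ true → g ≡ false →
         (d ≡ true → u ≡ true) × (d ≡ false → u′ ≡ false)
  step false true  u u′    h _ = (λ _ → h) , λ ()
  step false false u false h _ = (λ ()) , λ _ → refl
chain⁻ u (d ∷ ds) (g ∷ gs) (u′ ∷ us) l₁ l₂ eq (suc i) g≡ =
  chain⁻ u′ ds gs us (suc-injective l₁) (suc-injective l₂)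
    (proj₂ (∧⁻ {g ∨ (if d then u else not u′)} eq)) i g≡

∈-△-pos⁺ : ∀ b c i → at b i ≢ at c i → suc i ∈ (pos b △ pos c)
∈-△-pos⁺ b c i neq with at b i in b≡ | at c i in c≡
... | true  | true  = contradiction refl neq
... | false | false = contradiction refl neq
... | true  | false = ∈-++⁺ˡ (∈-filter⁺ (_∉? pos c) (∈-pos⁺ b i b≡)
                        λ i∈ → contradiction (trans (sym (∈-pos⁻ c i i∈)) c≡) λ ())
... | false | true  = ∈-++⁺ʳ (filter (_∉? pos c) (pos b)) (∈-filter⁺ (_∉? pos b) (∈-pos⁺ c i c≡)
                        λ i∈ → contradiction (trans (sym (∈-pos⁻ b i i∈)) b≡) λ ())

∈-△-pos⁻ : ∀ b c i → suc i ∈ (pos b △ pos c) → at b i ≢ at c i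
∈-△-pos⁻ b c i i∈ eq with ∈-++⁻ (filter (_∉? pos c) (pos b)) i∈
... | inj₁ i∈′ = let i∈b , i∉c = ∈-filter⁻ (_∉? pos c) {xs = pos b} i∈′ in
                 i∉c (∈-pos⁺ c i (trans (sym eq) (∈-pos⁻ b i i∈b)))
... | inj₂ i∈′ = let i∈c , i∉b = ∈-filter⁻ (_∉? pos b) {xs = pos c} i∈′ in
                 i∉b (∈-pos⁺ b i (trans eq (∈-pos⁻ c i i∈c)))

isPeak? : ∀ X → Decidable (λ i → (i ∸ 1 ∉ X) × (i ≢ 1))
isPeak? X i = (i ∸ 1 ∉? X) ×-dec ¬? (i ≟ 1)

∈-Peak-pos⁺ : ∀ ds i → at ds i ≡ true → at (true ∷ ds) i ≡ false → suc i ∈ Peak (pos ds)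
∈-Peak-pos⁺ ds (suc i) eq eq′ = ∈-filter⁺ (isPeak? (pos ds)) (∈-pos⁺ ds (suc i) eq)
  ((λ i∈ → contradiction (trans (sym (∈-pos⁻ ds i i∈)) eq′) λ ()) , λ ())

∈-Peak-pos⁻ : ∀ ds i → suc i ∈ Peak (pos ds) → at ds i ≡ true × at (true ∷ ds) i ≡ false
∈-Peak-pos⁻ ds i i∈ with ∈-filter⁻ (isPeak? (pos ds)) {xs = pos ds} i∈
∈-Peak-pos⁻ ds zero    i∈ | i∈pos , _ , ≢1 = contradiction refl ≢1
∈-Peak-pos⁻ ds (suc i) i∈ | i∈pos , ∉ , _  =
  ∈-pos⁻ ds (suc i) i∈pos , Bool.¬-not λ eq → ∉ (∈-pos⁺ ds i eq)

Peak-⊆ : ∀ {X i} → i ∈ Peak X → i ∈ X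
Peak-⊆ {X} = proj₁ ∘ ∈-filter⁻ (isPeak? X)

-- `K` takes the peaks of a set that is itself a set of peaks. Nothing is lost: i - 1 lies outside
-- X, hence outside the smaller set `Peak X`.
Peak-idempotent : ∀ X → Peak (Peak X) ≡ Peak X
Peak-idempotent X = List.filter-all (isPeak? (Peak X)) (All.tabulate λ i∈ →
  let _ , ∉X , ≢1 = ∈-filter⁻ (isPeak? X) {xs = X} i∈ in (∉X ∘ Peak-⊆) , ≢1)

#-pos-peaks : ∀ d ds g → length ds ≡ length g →
              # (λ j → not (at (d ∷ ds) (j ∸ 1))) (pos ds) ≡ peaks d (zip ds g)
#-pos-peaks d []        []       _   = refl
#-pos-peaks d (d′ ∷ ds) (g ∷ gs) len = trans (first d′) (cong (ind (d′ ∧ not d) +_)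
    (trans (#-map _ suc (pos ds))
        (trans (#-cong (pos ds) shift) (#-pos-peaks d′ ds gs (suc-injective len)))))
  where
  p : ℕ → Bool
  p j = not (at (d ∷ d′ ∷ ds) (j ∸ 1))
  first : ∀ d′ → # p (pos (d′ ∷ ds)) ≡ ind (d′ ∧ not d) + # p (map suc (pos ds))
  first true  = refl
  first false = refl
  shift : ∀ {j} → j ∈ pos ds → p (suc j) ≡ not (at (d′ ∷ ds) (j ∸ 1))
  shift {zero}  0∈ = contradiction 0∈ (0∉pos ds)
  shift {suc j} _  = refl

length-Peak-pos : ∀ ds g → length ds ≡ length g → length (Peak (pos ds)) ≡ peaks true (zip ds g)
length-Peak-pos ds g len =
  trans (length-filter-# (isPeak? (pos ds)) (pos ds))
        (trans (#-cong (pos ds) agree) (#-pos-peaks true ds g len))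
  where
  agree : ∀ {j} → j ∈ pos ds → does (isPeak? (pos ds) j) ≡ not (at (true ∷ ds) (j ∸ 1))
  agree {zero}        0∈ = contradiction 0∈ (0∉pos ds)
  agree {suc zero}    _  = dec-false (isPeak? (pos ds) 1) λ (_ , ≢1) → ≢1 refl
  agree {suc (suc j)} _  with at ds j in eq
  ... | true  = dec-false (isPeak? (pos ds) (suc (suc j))) λ (∉ , _) → ∉ (∈-pos⁺ ds j eq)
  ... | false = dec-true (isPeak? (pos ds) (suc (suc j)))
                  ((λ j∈ → contradiction (trans (sym (∈-pos⁻ ds j j∈)) eq) λ ()) , λ ())

pos-sorted : ∀ b → AllPairs _<_ (pos b)
pos-sorted []          = []
pos-sorted (true ∷ b)  =
  All.map⁺ (All.tabulate λ { {zero} 0∈ → contradiction 0∈ (0∉pos b) ; {suc _} _ → s≤s (s≤s z≤n) })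
  ∷ AllPairs.map⁺ (AllPairs.map s≤s (pos-sorted b))
pos-sorted (false ∷ b) = AllPairs.map⁺ (AllPairs.map s≤s (pos-sorted b))

pos-≤ : ∀ b → All (_≤ length b) (pos b)
pos-≤ []          = []
pos-≤ (true ∷ b)  = s≤s z≤n ∷ All.map⁺ (All.map s≤s (pos-≤ b))
pos-≤ (false ∷ b) = All.map⁺ (All.map s≤s (pos-≤ b))

-- The local function `go` of `comp`.
compFrom : ℕ → ℕ → List ℕ → List ℕ
compFrom n x X = drop 1 (comp n (x ∷ X))

-- The parts are differences of consecutive elements, so their partial sums telescope; x is where
-- the measuring starts.
set-compFrom : ∀ n x X → AllPairs _<_ (x ∷ X) → map (x +_) (set (compFrom n x X)) ≡ X
set-compFrom n x []           _                  = refl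
set-compFrom n x (y ∷ [])     ((x<y ∷ _) ∷ _)    = cong (_∷ []) (m+[n∸m]≡n (<⇒≤ x<y))
set-compFrom n x (y ∷ z ∷ X) ((x<y ∷ _) ∷ sorted) =
  cong₂ _∷_ x+[y∸x] (trans (sym (List.map-∘ (set (compFrom n y (z ∷ X)))))
    (trans (List.map-cong (λ i → trans (sym (+-assoc x (y ∸ x) i)) (cong (_+ i) x+[y∸x]))
        (set (compFrom n y (z ∷ X))))
           (set-compFrom n y (z ∷ X) sorted)))
  where x+[y∸x] = m+[n∸m]≡n (<⇒≤ x<y)

set-comp : ∀ n X → AllPairs _<_ X → set (comp n X) ≡ X
set-comp n []          _      = refl
set-comp n (x ∷ [])    _      = refl
set-comp n (x ∷ y ∷ X) sorted = cong (x ∷_) (set-compFrom n x (y ∷ X) sorted)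

sum-compFrom : ∀ n x X → AllPairs _<_ (x ∷ X) → All (_≤ n) (x ∷ X) → x + sum (compFrom n x X) ≡ n
sum-compFrom n x []      _                     (x≤n ∷ _) = trans (cong (x +_) (+-identityʳ _))
    (m+[n∸m]≡n x≤n)
sum-compFrom n x (y ∷ X) ((x<y ∷ _) ∷ sorted) (_ ∷ ≤n)  =
  trans (sym (+-assoc x (y ∸ x) _))
        (trans (cong (_+ sum (compFrom n y X)) (m+[n∸m]≡n (<⇒≤ x<y))) (sum-compFrom n y X sorted ≤n))

sum-comp : ∀ n X → AllPairs _<_ X → All (_≤ n) X → sum (comp n X) ≡ n
sum-comp n []      _      _  = +-identityʳ n
sum-comp n (x ∷ X) sorted ≤n = sum-compFrom n x X sorted ≤n

-- Coefficients of M, F and K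

_≟ᶜ_ : (α β : List ℕ) → Dec (α ≡ β)
_≟ᶜ_ = List.≡-dec _≟_

omitZeros-composition : ∀ e → Composition (omitZeros e)
omitZeros-composition e = All.map n≢0⇒n>0 (All.all-filter (λ u → ¬? (u ≟ 0)) e)

#-≟-∷ : ∀ x e y αs → # (does ∘ ((x ∷ e) ≟ᶜ_)) (map (y ∷_) αs) ≡
        # (λ α → does (x ≟ y) ∧ does (e ≟ᶜ α)) αs
#-≟-∷ x e y αs = #-map (does ∘ ((x ∷ e) ≟ᶜ_)) (y ∷_) αs

-- As the parts of α are positive, the support of e determines the only possible choice of i₁ < ⋯ <
-- iₖ.
M-coefficient : ∀ {α} → Composition α → ∀ e → M α e ≡ ind (does (omitZeros e ≟ᶜ α))
M-coefficient {α} α>0 e =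
  trans (length-filter-# (e ≟ᶜ_) (monomials (length e) α)) (count e α>0)
  where
  count : ∀ e {α} → Composition α → # (does ∘ (e ≟ᶜ_)) (monomials (length e) α) ≡
          ind (does (omitZeros e ≟ᶜ α))
  count []          []      = refl
  count []          (_ ∷ _) = refl
  count (zero ∷ e)  {[]}        []        = trans (#-≟-∷ 0 e 0 (monomials (length e) [])) (count e [])
  count (suc x ∷ e) {[]}        []        =
    trans (#-≟-∷ (suc x) e 0 (monomials (length e) [])) (#-false (monomials (length e) []))
  count (zero ∷ e)  {suc a ∷ α} (p ∷ α>0) =
      trans (#-++ _ (map (0 ∷_) (monomials (length e) (suc a ∷ α))) _)
    (trans (cong₂ _+_ (trans (#-≟-∷ 0 e 0 (monomials (length e) (suc a ∷ α))) (count e (p ∷ α>0)))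
                      (trans (#-≟-∷ 0 e (suc a) (monomials (length e) α))
                          (#-false (monomials (length e) α))))
           (+-identityʳ _))
  count (suc x ∷ e) {suc a ∷ α} (p ∷ α>0) =
      trans (#-++ _ (map (0 ∷_) (monomials (length e) (suc a ∷ α))) _)
    (cong₂ _+_ (trans (#-≟-∷ (suc x) e 0 (monomials (length e) (suc a ∷ α)))
        (#-false (monomials (length e) (suc a ∷ α))))
               (trans (#-≟-∷ (suc x) e (suc a) (monomials (length e) α)) rest))
    where
    rest : # (λ α′ → does (suc x ≟ suc a) ∧ does (e ≟ᶜ α′)) (monomials (length e) α) ≡
           ind (does (suc x ≟ suc a) ∧ does (omitZeros e ≟ᶜ α))
    rest with does (suc x ≟ suc a)
    ... | true  = count e α>0
    ... | false = #-false (monomials (length e) α)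

∑-M : {A : Set} (w : A → List ℕ) (xs : List A) → (∀ {x} → x ∈ xs → Composition (w x)) →
      ∀ e → ∑ xs (M ∘ w) e ≡ # (λ x → does (omitZeros e ≟ᶜ w x)) xs
∑-M w xs comps e =
  trans (cong sum (List.map-cong-local (All.tabulate λ x∈ → M-coefficient (comps x∈) e)))
        (sum-ind (λ x → does (omitZeros e ≟ᶜ w x)) xs)

compositions-unique : ∀ m → Unique (compositions (suc m))
compositions-unique m rewrite compositions-decode m = Unique.map⁺ decode-injective (bits-unique m)
  where
  decode-injective : ∀ {b c} → decode b ≡ decode c → b ≡ c
  decode-injective {b} {c} eq =
    at-ext (suc-injective (trans (sym (sum-decode b)) (trans (cong sum eq) (sum-decode c)))) λ i _ →
      bool-ext (λ p → ∈-pos⁻ c i (subst (suc i ∈_) pos≡ (∈-pos⁺ b i p)))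
               (λ p → ∈-pos⁻ b i (subst (suc i ∈_) (sym pos≡) (∈-pos⁺ c i p)))
    where
    pos≡ : pos b ≡ pos c
    pos≡ = trans (sym (set-decode b)) (trans (cong set eq) (set-decode c))

∈-compositions⁻ : ∀ m {γ} → γ ∈ compositions (suc m) → Composition γ × sum γ ≡ suc m
∈-compositions⁻ m γ∈ rewrite compositions-decode m with ∈-map⁻ decode γ∈
... | b , b∈ , refl = decode-composition b , trans (sum-decode b) (cong suc (∈-bits⁻ m b∈))

∈-compositions⁺ : ∀ m {γ} → Composition γ → sum γ ≡ suc m → γ ∈ compositions (suc m)
∈-compositions⁺ m γ>0 eq rewrite compositions-decode m with decode-surjective m γ>0 eq
... | g , refl , refl = ∈-map⁺ decode (∈-bits⁺ g)

-- Among the compositions refining β, only `omitZeros e` itself can contribute to the monomial of e.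
F-coefficient : ∀ m β → sum β ≡ suc m → ∀ e → F β e ≡ ind (does (refines? (omitZeros e) β))
F-coefficient m β sum≡ e rewrite sum≡ =
  trans (∑-M id (filter (λ δ → refines? δ β) (compositions (suc m)))
             (λ δ∈ → proj₁ (∈-compositions⁻ m (proj₁ (∈-filter⁻ (λ δ → refines? δ β) δ∈)))) e)
        (trans (#-filter (λ δ → refines? δ β) (λ δ → does (γ ≟ᶜ δ)) (compositions (suc m))) count)
  where
  γ = omitZeros e
  p : List ℕ → Bool
  p δ = does (refines? δ β) ∧ does (γ ≟ᶜ δ)
  only : ∀ {δ} → p δ ≡ true → δ ≡ γ
  only {δ} eq = sym (does⁻ (γ ≟ᶜ δ) (proj₂ (∧⁻ {does (refines? δ β)} eq)))
  count : # p (compositions (suc m)) ≡ ind (does (refines? γ β))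
  count with refines? γ β in eq
  ... | yes r = #-singleton p (compositions-unique m)
                  (∈-compositions⁺ m (omitZeros-composition e) (trans (Refines-sum r) sum≡))
                  (∧⁺ (cong does eq) (dec-true (γ ≟ᶜ γ) refl)) (λ _ → only)
  ... | no ¬r = #-none p (compositions (suc m)) λ {δ} _ → Bool.¬-not λ pδ →
                  ¬r (subst (_Refines β) (only pδ) (does⁻ (refines? δ β) (proj₁ (∧⁻ pδ))))

containsPeaks? : ∀ P β → Dec (All (_∈ (set β △ map suc (set β))) P)
containsPeaks? P β = All.all? (_∈? (set β △ map suc (set β))) P

K-expansion : ∀ m α → sum α ≡ suc m → ∀ e →
              K α e ≡ 2 ^ (length (Peak (set α)) + 1) *
                      # (λ β → does (containsPeaks? (Peak (set α)) β) ∧ does (refines? (omitZeros e) β))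
                        (compositions (suc m))
K-expansion m α sum≡ e rewrite sum≡ = cong (2 ^ (length P + 1) *_)
  (trans (cong sum (List.map-cong-local (All.tabulate λ {β} β∈ →
            F-coefficient m β
                (proj₂ (∈-compositions⁻ m
                    (proj₁ (∈-filter⁻ (containsPeaks? P) {xs = compositions (suc m)} β∈)))) e)))
    (trans (sum-ind (does ∘ refines? (omitZeros e)) (filter (containsPeaks? P) (compositions (suc m))))
           (#-filter (containsPeaks? P) (does ∘ refines? (omitZeros e)) (compositions (suc m)))))
  where P = Peak (set α)

-- No gap precedes the first letter, so its marking is handed to `chain` as the initial state.
chains : List Bool → List Bool → List Bool → Bool
chains ds g []       = true
chains ds g (u ∷ us) = chain u (zip ds g) us

module _ (ds : List Bool) (e : List ℕ) where
  private
    m = length ds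
    γ = omitZeros e
    P = Peak (pos ds)
    peakComp = comp (suc m) P

    P-sorted : AllPairs _<_ P
    P-sorted = AllPairs.filter⁺ (isPeak? (pos ds)) (pos-sorted ds)

    set-peakComp : set peakComp ≡ P
    set-peakComp = set-comp (suc m) P P-sorted

    K-peakComp : K peakComp e ≡
                 2 ^ (length P + 1) * # (λ β → does (containsPeaks? P β) ∧ does (refines? γ β))
                     (compositions (suc m))
    K-peakComp = subst (λ P′ → K peakComp e ≡ 2 ^ (length P′ + 1) *
                   # (λ β → does (containsPeaks? P′ β) ∧ does (refines? γ β)) (compositions (suc m)))
            (trans (cong Peak set-peakComp) (Peak-idempotent (pos ds)))
            (K-expansion m peakComp (sum-comp (suc m) P P-sorted
              (All.filter⁺ (isPeak? (pos ds)) (All.map m≤n⇒m≤1+n (pos-≤ ds)))) e)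

  -- K is homogeneous of degree m + 1, because refinement preserves sums.
  K-vanishes : sum γ ≢ suc m → K peakComp e ≡ 0
  K-vanishes neq =
      trans K-peakComp (trans (cong (2 ^ (length P + 1) *_) none) (*-zeroʳ (2 ^ (length P + 1))))
    where
    none : # (λ β → does (containsPeaks? P β) ∧ does (refines? γ β)) (compositions (suc m)) ≡ 0
    none = #-none _ (compositions (suc m)) λ {β} β∈ → Bool.¬-not λ eq →
      neq (trans (Refines-sum (does⁻ (refines? γ β) (proj₂ (∧⁻ {does (containsPeaks? P β)} eq))))
                 (proj₂ (∈-compositions⁻ m β∈)))

  -- That γ refines β bounds the bits of β by g, and the condition on symmetric differences makes
  -- them change at every peak: these are the lists accepted by `toggles`. The + 1 in the exponent
  -- is the factor 2 of `after-descent`.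
  K-chains : ∀ g → length g ≡ m → decode g ≡ γ → K peakComp e ≡ # (chains ds g) (bits (suc m))
  K-chains g len dec = begin
    K peakComp e
      ≡⟨ K-peakComp ⟩
    2 ^ (length P + 1) * # (λ β → does (containsPeaks? P β) ∧ does (refines? γ β))
        (compositions (suc m))
      ≡⟨ cong₂ (λ k → 2 ^ (k + 1) *_) (length-Peak-pos ds g (sym len)) count ⟩
    2 ^ (peaks true gs + 1) * # (toggles true true gs) (bits m)
      ≡⟨ cong (_* # (toggles true true gs) (bits m)) (cong (2 ^_) (+-comm (peaks true gs) 1)) ⟩
    2 * 2 ^ peaks true gs * # (toggles true true gs) (bits m)
      ≡⟨ *-assoc 2 (2 ^ peaks true gs) _ ⟩
    2 * (2 ^ peaks true gs * # (toggles true true gs) (bits m))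
      ≡⟨ subst (λ k → 2 * (2 ^ peaks true gs * # (toggles true true gs) (bits k)) ≡
                      # (chain true gs) (bits k) + # (chain false gs) (bits k)) length-gs
                          (#-chains gs) ⟩
    # (chain true gs) (bits m) + # (chain false gs) (bits m)
      ≡⟨ #-bits-suc (chains ds g) m ⟨
    # (chains ds g) (bits (suc m)) ∎
    where
    open ≡-Reasoning
    gs = zip ds g
    length-gs : length gs ≡ m
    length-gs = trans (List.length-zipWith _,_ ds g) (trans (cong (m ⊓_) len) (⊓-idem m))

    agree : ∀ {b} → b ∈ bits m →
            does (containsPeaks? P (decode b)) ∧ does (refines? γ (decode b)) ≡ toggles true true gs b
    agree {b} b∈ rewrite sym dec | set-decode b = bool-ext to from
      where
      length-b = ∈-bits⁻ m b∈
      to : _ → toggles true true gs b ≡ true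
      to eq = toggles⁺ true true ds g b (sym len) (trans length-b (sym len))
        (Refines-decode⁻ g b (trans len (sym length-b))
          (does⁻ (refines? (decode g) (decode b)) (proj₂ (∧⁻ eq))))
        -- By definition `map suc (pos b)` is `pos (false ∷ b)`. The first gap is never a peak, so
        -- only positions `suc i` occur.
        λ { (suc i) p q → ∈-△-pos⁻ b (false ∷ b) (suc i)
              (All.lookup (does⁻ (All.all? (_∈? (pos b △ map suc (pos b))) P) (proj₁ (∧⁻ eq)))
                          (∈-Peak-pos⁺ ds (suc i) p q)) }
      from : toggles true true gs b ≡ true → _
      from eq with toggles⁻ true true ds g b (sym len) (trans length-b (sym len)) eq
      ... | b≤g , toggled = ∧⁺
        (dec-true (All.all? (_∈? (pos b △ map suc (pos b))) P) (All.tabulate λ {i} → peak i))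
        (dec-true (refines? (decode g) (decode b)) (Refines-decode⁺ g b (trans len (sym length-b)) b≤g))
        where
        peak : ∀ i → i ∈ P → i ∈ (pos b △ map suc (pos b))
        peak zero          0∈ = contradiction (Peak-⊆ 0∈) (0∉pos ds)
        peak (suc zero)    1∈ = contradiction (proj₂ (∈-Peak-pos⁻ ds 0 1∈)) λ ()
        peak (suc (suc i)) i∈ = let p , q = ∈-Peak-pos⁻ ds (suc i) i∈ in
                                ∈-△-pos⁺ b (false ∷ b) (suc i) (toggled (suc i) p q)

    count : # (λ β → does (containsPeaks? P β) ∧ does (refines? γ β)) (compositions (suc m)) ≡
            # (toggles true true gs) (bits m)
    count rewrite compositions-decode m =
      trans (#-map (λ β → does (containsPeaks? P β) ∧ does (refines? γ β)) decode (bits m))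
          (#-cong (bits m) agree)

-- Boxes and fillings

above : ∀ {a} → Box α → Box (a ∷ α)
above (box r c) = box (suc r) c

map-filling : (A → B) → Filling A α → Filling B α
map-filling f = All.map (Vec.map f)

map-filling-! : (f : A → B) (T : Filling A α) (b : Box α) → map-filling f T ! b ≡ f (T ! b)
map-filling-! f (v ∷ T) (box zero c)    = Vec.lookup-map c f v
map-filling-! f (v ∷ T) (box (suc r) c) = map-filling-! f T (box r c)

filling-ext : {T T′ : Filling A α} → (∀ b → T ! b ≡ T′ ! b) → T ≡ T′
filling-ext {T = []}    {[]}     eq = refl
filling-ext {T = v ∷ T} {w ∷ T′} eq =
  cong₂ _∷_ (trans (sym (Vec.tabulate∘lookup v))
      (trans (Vec.tabulate-cong (eq ∘ box zero)) (Vec.tabulate∘lookup w)))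
            (filling-ext (eq ∘ above))

tabulate-filling : (Box α → A) → Filling A α
tabulate-filling {α = []}    f = []
tabulate-filling {α = a ∷ α} f = Vec.tabulate (f ∘ box zero) ∷ tabulate-filling (f ∘ above)

tabulate-filling-! : (f : Box α → A) (b : Box α) → tabulate-filling f ! b ≡ f b
tabulate-filling-! {α = a ∷ α} f (box zero c)    = Vec.lookup∘tabulate (f ∘ box zero) c
tabulate-filling-! {α = a ∷ α} f (box (suc r) c) = tabulate-filling-! (f ∘ above) (box r c)

∈-vectors⁺ : ∀ {xs n} (v : Vec A n) → (∀ i → Vec.lookup v i ∈ xs) → v ∈ vectors xs n
∈-vectors⁺ []      h = here refl
∈-vectors⁺ (x ∷ v) h = ∈-cartesianProductWith⁺ _∷_ (h zero) (∈-vectors⁺ v (h ∘ suc))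

∈-vectors⁻ : ∀ {xs n} {v : Vec A n} → v ∈ vectors xs n → ∀ i → Vec.lookup v i ∈ xs
∈-vectors⁻ {xs = xs} {suc n} v∈ i with ∈-cartesianProductWith⁻ _∷_ xs (vectors xs n) v∈
∈-vectors⁻ v∈ zero    | _ , _ , x∈ , _  , refl = x∈
∈-vectors⁻ v∈ (suc i) | _ , _ , _  , w∈ , refl = ∈-vectors⁻ w∈ i

∈-fillings⁺ : ∀ {xs} (T : Filling A α) → (∀ b → T ! b ∈ xs) → T ∈ fillings xs α
∈-fillings⁺ []      h = here refl
∈-fillings⁺ (v ∷ T) h = ∈-cartesianProductWith⁺ _∷_ (∈-vectors⁺ v (h ∘ box zero))
    (∈-fillings⁺ T (h ∘ above))

∈-fillings⁻ : ∀ {xs} {T : Filling A α} → T ∈ fillings xs α → ∀ b → T ! b ∈ xs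
∈-fillings⁻ {α = a ∷ α} {xs} T∈ b with ∈-cartesianProductWith⁻ _∷_ (vectors xs a) (fillings xs α) T∈
∈-fillings⁻ T∈ (box zero c)    | _ , _ , v∈ , _   , refl = ∈-vectors⁻ v∈ c
∈-fillings⁻ T∈ (box (suc r) c) | _ , _ , _  , T′∈ , refl = ∈-fillings⁻ T′∈ (box r c)

vectors-unique : ∀ {xs : List A} → Unique xs → ∀ n → Unique (vectors xs n)
vectors-unique xs! zero    = [] ∷ []
vectors-unique xs! (suc n) =
  Unique.cartesianProductWith⁺ _∷_ (λ { refl → refl , refl }) xs! (vectors-unique xs! n)

fillings-unique : ∀ {xs : List A} → Unique xs → ∀ α → Unique (fillings xs α)
fillings-unique xs! []      = [] ∷ []
fillings-unique xs! (a ∷ α) =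
  Unique.cartesianProductWith⁺ _∷_ (λ { refl → refl , refl }) (vectors-unique xs! a)
      (fillings-unique xs! α)

∈-allBoxes : (b : Box α) → b ∈ allBoxes α
∈-allBoxes (box r c) = ∈-concat⁺′ (∈-map⁺ (box r) (∈-allFin c)) (∈-map⁺ _ (∈-allFin r))

allBoxes-unique : ∀ α → Unique (allBoxes α)
allBoxes-unique α = Unique.concat⁺
  (All.map⁺ (All.tabulate λ {r} _ → Unique.map⁺ (λ { refl → refl }) (Unique.allFin⁺ (lookup α r))))
  (AllPairs.map⁺
      (AllPairs.map (λ {r} {r′} r≢r′ {b} (b∈ , b∈′) → same r≢r′ (∈-map⁻ (box r) b∈)
          (∈-map⁻ (box r′) b∈′)) (Unique.allFin⁺ (length α))))
  where
  same : ∀ {r r′} → r ≢ r′ → ∀ {b} → ∃[ c ] (c ∈ allFin (lookup α r) × b ≡ box r c) →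
         ∃[ c ] (c ∈ allFin (lookup α r′) × b ≡ box r′ c) → ⊥
  same r≢r′ (_ , _ , refl) (_ , _ , refl) = r≢r′ refl

length-allBoxes : ∀ α → length (allBoxes α) ≡ sum α
length-allBoxes α = trans (count (allFin (length α)))
  (cong sum (trans (List.map-tabulate id (lookup α)) (List.tabulate-lookup α)))
  where
  count : ∀ rs → length (concatMap (λ r → map (box {α} r) (allFin (lookup α r))) rs) ≡
          sum (map (lookup α) rs)
  count []       = refl
  count (r ∷ rs) = trans (List.length-++ (map (box {α} r) (allFin (lookup α r))))
    (cong₂ _+_ (trans (List.length-map (box {α} r) (allFin (lookup α r))) (List.length-tabulate id))
        (count rs))

position-injective : {b b′ : Box α} → position b ≡ position b′ → b ≡ b′
position-injective {b = box r c} {box r′ c′} eq with toℕ-injective (suc-injective (cong proj₂ eq))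
... | refl = cong (box r) (toℕ-injective (suc-injective (cong proj₁ eq)))

box-at : ∀ β r c (r< : r < length β) → c < lookup β (fromℕ< r<) →
         ∃[ d ] (position {β} d ≡ (suc c , suc r))
box-at β r c r< c< = box (fromℕ< r<) (fromℕ< c<) , cong₂ (λ x y → suc x , suc y) (toℕ-fromℕ< c<)
    (toℕ-fromℕ< r<)

row-< : ∀ (b : Box α) → toℕ (rowIndex b) < length α
row-< b = toℕ<n (rowIndex b)

firstBox : Composition α → ∀ r → r < length α → ∃[ b ] (position {α} b ≡ (1 , suc r))
firstBox {α} α>0 r r< = box-at α r 0 r< (All.lookup α>0 (∈-lookup (fromℕ< r<)))

secondBox : PeakComposition α → ∀ r → suc r < length α → ∃[ b ] (position {α} b ≡ (2 , suc r))
secondBox {α} (_ , α>1) r r+1< =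
    box-at α r 1 r< (α>1 (fromℕ< r<) (subst (λ x → suc x < length α) (sym (toℕ-fromℕ< r<)) r+1<))
  where r< = <-trans (n<1+n r) r+1<

-- Diagrams of peak compositions

-- In a peak diagram every row but the top one has at least two boxes, so a box brings along columns
-- 1 and 2 of all lower rows. Together with left-justification this characterizes the peak diagrams
-- inside a given one, and turns the condition on initial segments of a tableau into inequalities
-- between pairs of boxes.
record DownClosed (P : Box α → Set) : Set where
  field
    left  : ∀ b b′ → row b ≡ row b′ → col b ≤ col b′ → P b′ → P b
    below : ∀ b b′ → row b < row b′ → col b ≤ 2 → P b′ → P b

peakDiagram⁻ : {P : Box α → Set} → FormPeakDiagram P → DownClosed P
peakDiagram⁻ {α} {P} (β , (β>0 , β>1) , into , onto) = record { left = left ; below = below }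
  where
  transport : ∀ b (r< : toℕ (rowIndex b) < length β) → toℕ (colIndex b) < lookup β (fromℕ< r<) → P b
  transport b r< c< with box-at β (toℕ (rowIndex b)) (toℕ (colIndex b)) r< c<
  ... | d , eq with onto d
  ...   | b″ , Pb″ , eq″ = subst P (position-injective (trans eq″ eq)) Pb″

  left : ∀ b b′ → row b ≡ row b′ → col b ≤ col b′ → P b′ → P b
  left b b′ r≡ (s≤s c≤) Pb′ with into b′ Pb′
  ... | box r c , eq = transport b (subst (_< length β) r≡r (toℕ<n r))
          (subst (toℕ (colIndex b) <_)
              (cong (lookup β) (toℕ-injective (trans r≡r (sym (toℕ-fromℕ< _)))))
                 (<-≤-trans (s≤s c≤) (subst (_≤ lookup β r) (cong proj₁ eq) (toℕ<n c))))
    where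
    r≡r : toℕ r ≡ toℕ (rowIndex b)
    r≡r = suc-injective (trans (cong proj₂ eq) (sym r≡))

  below : ∀ b b′ → row b < row b′ → col b ≤ 2 → P b′ → P b
  below b b′ (s≤s r<) (s≤s c≤) Pb′ with into b′ Pb′
  ... | box r c , eq =
          transport b r<β
              (<-≤-trans (s≤s c≤)
                  (β>1 (fromℕ< r<β) (≤-trans (s≤s (≤-trans (s≤s (≤-reflexive (toℕ-fromℕ< r<β))) r<r))
                      (toℕ<n r))))
    where
    r<r : toℕ (rowIndex b) < toℕ r
    r<r = subst (toℕ (rowIndex b) <_) (sym (suc-injective (cong proj₂ eq))) r<
    r<β = <-trans r<r (toℕ<n r)

initial-segment : ∀ n {Q : Fin n → Set} → Decidable Q → (∀ i j → toℕ i ≤ toℕ j → Q j → Q i) →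
                  ∃[ m ] (m ≤ n × (∀ i → Q i → toℕ i < m) × (∀ i → toℕ i < m → Q i))
initial-segment zero    Q? closed = 0 , z≤n , (λ ()) , (λ ())
initial-segment (suc n) Q? closed with Q? zero
... | no ¬q = 0 , z≤n , (λ i q → contradiction (closed zero i z≤n q) ¬q) , (λ _ ())
... | yes q with initial-segment n (Q? ∘ suc) (λ i j i≤j → closed (suc i) (suc j) (s≤s i≤j))
...   | m , m≤n , f , g = suc m , s≤s m≤n ,
          (λ { zero _ → s≤s z≤n ; (suc i) q → s≤s (f i q) }) ,
          (λ { zero _ → q ; (suc i) (s≤s i<) → g i i< })

peakDiagram⁺ : PeakComposition α → {P : Box α → Set} → Decidable P → DownClosed P → FormPeakDiagram P
peakDiagram⁺ {[]}    _ P? closed = [] , ([] , λ ()) , (λ { (box () _) }) , (λ { (box () _) })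
peakDiagram⁺ {a ∷ α} (a>0 ∷ α>0 , α>1) {P} P? closed
  with initial-segment a (P? ∘ box zero) (λ i j i≤j → DownClosed.left closed _ _ refl (s≤s i≤j))
     | peakDiagram⁺ (α>0 , λ i i< → α>1 (suc i) (s≤s i<)) {P ∘ above} (P? ∘ above)
         (record { left  = λ b b′ r≡ → DownClosed.left closed (above b) (above b′) (cong suc r≡)
                 ; below = λ b b′ r< → DownClosed.below closed (above b) (above b′) (s≤s r<) })
... | zero , _ , f , _ | _ = [] , ([] , λ ()) , (λ b Pb → contradiction Pb (none b)) ,
        (λ { (box () _) })
  where
  none : ∀ b → ¬ P b
  none (box zero c)    Pb = contradiction (f c Pb) λ ()
  none (box (suc r) c) Pb with firstBox (a>0 ∷ α>0) 0 (s≤s z≤n)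
  ... | box zero c′ , eq = none (box zero c′)
        (DownClosed.below closed (box zero c′) (box (suc r) c) (s≤s (s≤s z≤n))
            (≤-trans (≤-reflexive (cong proj₁ eq)) (s≤s z≤n)) Pb)
... | suc m , m≤a , f , g | β , (β>0 , β>1) , into , onto =
  suc m ∷ β , (s≤s z≤n ∷ β>0 , λ { zero (s≤s β≢[]) → wide β≢[] ; (suc i) (s≤s i<) → β>1 i i< }) ,
      into′ , onto′
  where
  -- A box in a higher row brings along column 2 of the first row.
  wide : 0 < length β → 1 < suc m
  wide β≢[] with firstBox β>0 0 β≢[]
  ... | d , _ with onto d
  ...   | b , Pb , _ with secondBox {a ∷ α} (a>0 ∷ α>0 , α>1) 0 (s≤s (≤-trans (s≤s z≤n) (row-< b)))
  ...     | box zero c , eq = subst (_< suc m) (suc-injective (cong proj₁ eq))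
              (f c (DownClosed.below closed (box zero c) (above b) (s≤s (s≤s z≤n))
                  (≤-reflexive (cong proj₁ eq)) Pb))
  into′ : ∀ b → P b → ∃[ d ] (position {suc m ∷ β} d ≡ position b)
  into′ (box zero c)    Pb = box zero (fromℕ< (f c Pb)) , cong (λ x → suc x , 1) (toℕ-fromℕ< (f c Pb))
  into′ (box (suc r) c) Pb with into (box r c) Pb
  ... | d , eq = above d , cong (λ (x , y) → x , suc y) eq
  onto′ : ∀ (d : Box (suc m ∷ β)) → ∃[ b ] (P b × position b ≡ position d)
  onto′ (box zero c) = box zero c′ , g c′ (subst (_< suc m) (sym (toℕ-fromℕ< c<a)) (toℕ<n c)) , cong
      (λ x → suc x , 1) (toℕ-fromℕ< c<a)
    where
    c<a = <-≤-trans (toℕ<n c) m≤a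
    c′  = fromℕ< c<a
  onto′ (box (suc r) c) with onto (box r c)
  ... | b , Pb , eq = above b , Pb , cong (λ (x , y) → x , suc y) eq

-- Marked tableaux in terms of pairs of boxes

rank-injective : ∀ {x y} → rank x ≡ rank y → x ≡ y
rank-injective {marked i}   {marked j}   eq = cong marked (*-cancelˡ-≡ i j 2 eq)
rank-injective {marked i}   {unmarked j} eq = contradiction eq (even≢odd i j)
rank-injective {unmarked i} {marked j}   eq = contradiction (sym eq) (even≢odd j i)
rank-injective {unmarked i} {unmarked j} eq = cong unmarked (*-cancelˡ-≡ i j 2 (suc-injective eq))

2*index≤rank : ∀ x → 2 * index x ≤ rank x
2*index≤rank (marked i)   = ≤-refl
2*index≤rank (unmarked i) = n≤1+n _

rank≤1+2*index : ∀ x → rank x ≤ suc (2 * index x)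
rank≤1+2*index (marked i)   = n≤1+n _
rank≤1+2*index (unmarked i) = ≤-refl

index-< : ∀ x y → index x < index y → x <ᴸ y
index-< x y i<j = begin-strict
  rank x               ≤⟨ rank≤1+2*index x ⟩
  suc (2 * index x)    <⟨ n<1+n _ ⟩
  2 + 2 * index x      ≡⟨ *-suc 2 (index x) ⟨
  2 * suc (index x)    ≤⟨ *-monoʳ-≤ 2 i<j ⟩
  2 * index y          ≤⟨ 2*index≤rank y ⟩
  rank y               ∎
  where open ≤-Reasoning

index-mono : ∀ x y → x ≤ᴸ y → index x ≤ index y
index-mono x y x≤y with index x ≤? index y
... | yes i≤j = i≤j
... | no  i≰j = contradiction (index-< y x (≰⇒> i≰j)) (≤⇒≯ x≤y)

-- The relations of consecutive letters of an enriched word at an ascent and at a descent.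
infix 4 _≤ᴬ_ _≤ᴰ_
_≤ᴬ_ _≤ᴰ_ : Letter → Letter → Set
x ≤ᴬ y = x <ᴸ y ⊎ (x ≡ y × ¬ IsMarked x)
x ≤ᴰ y = x <ᴸ y ⊎ (x ≡ y × IsMarked x)

≤ᴬ⇒≤ : ∀ {x y} → x ≤ᴬ y → x ≤ᴸ y
≤ᴬ⇒≤ (inj₁ x<y)        = <⇒≤ x<y
≤ᴬ⇒≤ (inj₂ (refl , _)) = ≤-refl

≤ᴰ⇒≤ : ∀ {x y} → x ≤ᴰ y → x ≤ᴸ y
≤ᴰ⇒≤ (inj₁ x<y)        = <⇒≤ x<y
≤ᴰ⇒≤ (inj₂ (refl , _)) = ≤-refl

-- Along a row the letters behave as at ascents of an enriched word; from columns 1 and 2 to any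
-- higher row they behave as at descents.
record Marked {α} (M : Filling Letter α) : Set where
  field
    rows  : ∀ b b′ → row b ≡ row b′ → col b < col b′ → M ! b ≤ᴬ M ! b′
    below : ∀ b b′ → row b < row b′ → col b ≤ 2 → M ! b ≤ᴰ M ! b′

same-box : {b b′ : Box α} → row b ≡ row b′ → col b ≡ col b′ → b ≡ b′
same-box r≡ c≡ = position-injective (cong₂ _,_ c≡ r≡)

1≤col : (b : Box α) → 1 ≤ col b
1≤col b = s≤s z≤n

marked⁺ : PeakComposition α → {M : Filling Letter α} → (∀ b → index (M ! b) ≤ sum α) →
          IsMarkedPeakTableau M → Marked M
marked⁺ {α} (α>0 , _) {M} bound tab = record { rows = rows ; below = below }
  where
  open IsMarkedPeakTableau tab hiding (peak)
  module Closed k k≤ = DownClosed (peakDiagram⁻ (IsMarkedPeakTableau.peak tab k k≤))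

  rows : ∀ b b′ → row b ≡ row b′ → col b < col b′ → M ! b ≤ᴬ M ! b′
  rows b b′ r≡ c< with m≤n⇒m<n∨m≡n (rows-weak b b′ r≡ c<)
  ... | inj₁ lt = inj₁ lt
  ... | inj₂ eq = inj₂ (rank-injective eq , rows-marked b b′ r≡ c< (rank-injective eq))

  row-first : ∀ b → ∃[ b₁ ] (position {α} b₁ ≡ (1 , row b))
  row-first b = firstBox α>0 (toℕ (rowIndex b)) (row-< b)

  weak : ∀ b b′ → row b ≡ row b′ → col b ≤ col b′ → M ! b ≤ᴸ M ! b′
  weak b b′ r≡ c≤ with m≤n⇒m<n∨m≡n c≤
  ... | inj₁ c< = rows-weak b b′ r≡ c<
  ... | inj₂ c≡ = ≤-reflexive (cong (λ d → rank (M ! d)) (same-box r≡ c≡))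

  below : ∀ b b′ → row b < row b′ → col b ≤ 2 → M ! b ≤ᴰ M ! b′
  below b b′ r< c≤2 with m≤n⇒m<n∨m≡n c≤2
  ... | inj₁ (s≤s c≤1) with row-first b′
  ...   | b₁ , eq = inj₁ (<-≤-trans
            (column b b₁ (≤-antisym c≤1 (1≤col b)) (cong proj₁ eq)
                (subst (row b <_) (sym (cong proj₂ eq)) r<))
            (weak b₁ b′ (cong proj₂ eq) (subst (_≤ col b′) (sym (cong proj₁ eq)) (1≤col b′))))
  below b b′ r< c≤2 | inj₂ c≡2
    with m≤n⇒m<n∨m≡n (Closed.below (index (M ! b′)) (bound b′) b b′ r< c≤2 ≤-refl)
  ...   | inj₁ i<j = inj₁ (index-< (M ! b) (M ! b′) i<j)
  ...   | inj₂ i≡j with isMarked? (M ! b)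
  ...     | yes mk = both (M ! b) (M ! b′) i≡j mk
    where
    both : ∀ x y → index x ≡ index y → IsMarked x → x ≤ᴰ y
    both (marked i) (marked .i)   refl mk = inj₂ (refl , mk)
    both (marked i) (unmarked .i) refl mk = inj₁ (n<1+n _)
  -- The first box b₁ of the row above b has an index between those of b and b′, which agree. An
  -- unmarked letter at b then contradicts `unmarked-2`.
  ...     | no ¬mk with firstBox α>0 (row b) (≤-trans r< (row-< b′))
  ...       | b₁ , eq = contradiction (≤-antisym index≤ index≥)
                          (unmarked-2 b b₁ c≡2 (cong proj₁ eq) (cong proj₂ eq) ¬mk)
    where
    col-b₁ : col b₁ ≡ 1
    col-b₁ = cong proj₁ eq
    row-b₁ : row b₁ ≡ suc (row b)
    row-b₁ = cong proj₂ eq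
    index≥ : index (M ! b) ≤ index (M ! b₁)
    index≥ = Closed.below (index (M ! b₁)) (bound b₁) b b₁ (≤-reflexive (sym row-b₁)) c≤2 ≤-refl
    index≤ : index (M ! b₁) ≤ index (M ! b)
    index≤ rewrite i≡j with m≤n⇒m<n∨m≡n (subst (_≤ row b′) (sym row-b₁) r<)
    ... | inj₁ r₁<r′ = Closed.below (index (M ! b′)) (bound b′) b₁ b′ r₁<r′
            (subst (_≤ 2) (sym col-b₁) (s≤s z≤n)) ≤-refl
    ... | inj₂ r₁≡r′ = index-mono (M ! b₁) (M ! b′)
            (weak b₁ b′ r₁≡r′ (subst (_≤ col b′) (sym col-b₁) (1≤col b′)))

marked⁻ : PeakComposition α → {M : Filling Letter α} → Marked M → IsMarkedPeakTableau M
marked⁻ {α} peakα {M} marked-M = record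
  { rows-weak   = λ b b′ r≡ c< → ≤ᴬ⇒≤ (rows b b′ r≡ c<)
  ; rows-marked = λ b b′ r≡ c< eq → unmarked-eq (rows b b′ r≡ c<) eq
  ; column      = column
  ; peak        = λ k _ → peakDiagram⁺ peakα (λ b → index (M ! b) ≤? k) (record
      { left  = λ b b′ r≡ c≤ → ≤-trans (left b b′ r≡ c≤)
      ; below = λ b b′ r< c≤2 → ≤-trans (index-mono (M ! b) (M ! b′) (≤ᴰ⇒≤ (below b b′ r< c≤2))) })
  ; unmarked-2  = λ b b′ c≡2 c≡1 r≡ ¬mk eq →
      index-distinct (below b b′ (≤-reflexive (sym r≡)) (≤-reflexive c≡2)) ¬mk eq
  }
  where
  open Marked marked-M
  unmarked-eq : ∀ {x y} → x ≤ᴬ y → x ≡ y → ¬ IsMarked x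
  unmarked-eq (inj₁ x<y)      refl = contradiction x<y (n≮n _)
  unmarked-eq (inj₂ (_ , ¬m)) _    = ¬m

  left : ∀ b b′ → row b ≡ row b′ → col b ≤ col b′ → index (M ! b) ≤ index (M ! b′)
  left b b′ r≡ c≤ with m≤n⇒m<n∨m≡n c≤
  ... | inj₁ c< = index-mono (M ! b) (M ! b′) (≤ᴬ⇒≤ (rows b b′ r≡ c<))
  ... | inj₂ c≡ = ≤-reflexive (cong (λ d → index (M ! d)) (same-box r≡ c≡))

  -- Equality on the left needs an unmarked letter and on the right a marked one, so both cannot
  -- occur. Passing through column 2 thus makes the first column strict.
  strict : ∀ {x y z} → x ≤ᴬ y → y ≤ᴰ z → x <ᴸ z
  strict (inj₁ x<y)          y≤z                 = <-≤-trans x<y (≤ᴰ⇒≤ y≤z)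
  strict (inj₂ (refl , _))   (inj₁ y<z)          = y<z
  strict (inj₂ (refl , ¬mk)) (inj₂ (refl , mk))  = contradiction mk ¬mk

  column : ∀ b b′ → col b ≡ 1 → col b′ ≡ 1 → row b < row b′ → M ! b <ᴸ M ! b′
  column b b′ c≡1 _ r< with secondBox peakα (toℕ (rowIndex b)) (≤-trans r< (row-< b′))
  ... | b₂ , eq = strict
    (rows b b₂ (sym (cong proj₂ eq)) (subst₂ _<_ (sym c≡1) (sym (cong proj₁ eq)) (n<1+n 1)))
    (below b₂ b′ (subst (_< row b′) (sym (cong proj₂ eq)) r<) (≤-reflexive (cong proj₁ eq)))

  index-distinct : ∀ {x y} → x ≤ᴰ y → ¬ IsMarked x → index y ≢ index x
  index-distinct {unmarked i} {y} (inj₁ x<y) _ refl =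
    contradiction (<-≤-trans x<y (rank≤1+2*index y)) (n≮n _)
  index-distinct {marked i}       (inj₁ _)         ¬mk _ = ¬mk marked
  index-distinct                  (inj₂ (_ , mk))  ¬mk _ = ¬mk mk

-- Standard fillings

record Bijective {α} (T : Filling ℕ α) : Set where
  field
    range      : ∀ b → 1 ≤ T ! b × T ! b ≤ sum α
    injective  : ∀ b b′ → T ! b ≡ T ! b′ → b ≡ b′
    surjective : ∀ i → 1 ≤ i → i ≤ sum α → ∃[ b ] (T ! b ≡ i)

-- `Triple` is kept separate because relabelling is also applied to `farTableau`, for which the
-- triple condition is the question at issue.
record Standard {α} (T : Filling ℕ α) : Set where
  field
    bijective : Bijective T
    rows      : ∀ b b′ → row b ≡ row b′ → col b < col b′ → T ! b < T ! b′
    below     : ∀ b b′ → row b < row b′ → col b ≤ 2 → T ! b < T ! b′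
  open Bijective bijective public

Triple : Filling ℕ α → Set
Triple {α} T = ∀ (b b′ : Box α) → col b′ ≡ suc (col b) → row b′ < row b → T ! b < T ! b′ →
               ∃[ d ] (row d ≡ row b × col d ≡ suc (col b) × T ! d < T ! b′)

∈-[1⋯]⁺ : ∀ {n i} → 1 ≤ i → i ≤ n → i ∈ [1⋯ n ]
∈-[1⋯]⁺ {i = suc i} _ i≤n = ∈-applyUpTo⁺ suc i≤n

∈-[1⋯]⁻ : ∀ {n i} → i ∈ [1⋯ n ] → 1 ≤ i × i ≤ n
∈-[1⋯]⁻ i∈ with ∈-applyUpTo⁻ suc i∈
... | _ , i<n , refl = s≤s z≤n , i<n

[1⋯]-unique : ∀ n → Unique [1⋯ n ]
[1⋯]-unique n = Unique.applyUpTo⁺₁ suc n (λ i<j _ eq → <⇒≢ i<j (suc-injective eq))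

standard⁺ : {T : Filling ℕ α} → IsStandardPeakYoungTableau T → Standard T
standard⁺ {α} {T} tab = record
  { bijective = record { range = standard ; injective = injective ; surjective = surjective }
  ; rows = rows
  ; below = λ b b′ r< c≤2 → ≤∧≢⇒<
      -- The diagram of the entries at most `T ! b′` contains b′, hence also b.
      (DownClosed.below (peakDiagram⁻ (peak (T ! b′) (proj₂ (standard b′)))) b b′ r< c≤2 ≤-refl)
      (λ eq → <⇒≢ r< (cong row (injective b b′ eq)))
  }
  where
  open IsStandardPeakYoungTableau tab
  injective : ∀ b b′ → T ! b ≡ T ! b′ → b ≡ b′
  injective b b′ eq with All.lookup once (let p , q = standard b in ∈-[1⋯]⁺ p q)
  ... | _ , _ , unique = trans (sym (unique refl)) (unique (sym eq))
  surjective : ∀ i → 1 ≤ i → i ≤ sum α → ∃[ b ] (T ! b ≡ i)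
  surjective i 1≤i i≤n with All.lookup once (∈-[1⋯]⁺ 1≤i i≤n)
  ... | b , eq , _ = b , eq

standard⁻ : PeakComposition α → {T : Filling ℕ α} → Standard T → Triple T → IsStandardPeakYoungTableau T
standard⁻ {α} peakα {T} std triple = record
  { standard = range
  ; once     = All.tabulate λ i∈ →
      let p , q = ∈-[1⋯]⁻ i∈ ; b , eq = surjective _ p q
      in  b , eq , λ {b′} eq′ → injective b b′ (trans eq (sym eq′))
  ; rows     = rows
  ; column   = λ b b′ c≡1 _ r< → below b b′ r< (subst (_≤ 2) (sym c≡1) (s≤s z≤n))
  ; peak     = λ k _ → peakDiagram⁺ peakα (λ b → T ! b ≤? k) (record
      { left  = λ b b′ r≡ c≤ → ≤-trans (left b b′ r≡ c≤)
      ; below = λ b b′ r< c≤2 → ≤-trans (<⇒≤ (below b b′ r< c≤2)) })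
  ; triple   = triple
  }
  where
  open Standard std
  left : ∀ b b′ → row b ≡ row b′ → col b ≤ col b′ → T ! b ≤ T ! b′
  left b b′ r≡ c≤ with m≤n⇒m<n∨m≡n c≤
  ... | inj₁ c< = <⇒≤ (rows b b′ r≡ c<)
  ... | inj₂ c≡ = ≤-reflexive (cong (T !_) (same-box r≡ c≡))

#-entries : {T : Filling ℕ α} → Bijective T → (p : ℕ → Bool) →
            # (λ b → p (T ! b)) (allBoxes α) ≡ # p [1⋯ sum α ]
#-entries {α} {T} bij p = trans (sym (#-map p (T !_) (allBoxes α)))
  (#-set p (map-unique (T !_) (allBoxes-unique α) (λ _ _ → injective _ _)) ([1⋯]-unique (sum α))
    (λ t∈ → let b , _ , eq = ∈-map⁻ (T !_) t∈ ; l , u = range b in subst (_∈ _) (sym eq) (∈-[1⋯]⁺ l u))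
    (λ t∈ → let l , u = ∈-[1⋯]⁻ t∈ ; b , eq = surjective _ l u
            in  subst (_∈ _) eq (∈-map⁺ (T !_) (∈-allBoxes b))))
  where open Bijective bij

#-below : ∀ {n k} → k ≤ n → # (λ t → does (t <? suc k)) [1⋯ n ] ≡ k
#-below {n}     {zero}  _         = #-none _ [1⋯ n ] λ {t} t∈ →
  dec-false (t <? 1) (≤⇒≯ (proj₁ (∈-[1⋯]⁻ t∈)))
#-below {suc n} {suc k} (s≤s k≤n) = cong suc (trans
  (cong (# (λ t → does (t <? 2 + k))) (sym (List.map-applyUpTo suc suc n)))
  (trans (#-map (λ t → does (t <? 2 + k)) suc [1⋯ n ]) (#-below k≤n)))

#-mono : {p q : A → Bool} → ∀ xs → (∀ x → p x ≡ true → q x ≡ true) → # p xs ≤ # q xs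
#-mono []       p⇒q = z≤n
#-mono {p = p} {q} (x ∷ xs) p⇒q = +-mono-≤ (ind-mono (p⇒q x)) (#-mono xs p⇒q)
  where
  ind-mono : ∀ {a b} → (a ≡ true → b ≡ true) → ind a ≤ ind b
  ind-mono {true}  h rewrite h refl = ≤-refl
  ind-mono {false} h = z≤n

#-mono-< : {p q : A → Bool} → ∀ {xs z} → (∀ x → p x ≡ true → q x ≡ true) →
           z ∈ xs → p z ≡ false → q z ≡ true → # p xs < # q xs
#-mono-< {xs = _ ∷ xs} p⇒q (here refl) pz qz rewrite pz | qz = s≤s (#-mono xs p⇒q)
#-mono-< {p = p} {q} {x ∷ xs} p⇒q (there z∈) pz qz with p x in px
... | false = <-≤-trans (#-mono-< p⇒q z∈ pz qz) (m≤n+m _ (ind (q x)))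
... | true rewrite p⇒q x px = s≤s (#-mono-< p⇒q z∈ pz qz)

-- Standardization with respect to an order on the boxes

-- The middle component is an integer so that columns can be compared in reverse by changing their
-- sign.
Key : StrictTotalOrder _ _ _
Key = ×-strictTotalOrder <-strictTotalOrder (×-strictTotalOrder ℤ.<-strictTotalOrder <-strictTotalOrder)

module Standardization {α} (key : Box α → ℕ × ℤ × ℕ) (key-injective : ∀ b b′ → key b ≡ key b′ → b ≡ b′)
    where
  private module K = StrictTotalOrder Key

  infix 4 _≺_ _≺?_
  _≺_ : Box α → Box α → Set
  b ≺ b′ = key b K.< key b′

  _≺?_ : ∀ b b′ → Dec (b ≺ b′)
  b ≺? b′ = key b K.<? key b′

  ≺-irrefl : ∀ b → ¬ b ≺ b
  ≺-irrefl b = K.irrefl K.Eq.refl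

  ≺-total : ∀ b b′ → b ≢ b′ → b ≺ b′ ⊎ b′ ≺ b
  ≺-total b b′ b≢b′ with K.compare (key b) (key b′)
  ... | tri< lt _ _ = inj₁ lt
  ... | tri> _ _ gt = inj₂ gt
  ... | tri≈ _ (e₁ , e₂ , e₃) _ = contradiction (key-injective b b′ (cong₂ _,_ e₁ (cong₂ _,_ e₂ e₃)))
          b≢b′

  order : Box α → ℕ
  order b = # (λ b′ → does (b′ ≺? b)) (allBoxes α)

  standardization : Filling ℕ α
  standardization = tabulate-filling (suc ∘ order)

  private
    lookup-! : ∀ b → standardization ! b ≡ suc (order b)
    lookup-! = tabulate-filling-! (suc ∘ order)

    order-mono : ∀ b b′ → b ≺ b′ → order b < order b′
    order-mono b b′ b≺b′ = #-mono-< (λ d lt → dec-true (d ≺? b′) (K.trans (does⁻ (d ≺? b) lt) b≺b′))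
      (∈-allBoxes b) (dec-false (b ≺? b) (≺-irrefl b)) (dec-true (b ≺? b′) b≺b′)

    order-< : ∀ b → order b < sum α
    order-< b = subst (order b <_) (trans (#-true (allBoxes α)) (length-allBoxes α))
      (#-mono-< {q = const true} (λ _ _ → refl) (∈-allBoxes b) (dec-false (b ≺? b) (≺-irrefl b)) refl)

  standardization-mono : ∀ b b′ → b ≺ b′ → standardization ! b < standardization ! b′
  standardization-mono b b′ b≺b′ = subst₂ _<_ (sym (lookup-! b)) (sym (lookup-! b′))
      (s≤s (order-mono b b′ b≺b′))

  standardization-bijective : Bijective standardization
  standardization-bijective = record { range = range ; injective = injective ; surjective = surjective }
    where
    T = standardization
    range : ∀ b → 1 ≤ T ! b × T ! b ≤ sum α
    range b rewrite lookup-! b = s≤s z≤n , order-< b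
    injective : ∀ b b′ → T ! b ≡ T ! b′ → b ≡ b′
    injective b b′ eq with box-≟ b b′
    ... | yes b≡b′ = b≡b′
    ... | no  b≢b′ with ≺-total b b′ b≢b′
    ...   | inj₁ lt = contradiction eq (<⇒≢ (standardization-mono b b′ lt))
    ...   | inj₂ gt = contradiction (sym eq) (<⇒≢ (standardization-mono b′ b gt))
    surjective : ∀ i → 1 ≤ i → i ≤ sum α → ∃[ b ] (T ! b ≡ i)
    surjective i 1≤i i≤n with ∈-map⁻ (T !_)
        (unique-full _≟_ (map-unique (T !_) (allBoxes-unique α) (λ _ _ → injective _ _))
           (λ t∈ → let b , _ , eq = ∈-map⁻ (T !_) t∈ ; l , u = range b in subst (_∈ _) (sym eq) (∈-[1⋯]⁺ l u))
           (≤-reflexive (trans (List.length-applyUpTo suc (sum α))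
               (sym (trans (List.length-map (T !_) (allBoxes α)) (length-allBoxes α)))))
           (∈-[1⋯]⁺ 1≤i i≤n))
    ... | b , _ , eq = b , sym eq

  -- The entry of T at b is 1 plus the number of boxes with smaller entries, and these are the boxes
  -- preceding b. As the entries of T are distinct, the given implication between the two orders is
  -- an equivalence.
  standardization-unique : (T : Filling ℕ α) → Bijective T → (∀ b b′ → T ! b < T ! b′ → b ≺ b′) →
                           T ≡ standardization
  standardization-unique T bij mono = filling-ext λ b → trans (entry b) (sym (lookup-! b))
    where
    open Bijective bij
    back : ∀ b b′ → b ≺ b′ → T ! b < T ! b′
    back b b′ b≺b′ with <-cmp (T ! b) (T ! b′)
    ... | tri< lt _ _ = lt
    ... | tri≈ _ eq _ = contradiction (subst (_≺ b′) (injective b b′ eq) b≺b′) (≺-irrefl b′)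
    ... | tri> _ _ gt = contradiction (K.trans b≺b′ (mono b′ b gt)) (≺-irrefl b)
    entry : ∀ b → T ! b ≡ suc (order b)
    entry b with T ! b in eq | range b
    ... | suc k | _ , k<n = cong suc (sym (trans
      (#-cong (allBoxes α) λ {d} _ → bool-ext
        (λ lt → dec-true (T ! d <? suc k) (subst (T ! d <_) eq (back d b (does⁻ (d ≺? b) lt))))
        (λ lt → dec-true (d ≺? b) (mono d b (subst (T ! d <_) (sym eq) (does⁻ (T ! d <? suc k) lt)))))
      (trans (#-entries bij (λ t → does (t <? suc k))) (#-below (<⇒≤ k<n)))))

-- Sorted words and their weights

-- The index of the letter at position k (counted from 0) of a word whose index starts
-- at i and increases at the gaps marked in g.
wordIndex : ℕ → List Bool → ℕ → ℕ
wordIndex i g zero    = i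
wordIndex i g (suc k) = if at g k then suc (wordIndex i g k) else wordIndex i g k

wordIndex-∷ : ∀ i c g k → wordIndex i (c ∷ g) (suc k) ≡ wordIndex (if c then suc i else i) g k
wordIndex-∷ i c g zero    = refl
wordIndex-∷ i c g (suc k) rewrite wordIndex-∷ i c g k = refl

wordIndex-step : ∀ i g k → wordIndex i g k ≤ wordIndex i g (suc k)
wordIndex-step i g k with at g k
... | true  = n≤1+n _
... | false = ≤-refl

wordIndex-mono : ∀ i g {k l} → k ≤ l → wordIndex i g k ≤ wordIndex i g l
wordIndex-mono i g {k} {l} k≤l with m≤n⇒m<n∨m≡n k≤l
... | inj₂ refl      = ≤-refl
wordIndex-mono i g {k} {suc l} k≤l | inj₁ (s≤s k≤l′) = ≤-trans (wordIndex-mono i g k≤l′)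
    (wordIndex-step i g l)

wordIndex-flat : ∀ i g k → wordIndex i g k ≡ wordIndex i g (suc k) → at g k ≡ false
wordIndex-flat i g k eq with at g k
... | false = refl
... | true  = contradiction eq (<⇒≢ (n<1+n _))

wordIndex-≤ : ∀ i g k → wordIndex i g k ≤ k + i
wordIndex-≤ i g zero    = ≤-refl
wordIndex-≤ i g (suc k) with at g k
... | true  = s≤s (wordIndex-≤ i g k)
... | false = m≤n⇒m≤1+n (wordIndex-≤ i g k)

occurrences : ℕ → List ℕ → ℕ
occurrences x = # (λ y → does (y ≟ x))

-- `wt` always lists n entries, so a weight γ occurs in it followed by zeros.
pad : ℕ → List ℕ → List ℕ
pad n γ = γ ++ replicate (n ∸ length γ) 0

applyUpTo-cong : {A : Set} {f f′ : ℕ → A} → ∀ n → (∀ k → k < n → f k ≡ f′ k) →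
                 applyUpTo f n ≡ applyUpTo f′ n
applyUpTo-cong zero    h = refl
applyUpTo-cong (suc n) h = cong₂ _∷_ (h 0 (s≤s z≤n)) (applyUpTo-cong n λ k k<n → h (suc k) (s≤s k<n))

applyUpTo-injective : {A : Set} {f f′ : ℕ → A} → ∀ n → applyUpTo f n ≡ applyUpTo f′ n → ∀ k → k < n →
                      f k ≡ f′ k
applyUpTo-injective (suc n) eq zero    _         = List.∷-injectiveˡ eq
applyUpTo-injective (suc n) eq (suc k) (s≤s k<n) = applyUpTo-injective n (List.∷-injectiveʳ eq) k k<n

applyUpTo-const : ∀ n → applyUpTo (const 0) n ≡ replicate n 0
applyUpTo-const zero    = refl
applyUpTo-const (suc n) = cong (0 ∷_) (applyUpTo-const n)

length-incrementFirst : ∀ α → length (incrementFirst α) ≡ length α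
length-incrementFirst []      = refl
length-incrementFirst (_ ∷ _) = refl

length-decode-≤ : ∀ g → length (decode g) ≤ suc (length g)
length-decode-≤ []          = ≤-refl
length-decode-≤ (true ∷ g)  = s≤s (length-decode-≤ g)
length-decode-≤ (false ∷ g) = subst (_≤ 2 + length g) (sym (length-incrementFirst (decode g)))
    (m≤n⇒m≤1+n (length-decode-≤ g))

word : ℕ → List Bool → List ℕ
word i []      = i ∷ []
word i (c ∷ g) = i ∷ word (if c then suc i else i) g

word-applyUpTo : ∀ i g → word i g ≡ applyUpTo (wordIndex i g) (suc (length g))
word-applyUpTo i []      = refl
word-applyUpTo i (c ∷ g) = cong (i ∷_) (trans (word-applyUpTo _ g)
  (applyUpTo-cong (suc (length g)) λ k _ → sym (wordIndex-∷ i c g k)))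

word-≥ : ∀ i g → All (i ≤_) (word i g)
word-≥ i []          = ≤-refl ∷ []
word-≥ i (true ∷ g)  = ≤-refl ∷ All.map <⇒≤ (word-≥ (suc i) g)
word-≥ i (false ∷ g) = ≤-refl ∷ word-≥ i g

occurrences-none : ∀ {x xs} → All (x <_) xs → occurrences x xs ≡ 0
occurrences-none {x} {xs} x<xs = #-none _ xs λ {y} y∈ →
  dec-false (y ≟ x) λ y≡x → <⇒≢ (All.lookup x<xs y∈) (sym y≡x)

-- The runs of equal indices have the parts of the composition as lengths: `word` and `decode` read
-- g alike, a true bit opening a new run and a false bit lengthening the current one.
occurrences-word : ∀ i g N → length (decode g) ≤ N →
                   applyUpTo (λ k → occurrences (i + k) (word i g)) N ≡ pad N (decode g)
occurrences-word i [] (suc N) _ = cong₂ _∷_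
  (cong (λ b → ind b + 0) (dec-true (i ≟ i + 0) (sym (+-identityʳ i))))
  (trans (applyUpTo-cong N λ k _ →
      cong (λ b → ind b + 0) (dec-false (i ≟ i + suc k) (<⇒≢ (m<m+n i (s≤s z≤n)))))
         (applyUpTo-const N))
occurrences-word i (true ∷ g) (suc N) (s≤s len) = cong₂ _∷_
  (cong₂ (λ b k → ind b + k) (dec-true (i ≟ i + 0) (sym (+-identityʳ i)))
         (trans (cong (λ x → occurrences x (word (suc i) g)) (+-identityʳ i))
             (occurrences-none (word-≥ (suc i) g))))
  (trans (applyUpTo-cong N λ k _ → cong₂ (λ b x → ind b + occurrences x (word (suc i) g))
           (dec-false (i ≟ i + suc k) (<⇒≢ (m<m+n i (s≤s z≤n)))) (+-suc i k))
         (occurrences-word (suc i) g N len))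
occurrences-word i (false ∷ g) N len rewrite length-incrementFirst (decode g)
  with decode g | decode-∷ g | N | len | occurrences-word i g N len
... | _ | a , r , refl | suc N | s≤s _ | rec = cong₂ _∷_
  (cong₂ (λ b k → ind b + k) (dec-true (i ≟ i + 0) (sym (+-identityʳ i))) (List.∷-injectiveˡ rec))
  (trans (applyUpTo-cong N λ k _ → cong (λ b → ind b + occurrences (i + suc k) (word i g))
           (dec-false (i ≟ i + suc k) (<⇒≢ (m<m+n i (s≤s z≤n)))))
         (List.∷-injectiveʳ rec))

pad-noInternalZeros : ∀ {γ} n → Composition γ → NoInternalZeros (pad n γ)
pad-noInternalZeros {γ} n γ>0 = go γ>0 (n ∸ length γ)
  where
  zeros : ∀ k → NoInternalZeros (replicate k 0)
  zeros zero    = []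
  zeros (suc k) = All.replicate⁺ k (λ (_ , 0≢0) → 0≢0 refl) ∷ zeros k
  go : ∀ {γ} → Composition γ → ∀ k → NoInternalZeros (γ ++ replicate k 0)
  go []          k = zeros k
  go (a>0 ∷ γ>0) k =
    All.tabulate (λ _ (a≡0 , _) → contradiction (subst (0 <_) a≡0 a>0) (n≮n 0)) ∷ go γ>0 k

omitZeros-pad : ∀ {γ} n → Composition γ → omitZeros (pad n γ) ≡ γ
omitZeros-pad {γ} n γ>0 = trans (List.filter-++ (λ u → ¬? (u ≟ 0)) γ _)
  (trans (cong₂ _++_ (List.filter-all (λ u → ¬? (u ≟ 0)) (All.map (λ 0<a → >⇒≢ 0<a) γ>0))
                     (List.filter-none (λ u → ¬? (u ≟ 0)) (All.replicate⁺ (n ∸ length γ) λ 0≢0 →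
                         0≢0 refl)))
         (List.++-identityʳ γ))

pad-omitZeros : ∀ {c} → NoInternalZeros c → c ≡ pad (length c) (omitZeros c)
pad-omitZeros {[]}        []          = refl
pad-omitZeros {suc a ∷ c} (_ ∷ c-ok)  = cong (suc a ∷_) (pad-omitZeros c-ok)
pad-omitZeros {zero ∷ c}  (zeros ∷ _) =
  trans (cong (0 ∷_) (replicate-all zero-c)) (cong (pad (suc (length c))) (sym omit≡[]))
  where
  zero-c : All (_≡ 0) c
  zero-c = All.map (λ {v} h → decide v h) zeros
    where
    decide : ∀ v → ¬ (0 ≡ 0 × v ≢ 0) → v ≡ 0
    decide zero    h = refl
    decide (suc v) h = contradiction (refl , λ ()) h
  replicate-all : ∀ {c} → All (_≡ 0) c → c ≡ replicate (length c) 0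
  replicate-all []          = refl
  replicate-all (refl ∷ zs) = cong (0 ∷_) (replicate-all zs)
  omit≡[] : omitZeros c ≡ []
  omit≡[] = List.filter-none (λ u → ¬? (u ≟ 0)) (All.map (λ eq ≢0 → ≢0 eq) zero-c)

-- Relabelling a standard filling by an enriched word

letter : Bool → ℕ → Letter
letter true  = marked
letter false = unmarked

index-letter : ∀ b i → index (letter b i) ≡ i
index-letter true  i = refl
index-letter false i = refl

letter-injective : ∀ {b c i j} → letter b i ≡ letter c j → b ≡ c
letter-injective {true}  {true}  _ = refl
letter-injective {false} {false} _ = refl

isMarked : Letter → Bool
isMarked (marked _)   = true
isMarked (unmarked _) = false

letter-isMarked : ∀ x → letter (isMarked x) (index x) ≡ x
letter-isMarked (marked _)   = refl
letter-isMarked (unmarked _) = refl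

letterAt : List Bool → List Bool → ℕ → Letter
letterAt g μ k = letter (at μ k) (wordIndex 1 g k)

relabel : List Bool → List Bool → Filling ℕ α → Filling Letter α
relabel g μ = map-filling (λ t → letterAt g μ (t ∸ 1))

relabel-! : ∀ g μ (T : Filling ℕ α) b {k} → T ! b ≡ suc k → relabel g μ T ! b ≡ letterAt g μ k
relabel-! g μ T b eq = trans (map-filling-! (λ t → letterAt g μ (t ∸ 1)) T b)
    (cong (λ t → letterAt g μ (t ∸ 1)) eq)

wt-bijective : {M : Filling Letter α} {T : Filling ℕ α} → Bijective T → (ι : ℕ → ℕ) →
               (∀ b → index (M ! b) ≡ ι (T ! b ∸ 1)) →
               wt M ≡ applyUpTo (λ k → occurrences (suc k) (applyUpTo ι (sum α))) (sum α)
wt-bijective {α} {M} {T} bij ι index≡ = trans (List.map-applyUpTo suc _ (sum α))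
    (applyUpTo-cong (sum α) λ k _ → count (suc k))
  where
  count : ∀ i → length (filter (λ b → index (M ! b) ≟ i) (allBoxes α)) ≡
          occurrences i (applyUpTo ι (sum α))
  count i = begin
    length (filter (λ b → index (M ! b) ≟ i) (allBoxes α))   ≡⟨ length-filter-#
        (λ b → index (M ! b) ≟ i) (allBoxes α) ⟩
    # (λ b → does (index (M ! b) ≟ i)) (allBoxes α)          ≡⟨ #-cong (allBoxes α)
        (λ {b} _ → cong (λ x → does (x ≟ i)) (index≡ b)) ⟩
    # (λ b → does (ι (T ! b ∸ 1) ≟ i)) (allBoxes α)          ≡⟨ #-entries bij
        (λ t → does (ι (t ∸ 1) ≟ i)) ⟩
    # (λ t → does (ι (t ∸ 1) ≟ i)) [1⋯ sum α ]               ≡⟨ #-map (λ y → does (y ≟ i))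
        (λ t → ι (t ∸ 1)) [1⋯ sum α ] ⟨
    occurrences i (map (λ t → ι (t ∸ 1)) [1⋯ sum α ])        ≡⟨ cong (occurrences i)
        (List.map-applyUpTo suc (λ t → ι (t ∸ 1)) (sum α)) ⟩
    occurrences i (applyUpTo ι (sum α))                      ∎
    where open ≡-Reasoning

descents : Filling ℕ α → ℕ → List Bool
descents T = applyUpTo (does ∘ descent←? T ∘ suc)

-- What `chain` tests: the word with markings μ is enriched with descents ds. Gap i lies between the
-- positions i and i + 1.
Compatible : List Bool → List Bool → List Bool → Set
Compatible ds g μ = ∀ i → at g i ≡ false → (at ds i ≡ true → at μ i ≡ true) ×
                                           (at ds i ≡ false → at μ (suc i) ≡ false)

Narrow : List ℕ → Set
Narrow α = ∀ (b b′ : Box α) → 3 ≤ col b′ → 2 ≤ col b → row b ≤ row b′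

-- From column 2 on, narrowness excludes the configuration of the triple condition; between columns
-- 1 and 2 the lower row already has the smaller entry.
narrow⇒triple : Narrow α → {T : Filling ℕ α} → Standard T → Triple T
narrow⇒triple narrow std b b′ c≡ r< T< with m≤n⇒m<n∨m≡n (1≤col b)
... | inj₁ 2≤c = contradiction (narrow b b′ (subst (3 ≤_) (sym c≡) (s≤s 2≤c)) 2≤c) (<⇒≱ r<)
... | inj₂ 1≡c = contradiction (Standard.below std b′ b r<
        (≤-reflexive (trans c≡ (cong suc (sym 1≡c))))) (<-asym T<)

orientedColumn : Letter → ℕ → ℤ
orientedColumn (marked _)   c = ℤ.- (ℤ.+ c)
orientedColumn (unmarked _) c = ℤ.+ c

orientedColumn-injective : ∀ x {c c′} → orientedColumn x c ≡ orientedColumn x c′ → c ≡ c′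
orientedColumn-injective (marked _)   eq = ℤ.+-injective (ℤ.neg-injective eq)
orientedColumn-injective (unmarked _) eq = ℤ.+-injective eq

-- Boxes with equal letters are ordered so that marked letters yield descents and unmarked
-- ones ascents.
letterKey : Filling Letter α → Box α → ℕ × ℤ × ℕ
letterKey M b = rank (M ! b) , orientedColumn (M ! b) (col b) , row b

letterKey-injective : (M : Filling Letter α) → ∀ b b′ → letterKey M b ≡ letterKey M b′ → b ≡ b′
letterKey-injective M b b′ eq = same-box (cong (proj₂ ∘ proj₂) eq)
  (orientedColumn-injective (M ! b) (trans (cong (proj₁ ∘ proj₂) eq)
    (cong (λ x → orientedColumn x (col b′)) (sym (rank-injective {M ! b} {M ! b′} (cong proj₁ eq))))))

module Precedence {α} (M : Filling Letter α) = Standardization (letterKey M) (letterKey-injective M)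

module Word {α m} (sum≡ : sum α ≡ suc m) (g : List Bool) {T : Filling ℕ α} (std : Standard T)
            (μ : List Bool) (compatible : Compatible (descents T m) g μ) where
  open Standard std

  private
    v = wordIndex 1 g
    R = relabel g μ T

    entry : ∀ b → ∃[ k ] (T ! b ≡ suc k × k < suc m)
    entry b with T ! b | range b
    ... | suc k | _ , k≤ = k , refl , subst (suc k ≤_) sum≡ k≤

    box-of : ∀ k → k < suc m → ∃[ b ] (T ! b ≡ suc k)
    box-of k k< = surjective (suc k) (s≤s z≤n) (subst (suc k ≤_) (sym sum≡) k<)

    flat : ∀ {p k q} → p ≤ k → k < q → v p ≡ v q → at g k ≡ false
    flat p≤k k<q eq = wordIndex-flat 1 g _ (≤-antisym (wordIndex-step 1 g _)
      (≤-trans (wordIndex-mono 1 g k<q) (≤-trans (≤-reflexive (sym eq)) (wordIndex-mono 1 g p≤k))))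

    squeeze : ∀ {p q k} → p ≤ k → k ≤ q → v p ≡ v q → v p ≡ v k
    squeeze p≤k k≤q eq = ≤-antisym (wordIndex-mono 1 g p≤k)
        (≤-trans (wordIndex-mono 1 g k≤q) (≤-reflexive (sym eq)))

    -- In a run of equal indices that ends marked every gap is a descent, since an ascent would make
    -- the next letter unmarked. So the marking propagates to the left and the columns weakly
    -- decrease.
    marked-run : ∀ q p b b′ → T ! b ≡ suc p → T ! b′ ≡ suc q → p ≤ q → v p ≡ v q →
                 at μ q ≡ true → at μ p ≡ true × col b′ ≤ col b
    marked-run q p b b′ eq eq′ p≤q v≡ μq with m≤n⇒m<n∨m≡n p≤q
    ... | inj₂ refl with injective b b′ (trans eq (sym eq′))
    ...   | refl = μq , ≤-refl
    marked-run (suc q) p b b′ eq eq′ p≤q v≡ μq | inj₁ (s≤s p≤q′)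
      with entry b′
    ... | k , eqk , k< with suc-injective (trans (sym eq′) eqk)
    ...   | refl with box-of q (<-trans (n<1+n q) k<) | at (descents T m) q in dq
    ...     | _ , _   | false =
            contradiction (trans (sym μq) (proj₂ (compatible q (flat p≤q′ (n<1+n q) v≡)) dq)) λ ()
    ...     | c , eqc | true
              with does⁻ (descent←? T (suc q)) (trans (sym (at-applyUpTo _ m (s≤s⁻¹ k<))) dq)
    ...       | d , d′ , eqd , eqd′ , col≤ with injective d c (trans eqd (sym eqc))
            | injective d′ b′ (trans eqd′ (sym eq′))
    ...         | refl | refl with marked-run q p b c eq eqc p≤q′ (squeeze p≤q′ (n≤1+n q) v≡)
                                     (proj₁ (compatible q (flat p≤q′ (n<1+n q) v≡)) dq)
    ...           | μp , col≤′ = μp , ≤-trans col≤ col≤′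

    -- Dually, a run that starts unmarked has only ascents, since a descent needs a marked letter on
    -- its left.
    unmarked-run : ∀ q p b b′ → T ! b ≡ suc p → T ! b′ ≡ suc q → p ≤ q → v p ≡ v q →
                   at μ p ≡ false → at μ q ≡ false × (b ≡ b′ ⊎ col b < col b′)
    unmarked-run q p b b′ eq eq′ p≤q v≡ μp with m≤n⇒m<n∨m≡n p≤q
    ... | inj₂ refl = μp , inj₁ (injective b b′ (trans eq (sym eq′)))
    unmarked-run (suc q) p b b′ eq eq′ p≤q v≡ μp | inj₁ (s≤s p≤q′) with entry b′
    ... | k , eqk , k< with suc-injective (trans (sym eq′) eqk)
    ...   | refl with box-of q (<-trans (n<1+n q) k<)
    ...     | c , eqc with unmarked-run q p b c eq eqc p≤q′ (squeeze p≤q′ (n≤1+n q) v≡) μp | at (descents T m) q in dq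
    ...       | μq , _ | true =
            contradiction (trans (sym (proj₁ (compatible q (flat p≤q′ (n<1+n q) v≡)) dq)) μq) λ ()
    ...       | μq , b≤c | false = proj₂ (compatible q (flat p≤q′ (n<1+n q) v≡)) dq , inj₂ (right b≤c)
      where
      ascent : col c < col b′
      ascent = ≰⇒> λ col≤ → contradiction
        (trans (sym (dec-true (descent←? T (suc q)) (c , b′ , eqc , eq′ , col≤)))
               (trans (sym (at-applyUpTo (does ∘ descent←? T ∘ suc) m (s≤s⁻¹ k<))) dq)) λ ()
      right : b ≡ c ⊎ col b < col c → col b < col b′
      right (inj₁ refl) = ascent
      right (inj₂ b<c)  = <-trans b<c ascent

  data Comparison (b b′ : Box α) : Set where
    strictly      : R ! b <ᴸ R ! b′ → Comparison b b′
    marked≡   : R ! b ≡ R ! b′ → IsMarked (R ! b) → col b′ ≤ col b → Comparison b b′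
    unmarked≡ : R ! b ≡ R ! b′ → ¬ IsMarked (R ! b) → col b < col b′ → Comparison b b′

  comparison : ∀ b b′ → T ! b < T ! b′ → Comparison b b′
  comparison b b′ T< with entry b | entry b′
  ... | p , eq , _ | q , eq′ , _ with s≤s⁻¹ (subst₂ _<_ eq eq′ T<)
  ...   | p<q with m≤n⇒m<n∨m≡n (wordIndex-mono 1 g (<⇒≤ p<q)) | relabel-! g μ T b eq
          | relabel-! g μ T b′ eq′
  ...     | inj₁ v< | Rb | Rb′ = strictly (index-< (R ! b) (R ! b′) (subst₂ _<_
              (sym (trans (cong index Rb) (index-letter (at μ p) (v p))))
              (sym (trans (cong index Rb′) (index-letter (at μ q) (v q)))) v<))
  ...     | inj₂ v≡ | Rb | Rb′ with at μ p in μp | at μ q in μq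
  ...       | true  | true  = marked≡ (trans Rb (trans (cong marked v≡) (sym Rb′)))
          (subst IsMarked (sym Rb) marked)
                                (proj₂ (marked-run q p b b′ eq eq′ (<⇒≤ p<q) v≡ μq))
  ...       | true  | false = strictly (subst₂ _<ᴸ_ (sym Rb) (sym (trans Rb′ (cong unmarked (sym v≡))))
          (n<1+n _))
  ...       | false | true  =
          contradiction (trans (sym μp) (proj₁ (marked-run q p b b′ eq eq′ (<⇒≤ p<q) v≡ μq))) λ ()
  ...       | false | false = unmarked≡ (trans Rb (trans (cong unmarked v≡) (sym Rb′))) (¬marked Rb)
          (strict (proj₂
                                (unmarked-run q p b b′ eq eq′ (<⇒≤ p<q) v≡ μp)))
    where
    ¬marked : ∀ {x i} → x ≡ unmarked i → ¬ IsMarked x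
    ¬marked refl ()
    strict : b ≡ b′ ⊎ col b < col b′ → col b < col b′
    strict (inj₁ refl) = contradiction T< (n≮n _)
    strict (inj₂ lt)   = lt

  relabel-marked : PeakComposition α → Marked R
  relabel-marked (α>0 , _) = record { rows = rowsᴬ ; below = belowᴰ }
    where
    rowsᴬ : ∀ b b′ → row b ≡ row b′ → col b < col b′ → R ! b ≤ᴬ R ! b′
    rowsᴬ b b′ r≡ c< with comparison b b′ (rows b b′ r≡ c<)
    ... | strictly lt            = inj₁ lt
    ... | marked≡ _ _ c≤     = contradiction c< (≤⇒≯ c≤)
    ... | unmarked≡ eq ¬mk _ = inj₂ (eq , ¬mk)

    R-≤ : ∀ b b′ → T ! b < T ! b′ → R ! b ≤ᴸ R ! b′
    R-≤ b b′ T< with comparison b b′ T<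
    ... | strictly lt          = <⇒≤ lt
    ... | marked≡ eq _ _   = ≤-reflexive (cong rank eq)
    ... | unmarked≡ eq _ _ = ≤-reflexive (cong rank eq)

    first≤ : ∀ b₁ b′ → row b₁ ≡ row b′ → col b₁ ≡ 1 → R ! b₁ ≤ᴸ R ! b′
    first≤ b₁ b′ r≡ c≡ with m≤n⇒m<n∨m≡n (1≤col b′)
    ... | inj₁ 1<c = R-≤ b₁ b′ (rows b₁ b′ r≡ (subst (_< col b′) (sym c≡) 1<c))
    ... | inj₂ 1≡c = ≤-reflexive (cong (λ d → rank (R ! d)) (same-box r≡ (trans c≡ 1≡c)))

    belowᴰ : ∀ b b′ → row b < row b′ → col b ≤ 2 → R ! b ≤ᴰ R ! b′
    belowᴰ b b′ r< c≤2 with comparison b b′ (below b b′ r< c≤2)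
    ... | strictly lt        = inj₁ lt
    ... | marked≡ eq mk _ = inj₂ (eq , mk)
    -- An unmarked tie is possible only with a box strictly to the right of b. The first box b₁ of
    -- the row of b′ is not one, so already its letter exceeds that of b.
    ... | unmarked≡ eq ¬mk c< with firstBox α>0 (toℕ (rowIndex b′)) (row-< b′)
    ...   | b₁ , at₁ with comparison b b₁ (below b b₁ (subst (row b <_) (sym (cong proj₂ at₁)) r<) c≤2)
    ...     | strictly lt           =
            inj₁ (<-≤-trans lt (first≤ b₁ b′ (cong proj₂ at₁) (cong proj₁ at₁)))
    ...     | marked≡ _ mk _    = contradiction mk ¬mk
    ...     | unmarked≡ _ _ c<₁ = contradiction (subst (col b <_) (cong proj₁ at₁) c<₁) (≤⇒≯ (1≤col b))

  -- The order of the entries of T is recovered from the relabelled tableau; this is where two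
  -- boxes in one column must be comparable.
  precedes : Narrow α → ∀ b b′ → T ! b < T ! b′ → Precedence._≺_ R b b′
  precedes narrow b b′ T< with comparison b b′ T<
  ... | strictly lt = inj₁ lt
  ... | unmarked≡ eq ¬mk c< = inj₂ (cong rank eq , inj₁ (unmarked-< (R ! b) (R ! b′) eq ¬mk c<))
    where
    unmarked-< : ∀ x y → x ≡ y → ¬ IsMarked x → ∀ {c c′} → c < c′ →
                 orientedColumn x c ℤ.< orientedColumn y c′
    unmarked-< (marked _)   _ refl ¬mk _  = contradiction marked ¬mk
    unmarked-< (unmarked _) _ refl _   c< = ℤ.+<+ c<
  ... | marked≡ eq mk c≤ with m≤n⇒m<n∨m≡n c≤
  ...   | inj₁ c< = inj₂ (cong rank eq , inj₁ (marked-< (R ! b) (R ! b′) eq mk c<))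
    where
    marked-< : ∀ x y → x ≡ y → IsMarked x → ∀ {c c′} → c′ < c →
               orientedColumn x c ℤ.< orientedColumn y c′
    marked-< (marked _) _ refl _ c< = ℤ.neg-mono-< (ℤ.+<+ c<)
  ...   | inj₂ c≡ = inj₂ (cong rank eq , inj₂ (cong₂ orientedColumn eq (sym c≡) , row<))
    where
    row< : row b < row b′
    row< with <-cmp (row b) (row b′)
    ... | tri< lt _ _ = lt
    ... | tri≈ _ r≡ _ = contradiction T< (λ T< → <⇒≢ T< (cong (T !_) (same-box r≡ (sym c≡))))
    ... | tri> _ _ gt with col b ≤? 2
    ...   | yes c≤2 = contradiction (below b′ b gt (subst (_≤ 2) (sym c≡) c≤2)) (<-asym T<)
    ...   | no  c≰2 = contradiction (narrow b b′ (subst (3 ≤_) (sym c≡) (≰⇒> c≰2)) (<⇒≤ (≰⇒> c≰2)))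
            (<⇒≱ gt)

-- Recovering the standard filling and the enriched word

-- Used to recover the word of indices from its weight. The smaller of two distinct heads would be
-- missing from the other list.
sorted-equal : ∀ {xs ys} → AllPairs _≤_ xs → AllPairs _≤_ ys →
               (∀ x → occurrences x xs ≡ occurrences x ys) → xs ≡ ys
sorted-equal {[]}     {[]}     _ _ _  = refl
sorted-equal {[]}     {y ∷ ys} _ _ eq = contradiction (eq y) λ e →
  contradiction (trans e (cong (λ b → ind b + occurrences y ys) (dec-true (y ≟ y) refl))) λ ()
sorted-equal {x ∷ xs} {[]}     _ _ eq = contradiction (eq x) λ e →
  contradiction (trans (sym e) (cong (λ b → ind b + occurrences x xs) (dec-true (x ≟ x) refl))) λ ()
sorted-equal {x ∷ xs} {y ∷ ys} (x≤ ∷ xs-sorted) (y≤ ∷ ys-sorted) eq with <-cmp x y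
... | tri≈ _ refl _ = cong (x ∷_) (sorted-equal xs-sorted ys-sorted λ z →
        +-cancelˡ-≡ (ind (does (x ≟ z))) _ _ (eq z))
... | tri< x<y _ _ = contradiction (eq x) λ e → contradiction
        (trans (sym (trans e (occurrences-none (x<y ∷ All.map (<-≤-trans x<y) y≤))))
               (cong (λ b → ind b + occurrences x xs) (dec-true (x ≟ x) refl))) λ ()
... | tri> _ _ y<x = contradiction (eq y) λ e → contradiction
        (trans (sym (trans (sym e) (occurrences-none (y<x ∷ All.map (<-≤-trans y<x) x≤))))
               (cong (λ b → ind b + occurrences y ys) (dec-true (y ≟ y) refl))) λ ()

module Destandardize {α m} (peakα : PeakComposition α) (narrow : Narrow α) (sum≡ : sum α ≡ suc m)
                     (g : List Bool) (length-g : length g ≡ m) {M : Filling Letter α}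
                         (marked-M : Marked M)
                     (index-range : ∀ b → 1 ≤ index (M ! b) × index (M ! b) ≤ sum α)
                     (wt≡ : wt M ≡ pad (sum α) (decode g)) where
  open Precedence M
  open Marked marked-M

  private
    T = standardization
    v = wordIndex 1 g
    open Bijective standardization-bijective

    rows-≺ : ∀ b b′ → row b ≡ row b′ → col b < col b′ → b ≺ b′
    rows-≺ b b′ r≡ c< with rows b b′ r≡ c<
    ... | inj₁ lt         = inj₁ lt
    ... | inj₂ (eq , ¬mk) = inj₂ (cong rank eq , inj₁ (right (M ! b) (M ! b′) eq ¬mk))
      where
      right : ∀ x y → x ≡ y → ¬ IsMarked x → orientedColumn x (col b) ℤ.< orientedColumn y (col b′)
      right (marked _)   _ refl ¬mk = contradiction marked ¬mk
      right (unmarked _) _ refl _   = ℤ.+<+ c<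

    -- Were b′ strictly to the right of b, the first letter of its row would be caught between two
    -- equal marked letters, and the row would repeat a marked letter.
    left-or-same : ∀ b b′ → row b < row b′ → col b ≤ 2 → M ! b ≡ M ! b′ → IsMarked (M ! b) →
                   col b′ ≤ col b
    left-or-same b b′ r< c≤2 eq mk = ≮⇒≥ λ c< →
      let b₁ , at₁ = firstBox (proj₁ peakα) (toℕ (rowIndex b′)) (row-< b′)
          c₁<c′ = subst (_< col b′) (sym (cong proj₁ at₁)) (≤-<-trans (1≤col b) c<)
      in  excluded (below b b₁ (subst (row b <_) (sym (cong proj₂ at₁)) r<) c≤2)
                   (rows b₁ b′ (cong proj₂ at₁) c₁<c′)
      where
      excluded : ∀ {x} → M ! b ≤ᴰ x → x ≤ᴬ M ! b′ → ⊥
      excluded (inj₁ x<y)        y≤z                = <⇒≢ (<-≤-trans x<y (≤ᴬ⇒≤ y≤z)) (cong rank eq)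
      excluded (inj₂ (refl , _)) (inj₁ y<z)         = <⇒≢ y<z (cong rank eq)
      excluded (inj₂ (refl , _)) (inj₂ (_ , ¬mk))   = ¬mk mk

    below-≺ : ∀ b b′ → row b < row b′ → col b ≤ 2 → b ≺ b′
    below-≺ b b′ r< c≤2 with below b b′ r< c≤2
    ... | inj₁ lt        = inj₁ lt
    ... | inj₂ (eq , mk) with m≤n⇒m<n∨m≡n (left-or-same b b′ r< c≤2 eq mk)
    ...   | inj₁ c< = inj₂ (cong rank eq , inj₁ (left (M ! b) (M ! b′) eq mk))
      where
      left : ∀ x y → x ≡ y → IsMarked x → orientedColumn x (col b) ℤ.< orientedColumn y (col b′)
      left (marked _) _ refl _ = ℤ.neg-mono-< (ℤ.+<+ c<)
    ...   | inj₂ c≡ = inj₂ (cong rank eq , inj₂ (cong₂ orientedColumn eq (sym c≡) , r<))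

  standard-T : Standard T
  standard-T = record
    { bijective = standardization-bijective
    ; rows      = λ b b′ r≡ c< → standardization-mono b b′ (rows-≺ b b′ r≡ c<)
    ; below     = λ b b′ r< c≤2 → standardization-mono b b′ (below-≺ b b′ r< c≤2)
    }

  private
    -- Beyond the last entry the box containing 1 serves as a default, which makes `boxAt` total.
    chooseBox : ∀ k → ∃[ b ] (k < sum α → T ! b ≡ suc k)
    chooseBox k with k <? sum α
    ... | yes k< = let b , eq = surjective (suc k) (s≤s z≤n) k< in b , λ _ → eq
    ... | no  k≮ = proj₁ (surjective 1 ≤-refl (subst (1 ≤_) (sym sum≡) (s≤s z≤n))) , λ k< →
            contradiction k< k≮

    boxAt : ℕ → Box α
    boxAt k = proj₁ (chooseBox k)

    boxAt-entry : ∀ {k} → k < sum α → T ! boxAt k ≡ suc k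
    boxAt-entry {k} = proj₂ (chooseBox k)

    entry : ∀ b → ∃[ k ] (T ! b ≡ suc k × k < sum α)
    entry b with T ! b | range b
    ... | suc k | _ , k< = k , refl , k<

    boxAt-≡ : ∀ b {k} → T ! b ≡ suc k → k < sum α → boxAt k ≡ b
    boxAt-≡ b eq k< = injective _ b (trans (boxAt-entry k<) (sym eq))

    ι : ℕ → ℕ
    ι k = index (M ! boxAt k)

    μ : List Bool
    μ = applyUpTo (isMarked ∘ (M !_) ∘ boxAt) (sum α)

    boxAt-≺ : ∀ {k l} → k < l → l < sum α → boxAt k ≺ boxAt l
    boxAt-≺ {k} {l} k<l l<n with ≺-total (boxAt k) (boxAt l) (λ eq → <⇒≢ k<l (suc-injective
      (trans (sym (boxAt-entry (<-trans k<l l<n))) (trans (cong (T !_) eq) (boxAt-entry l<n)))))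
    ... | inj₁ lt = lt
    ... | inj₂ gt = contradiction (subst₂ _<_ (boxAt-entry l<n) (boxAt-entry (<-trans k<l l<n))
            (standardization-mono _ _ gt))
                                  (<-asym (s≤s k<l))

    rank-≺ : ∀ {b b′} → b ≺ b′ → M ! b ≤ᴸ M ! b′
    rank-≺ (inj₁ lt)       = <⇒≤ lt
    rank-≺ (inj₂ (eq , _)) = ≤-reflexive eq

    -- For x between 1 and n the weight decides; any other x occurs in neither word.
    counts : ∀ x → occurrences x (applyUpTo ι (sum α)) ≡ occurrences x (applyUpTo v (sum α))
    counts x with 1 ≤? x | x ≤? sum α
    counts (suc x) | yes _ | yes x< = applyUpTo-injective (sum α)
      (trans (sym (wt-bijective {M = M} standardization-bijective ι λ b →
                let k , eq , k< = entry b in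
                cong (index ∘ (M !_))
                    (trans (sym (boxAt-≡ b eq k<)) (cong (λ t → boxAt (t ∸ 1)) (sym eq)))))
        (trans wt≡ (trans
          (sym (occurrences-word 1 g (sum α)
              (subst (length (decode g) ≤_) (trans (cong suc length-g) (sym sum≡))
                  (length-decode-≤ g))))
          (applyUpTo-cong (sum α) λ k _ → cong (occurrences (suc k))
            (trans (word-applyUpTo 1 g) (cong (applyUpTo v) (trans (cong suc length-g) (sym sum≡))))))))
      x x<
    ... | yes _ | no x≰n = trans (out ι λ k k< → proj₂ (index-range (boxAt k)))
                                 (sym (out v λ k k< → ≤-trans (wordIndex-≤ 1 g k)
                                     (subst (_≤ sum α) (+-comm 1 k) k<)))
      where
      out : ∀ f → (∀ k → k < sum α → f k ≤ sum α) → occurrences x (applyUpTo f (sum α)) ≡ 0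
      out f f≤ = #-none _ (applyUpTo f (sum α)) λ {y} y∈ → let k , k< , eq = ∈-applyUpTo⁻ f y∈ in
        dec-false (y ≟ x) λ y≡x → x≰n (subst (_≤ sum α) (trans (sym eq) y≡x) (f≤ k k<))
    ... | no x<1 | _ = trans (out ι λ k → proj₁ (index-range (boxAt k)))
            (sym (out v λ k → wordIndex-mono 1 g {l = k} z≤n))
      where
      out : ∀ f → (∀ k → 1 ≤ f k) → occurrences x (applyUpTo f (sum α)) ≡ 0
      out f 1≤f = #-none _ (applyUpTo f (sum α)) λ {y} y∈ → let k , _ , eq = ∈-applyUpTo⁻ f y∈ in
        dec-false (y ≟ x) λ y≡x → x<1 (subst (1 ≤_) (trans (sym eq) y≡x) (1≤f k))

    -- The order `≺` compares letters first, so the indices read along the entries of the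
    -- standardization form a sorted word, and its weight identifies it.
    ι≡v : ∀ k → k < sum α → ι k ≡ v k
    ι≡v = applyUpTo-injective (sum α) (sorted-equal
      (AllPairs.applyUpTo⁺₁ ι (sum α) λ {k} {l} k<l l<n → index-mono (M ! boxAt k) (M ! boxAt l)
          (rank-≺ (boxAt-≺ k<l l<n)))
      (AllPairs.applyUpTo⁺₁ v (sum α) λ k<l _ → wordIndex-mono 1 g (<⇒≤ k<l))
      counts)

    isMarked⁺ : ∀ {x} → IsMarked x → isMarked x ≡ true
    isMarked⁺ marked = refl

    isMarked-false : ∀ {x} → ¬ IsMarked x → isMarked x ≡ false
    isMarked-false {marked _}   ¬mk = contradiction marked ¬mk
    isMarked-false {unmarked _} _   = refl

    -- The only distinct letters of equal index in increasing order are i′ and i; the last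
    -- hypothesis excludes this pair.
    equal-letters : ∀ x y → x ≤ᴸ y → index x ≡ index y → ¬ IsMarked x ⊎ IsMarked y → x ≡ y
    equal-letters (marked i)   (marked .i)   _   refl _          = refl
    equal-letters (marked i)   (unmarked .i) _   refl (inj₁ ¬mk) = contradiction marked ¬mk
    equal-letters (marked i)   (unmarked .i) _   refl (inj₂ ())
    equal-letters (unmarked i) (marked .i)   x≤y refl _          = contradiction x≤y (n≮n _)
    equal-letters (unmarked i) (unmarked .i) _   refl _          = refl

    unmarked-right : ∀ b b′ → b ≺ b′ → M ! b ≡ M ! b′ → ¬ IsMarked (M ! b) → col b < col b′
    unmarked-right b b′ (inj₁ lt) eq ¬mk = contradiction (cong rank eq) (<⇒≢ lt)
    unmarked-right b b′ (inj₂ (_ , inj₁ lt)) eq ¬mk = right (M ! b) (M ! b′) eq ¬mk lt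
      where
      right : ∀ x y → x ≡ y → ¬ IsMarked x → orientedColumn x (col b) ℤ.< orientedColumn y (col b′) →
              col b < col b′
      right (marked _)   _ refl ¬mk _  = contradiction marked ¬mk
      right (unmarked _) _ refl _   (ℤ.+<+ c<) = c<
    -- A tie within one column: in columns 1 and 2 only marked letters tie, and further right
    -- narrowness leaves a single row.
    unmarked-right b b′ (inj₂ (_ , inj₂ (c≡ , r<))) eq ¬mk with col b ≤? 2
    ... | yes c≤2 = contradiction (below b b′ r< c≤2) λ
        { (inj₁ lt) → <⇒≢ lt (cong rank eq) ; (inj₂ (_ , mk)) → ¬mk mk }
    ... | no  c≰2 = contradiction (narrow b′ b (≰⇒> c≰2) (subst (2 ≤_) col≡ (<⇒≤ (≰⇒> c≰2)))) (<⇒≱ r<)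
      where
      col≡ : col b ≡ col b′
      col≡ = orientedColumn-injective (M ! b)
          (trans c≡ (cong (λ x → orientedColumn x (col b′)) (sym eq)))

    marked-left : ∀ b b′ → b ≺ b′ → M ! b ≡ M ! b′ → IsMarked (M ! b) → col b′ ≤ col b
    marked-left b b′ (inj₁ lt) eq mk = contradiction (cong rank eq) (<⇒≢ lt)
    marked-left b b′ (inj₂ (_ , inj₁ lt)) eq mk = left (M ! b) (M ! b′) eq mk lt
      where
      left : ∀ x y → x ≡ y → IsMarked x → orientedColumn x (col b) ℤ.< orientedColumn y (col b′) →
             col b′ ≤ col b
      left (marked _) _ refl _ lt with ℤ.neg-cancel-< lt
      ... | ℤ.+<+ c< = <⇒≤ c<
    marked-left b b′ (inj₂ (_ , inj₂ (c≡ , _))) eq mk =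
      ≤-reflexive (sym
          (orientedColumn-injective (M ! b)
              (trans c≡ (cong (λ x → orientedColumn x (col b′)) (sym eq)))))

    compatible : Compatible (descents T m) g μ
    compatible k gk with suc k <? sum α
    ... | no ¬k+1< = (λ dk → contradiction (trans (sym dk) (at-beyond (descents T m) beyond)) λ ()) ,
                     (λ _ → at-beyond μ (subst (_≤ suc k) (sym (List.length-applyUpTo _ (sum α)))
                         (≮⇒≥ ¬k+1<)))
      where
      beyond : length (descents T m) ≤ k
      beyond = subst (_≤ k) (sym (List.length-applyUpTo _ m))
          (s≤s⁻¹ (subst (_≤ suc k) sum≡ (≮⇒≥ ¬k+1<)))
    ... | yes k+1< = descent , ascent
      where
      k<  = <-trans (n<1+n k) k+1<
      k<m = s≤s⁻¹ (subst (suc k <_) sum≡ k+1<)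
      b   = boxAt k
      b′  = boxAt (suc k)
      b≺b′ : b ≺ b′
      b≺b′ = boxAt-≺ (n<1+n k) k+1<
      index≡ : index (M ! b) ≡ index (M ! b′)
      index≡ = trans (ι≡v k k<) (trans (cong (λ c → if c then suc (v k) else v k) (sym gk))
          (sym (ι≡v (suc k) k+1<)))
      dk≡ : at (descents T m) k ≡ does (descent←? T (suc k))
      dk≡ = at-applyUpTo _ m k<m

      descent : at (descents T m) k ≡ true → at μ k ≡ true
      descent dk = trans (at-applyUpTo _ (sum α) k<) (isMarked⁺ mk)
        where
        mk : IsMarked (M ! b)
        mk with isMarked? (M ! b) | does⁻ (descent←? T (suc k)) (trans (sym dk≡) dk)
        ... | yes mk | _ = mk
        ... | no ¬mk | d , d′ , eq , eq′ , c≤ with boxAt-≡ d eq k< | boxAt-≡ d′ eq′ k+1<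
        ...   | refl | refl = contradiction
                (unmarked-right b b′ b≺b′ (equal-letters _ _ (rank-≺ b≺b′) index≡ (inj₁ ¬mk)) ¬mk)
                    (≤⇒≯ c≤)

      ascent : at (descents T m) k ≡ false → at μ (suc k) ≡ false
      ascent dk = trans (at-applyUpTo _ (sum α) k+1<) (isMarked-false λ mk → contradiction
        (trans (sym (trans dk≡
            (dec-true (descent←? T (suc k)) (b , b′ , boxAt-entry k< , boxAt-entry k+1< , left mk))))
                dk) λ ())
        where
        left : IsMarked (M ! b′) → col b′ ≤ col b
        left mk = let eq = equal-letters _ _ (rank-≺ b≺b′) index≡ (inj₂ mk) in
                  marked-left b b′ b≺b′ eq (subst IsMarked (sym eq) mk)

    relabel≡ : M ≡ relabel g μ T
    relabel≡ = filling-ext λ b → let k , eq , k< = entry b in trans (letter≡ b k eq k<) (sym (relabel-! g μ T b eq))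
      where
      letter≡ : ∀ b k → T ! b ≡ suc k → k < sum α → M ! b ≡ letterAt g μ k
      letter≡ b k eq k< with boxAt-≡ b eq k<
      ... | refl = trans (sym (letter-isMarked (M ! b)))
              (cong₂ letter (sym (at-applyUpTo _ (sum α) k<)) (ι≡v k k<))

  destandardize : ∃[ T ] ∃[ μ ] (Standard T × length μ ≡ suc m × Compatible (descents T m) g μ ×
                                 M ≡ relabel g μ T)
  destandardize = T , μ , standard-T , trans (List.length-applyUpTo _ (sum α))
      sum≡ , compatible , relabel≡

-- Coefficients of the two series as numbers of tableaux and of pairs

∈-letters⁺ : ∀ {n} x → 1 ≤ index x → index x ≤ n → x ∈ letters n
∈-letters⁺ x 1≤i i≤n = ∈-concat⁺′ (x∈ x) (∈-map⁺ _ (∈-[1⋯]⁺ 1≤i i≤n))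
  where
  x∈ : ∀ x → x ∈ marked (index x) ∷ unmarked (index x) ∷ []
  x∈ (marked i)   = here refl
  x∈ (unmarked i) = there (here refl)

∈-letters⁻ : ∀ {n x} → x ∈ letters n → 1 ≤ index x × index x ≤ n
∈-letters⁻ {n} x∈ with ∈-concat⁻′ (map (λ i → marked i ∷ unmarked i ∷ []) [1⋯ n ]) x∈
... | _ , x∈′ , xs∈ with ∈-map⁻ (λ i → marked i ∷ unmarked i ∷ []) xs∈
...   | i , i∈ , refl with x∈′
...     | here refl         = ∈-[1⋯]⁻ i∈
...     | there (here refl) = ∈-[1⋯]⁻ i∈

letters-unique : ∀ n → Unique (letters n)
letters-unique n = Unique.concat⁺
  (All.map⁺ (All.tabulate λ _ → ((λ ()) ∷ []) ∷ [] ∷ []))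
  (AllPairs.map⁺ (AllPairs.map (λ i≢j {x} (x∈ , x∈′) → i≢j (trans (sym (index≡ x∈)) (index≡ x∈′)))
      ([1⋯]-unique n)))
  where
  index≡ : ∀ {x i} → x ∈ marked i ∷ unmarked i ∷ [] → index x ≡ i
  index≡ (here refl)         = refl
  index≡ (there (here refl)) = refl

MPCT-unique : ∀ α → Unique (MPCT α)
MPCT-unique α = Unique.filter⁺ _ (fillings-unique (letters-unique (sum α)) α)

SPYCT-unique : ∀ α → Unique (SPYCT α)
SPYCT-unique α = Unique.filter⁺ _ (fillings-unique ([1⋯]-unique (sum α)) α)

∈-MPCT⁻ : ∀ {M} → M ∈ MPCT α → (∀ b → 1 ≤ index (M ! b) × index (M ! b) ≤ sum α) ×
                               IsMarkedPeakTableau M × NoInternalZeros (wt M)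
∈-MPCT⁻ {α} M∈ with ∈-filter⁻ (λ T → isMarkedPeakTableau? T ×-dec noInternalZeros? (wt T))
    {xs = fillings (letters (sum α)) α} M∈
... | M∈′ , tab , ok = (∈-letters⁻ ∘ ∈-fillings⁻ M∈′) , tab , ok

∈-MPCT⁺ : ∀ {M} → (∀ b → 1 ≤ index (M ! b) × index (M ! b) ≤ sum α) →
          IsMarkedPeakTableau M → NoInternalZeros (wt M) → M ∈ MPCT α
∈-MPCT⁺ {M = M} range tab ok = ∈-filter⁺ (λ T → isMarkedPeakTableau? T ×-dec noInternalZeros? (wt T))
  (∈-fillings⁺ M λ b → ∈-letters⁺ (M ! b) (proj₁ (range b)) (proj₂ (range b))) (tab , ok)

∈-SPYCT⁻ : ∀ {T} → T ∈ SPYCT α → IsStandardPeakYoungTableau T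
∈-SPYCT⁻ {α} = proj₂ ∘ ∈-filter⁻ isStandardPeakYoungTableau? {xs = fillings [1⋯ sum α ] α}

∈-SPYCT⁺ : ∀ {T} → IsStandardPeakYoungTableau T → T ∈ SPYCT α
∈-SPYCT⁺ {T = T} tab = ∈-filter⁺ isStandardPeakYoungTableau?
  (∈-fillings⁺ T λ b → let p , q = IsStandardPeakYoungTableau.standard tab b in ∈-[1⋯]⁺ p q) tab

weighted : ∀ α → List ℕ → List (Filling Letter α)
weighted α γ = filter (λ M → γ ≟ᶜ omitZeros (wt M)) (MPCT α)

Q̃-coefficient : ∀ α e → Q̃ α e ≡ length (weighted α (omitZeros e))
Q̃-coefficient α e = trans (∑-M (omitZeros ∘ wt) (MPCT α) (λ {M} _ → omitZeros-composition (wt M)) e)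
  (sym (length-filter-# (λ M → omitZeros e ≟ᶜ omitZeros (wt M)) (MPCT α)))

length-filter-true : {A : Set} (p : A → Bool) → ∀ xs →
                     length (filter (λ x → p x Bool.≟ true) xs) ≡ # p xs
length-filter-true p xs = trans (length-filter-# (λ x → p x Bool.≟ true) xs)
  (#-cong xs λ {x} _ → bool-ext (does⁻ (p x Bool.≟ true)) (dec-true (p x Bool.≟ true)))

sum-map-+ : {A : Set} (f h : A → ℕ) → ∀ xs → sum (map (λ x → f x + h x) xs) ≡
            sum (map f xs) + sum (map h xs)
sum-map-+ f h []       = refl
sum-map-+ f h (x ∷ xs) rewrite sum-map-+ f h xs = solve 4
  (λ a b c d → (a :+ b) :+ (c :+ d) := (a :+ c) :+ (b :+ d)) refl (f x) (h x) (sum (map f xs))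
      (sum (map h xs))
  where open +-*-Solver

sum-fibres : {A : Set} (f : A → ℕ) → ∀ n xs → (∀ x → 1 ≤ f x × f x ≤ n) →
             sum (map (λ i → # (λ x → does (f x ≟ i)) xs) [1⋯ n ]) ≡ length xs
sum-fibres f n []       range = zeros [1⋯ n ]
  where
  zeros : (is : List ℕ) → sum (map (const 0) is) ≡ 0
  zeros []       = refl
  zeros (_ ∷ is) = zeros is
sum-fibres f n (x ∷ xs) range =
  trans (sum-map-+ (λ i → ind (does (f x ≟ i))) (λ i → # (λ x → does (f x ≟ i)) xs) [1⋯ n ])
        (cong₂ _+_ (trans (sum-ind (λ i → does (f x ≟ i)) [1⋯ n ])
                          (#-singleton _ ([1⋯]-unique n) (∈-[1⋯]⁺ (proj₁ (range x)) (proj₂ (range x)))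
                             (dec-true (f x ≟ f x) refl) (λ {i} _ eq → sym (does⁻ (f x ≟ i) eq))))
                   (sum-fibres f n xs range))

sum-omitZeros : ∀ c → sum (omitZeros c) ≡ sum c
sum-omitZeros []          = refl
sum-omitZeros (zero ∷ c)  = sum-omitZeros c
sum-omitZeros (suc a ∷ c) = cong (suc a +_) (sum-omitZeros c)

sum-wt : (M : Filling Letter α) → (∀ b → 1 ≤ index (M ! b) × index (M ! b) ≤ sum α) → sum (wt M) ≡ sum α
sum-wt {α} M range = trans
  (cong sum (List.map-cong (λ i → length-filter-# (λ b → index (M ! b) ≟ i) (allBoxes α)) [1⋯ sum α ]))
  (trans (sum-fibres (λ b → index (M ! b)) (sum α) (allBoxes α) range) (length-allBoxes α))

weighted-vanishes : ∀ α γ → sum γ ≢ sum α → length (weighted α γ) ≡ 0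
weighted-vanishes α γ neq =
    cong length (List.filter-none (λ M → γ ≟ᶜ omitZeros (wt M)) (All.tabulate λ {M} M∈ γ≡ →
  neq (trans (cong sum γ≡) (trans (sum-omitZeros (wt M)) (sum-wt {α} M (proj₁ (∈-MPCT⁻ {α} M∈)))))))

module _ {α m} (sum≡ : sum α ≡ suc m) where

  Peak←-descents : (T : Filling ℕ α) → Peak← T ≡ Peak (pos (descents T m))
  Peak←-descents T = cong Peak
    (trans (cong (λ n → filter (descent←? T) [1⋯ n ∸ 1 ]) sum≡) (filter-pos (descent←? T) m))

  length-descents : (T : Filling ℕ α) → length (descents T m) ≡ m
  length-descents T = List.length-applyUpTo _ m

  K-descents : ∀ e T → K (comp (sum α) (Peak← T)) e ≡
                       K (comp (suc (length (descents T m))) (Peak (pos (descents T m)))) e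
  K-descents e T = cong₂ (λ n X → K (comp n X) e)
    (trans sum≡ (cong suc (sym (length-descents T)))) (Peak←-descents T)

  S̃-coefficient : ∀ e g → length g ≡ m → decode g ≡ omitZeros e →
                  S̃ α e ≡ # (λ (T , μ) → chains (descents T m) g μ)
                      (cartesianProduct (SPYCT α) (bits (suc m)))
  S̃-coefficient e g len dec = trans (cong sum (List.map-cong step (SPYCT α)))
    (sym (#-cartesianProduct (λ (T , μ) → chains (descents T m) g μ) (SPYCT α) (bits (suc m))))
    where
    step : ∀ T → K (comp (sum α) (Peak← T)) e ≡ # (chains (descents T m) g) (bits (suc m))
    step T = trans (K-descents e T)
      (trans (K-chains (descents T m) e g (trans len (sym (length-descents T))) dec)
             (cong (λ l → # (chains (descents T m) g) (bits (suc l))) (length-descents T)))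

  S̃-vanishes : ∀ e → sum (omitZeros e) ≢ sum α → S̃ α e ≡ 0
  S̃-vanishes e neq = zeros (SPYCT α)
    where
    zeros : ∀ Ts → sum (map (λ T → K (comp (sum α) (Peak← T)) e) Ts) ≡ 0
    zeros []       = refl
    zeros (T ∷ Ts) = cong₂ _+_
      (trans (K-descents e T) (K-vanishes (descents T m) e λ eq →
        neq (trans eq (trans (cong suc (length-descents T)) (sym sum≡)))))
      (zeros Ts)

  module _ (g : List Bool) (length-g : length g ≡ m) where

    compatible⁻ : ∀ T μ → length μ ≡ suc m → chains (descents {α} T m) g μ ≡ true →
                  Compatible (descents T m) g μ
    compatible⁻ T (u ∷ us) len = chain⁻ u (descents T m) g us (trans (length-descents T) (sym length-g))
                                        (trans (suc-injective len) (sym length-g))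

    compatible⁺ : ∀ T μ → length μ ≡ suc m → Compatible (descents {α} T m) g μ →
                  chains (descents T m) g μ ≡ true
    compatible⁺ T (u ∷ us) len = chain⁺ u (descents T m) g us (trans (length-descents T) (sym length-g))
                                        (trans (suc-injective len) (sym length-g))

    module _ {T : Filling ℕ α} (std : Standard T) where
      open Standard std

      entry : ∀ b → ∃[ k ] (T ! b ≡ suc k × k < suc m)
      entry b with T ! b | range b
      ... | suc k | _ , k≤ = k , refl , subst (suc k ≤_) sum≡ k≤

      relabel-index : ∀ μ b → index (relabel g μ T ! b) ≡ wordIndex 1 g (T ! b ∸ 1)
      relabel-index μ b = trans (cong index (map-filling-! _ T b)) (index-letter (at μ (T ! b ∸ 1)) _)

      relabel-wt : ∀ μ → wt (relabel g μ T) ≡ pad (sum α) (decode g)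
      relabel-wt μ =
          trans (wt-bijective {M = relabel g μ T} bijective (wordIndex 1 g) (relabel-index μ)) (trans
        (applyUpTo-cong (sum α) λ k _ → cong (occurrences (suc k))
          (sym (trans (word-applyUpTo 1 g) (cong (applyUpTo (wordIndex 1 g)) length-g+1))))
        (occurrences-word 1 g (sum α) (subst (length (decode g) ≤_) length-g+1 (length-decode-≤ g))))
        where length-g+1 = trans (cong suc length-g) (sym sum≡)

      relabel-weighted : PeakComposition α → ∀ μ → Compatible (descents T m) g μ →
                         relabel g μ T ∈ weighted α (decode g)
      relabel-weighted peakα μ compatible = ∈-filter⁺ (λ M → decode g ≟ᶜ omitZeros (wt M))
        (∈-MPCT⁺ index-range (marked⁻ peakα (Word.relabel-marked sum≡ g std μ compatible peakα))
          (subst NoInternalZeros (sym (relabel-wt μ))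
              (pad-noInternalZeros (sum α) (decode-composition g))))
        (sym (trans (cong omitZeros (relabel-wt μ)) (omitZeros-pad (sum α) (decode-composition g))))
        where
        index-range : ∀ b → 1 ≤ index (relabel g μ T ! b) × index (relabel g μ T ! b) ≤ sum α
        index-range b rewrite relabel-index μ b with entry b
        ... | k , eq , k< rewrite eq | sum≡ =
          wordIndex-mono 1 g {l = k} z≤n , ≤-trans (wordIndex-≤ 1 g k)
              (subst (_≤ suc m) (+-comm 1 k) k<)

      -- Every position of the word is used by some box, so each mark is visible in the relabelled
      -- filling.
      relabel-marks : ∀ {μ μ′} → length μ ≡ suc m → length μ′ ≡ suc m →
                      relabel g μ T ≡ relabel g μ′ T → μ ≡ μ′
      relabel-marks {μ} {μ′} len len′ eq = at-ext (trans len (sym len′)) λ k k< →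
        let b , T≡ = surjective (suc k) (s≤s z≤n) (subst (suc k ≤_) (trans len (sym sum≡)) k<)
        in  letter-injective (trans (sym (relabel-! g μ T b T≡)) (trans (cong (_! b) eq) (relabel-! g μ′ T b T≡)))

-- Equality for narrow shapes

-- Relabelling is the bijection: T is recovered as the standardization of the result, because
-- `precedes` identifies the two orders on boxes; μ is recovered from the letters; surjectivity is
-- `destandardize`.
length-weighted : ∀ {m} → PeakComposition α → Narrow α → sum α ≡ suc m → ∀ g → length g ≡ m →
                  length (weighted α (decode g)) ≡
                  # (λ (T , μ) → chains (descents T m) g μ) (cartesianProduct (SPYCT α) (bits (suc m)))
length-weighted {α} {m} peakα narrow sum≡ g length-g =
  trans (sym (length-bijection Φ pairs-unique weighted-unique into injective onto))
        (length-filter-true test (cartesianProduct (SPYCT α) (bits (suc m))))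
  where
  test : Filling ℕ α × List Bool → Bool
  test (T , μ) = chains (descents T m) g μ

  pairs = filter (λ p → test p Bool.≟ true) (cartesianProduct (SPYCT α) (bits (suc m)))

  Φ : Filling ℕ α × List Bool → Filling Letter α
  Φ (T , μ) = relabel g μ T

  pairs-unique : Unique pairs
  pairs-unique = Unique.filter⁺ (λ p → test p Bool.≟ true)
      (Unique.cartesianProduct⁺ (SPYCT-unique α) (bits-unique (suc m)))

  weighted-unique : Unique (weighted α (decode g))
  weighted-unique = Unique.filter⁺ (λ M → decode g ≟ᶜ omitZeros (wt M)) (MPCT-unique α)

  ∈-pairs⁻ : ∀ {T μ} → (T , μ) ∈ pairs → Standard T × length μ ≡ suc m × Compatible (descents T m) g μ
  ∈-pairs⁻ {T} {μ} p∈ =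
    let p∈′ , ok = ∈-filter⁻ (λ p → test p Bool.≟ true) {xs = cartesianProduct (SPYCT α) (bits (suc m))} p∈
        T∈ , μ∈  = ∈-cartesianProduct⁻ (SPYCT α) (bits (suc m)) p∈′
        len      = ∈-bits⁻ (suc m) μ∈
    in  standard⁺ (∈-SPYCT⁻ {α} T∈) , len , compatible⁻ sum≡ g length-g T μ len ok

  into : ∀ {p} → p ∈ pairs → Φ p ∈ weighted α (decode g)
  into {T , μ} p∈ = let std , _ , compatible = ∈-pairs⁻ p∈ in
                    relabel-weighted sum≡ g length-g std peakα μ compatible

  T-determined : ∀ {T μ} → (T , μ) ∈ pairs → T ≡ Precedence.standardization (relabel g μ T)
  T-determined {T} {μ} p∈ = let std , _ , compatible = ∈-pairs⁻ p∈ in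
    Precedence.standardization-unique (relabel g μ T) T (Standard.bijective std)
      (Word.precedes sum≡ g std μ compatible narrow)

  injective : ∀ {p q} → p ∈ pairs → q ∈ pairs → Φ p ≡ Φ q → p ≡ q
  injective {T , μ} {T′ , μ′} p∈ q∈ eq =
    let std , len , _ = ∈-pairs⁻ p∈
        _ , len′ , _  = ∈-pairs⁻ q∈
        T≡T′          =
            trans (T-determined p∈) (trans (cong Precedence.standardization eq) (sym (T-determined q∈)))
    in  cong₂ _,_ T≡T′ (relabel-marks sum≡ g length-g std len len′
                          (trans eq (cong (relabel g μ′) (sym T≡T′))))

  onto : ∀ {M} → M ∈ weighted α (decode g) → ∃[ p ] (p ∈ pairs × M ≡ Φ p)
  onto {M} M∈ =
    let M∈′ , γ≡ = ∈-filter⁻ (λ M → decode g ≟ᶜ omitZeros (wt M)) {xs = MPCT α} M∈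
        index-range , tab , ok = ∈-MPCT⁻ {α} M∈′
        -- With all zeros trailing, the weight is determined by its nonzero entries.
        wt≡ = trans (pad-omitZeros ok)
                    (cong₂ pad (trans (List.length-map _ [1⋯ sum α ])
                        (List.length-applyUpTo suc (sum α))) (sym γ≡))
        T , μ , std , len , compatible , M≡ = Destandardize.destandardize peakα narrow sum≡ g length-g
          (marked⁺ peakα (proj₂ ∘ index-range) tab) index-range wt≡
        T∈ = ∈-SPYCT⁺ {α} (standard⁻ peakα std (narrow⇒triple narrow std))
        μ∈ = subst (λ l → μ ∈ bits l) len (∈-bits⁺ μ)
    in  (T , μ) ,
        ∈-filter⁺ (λ p → test p Bool.≟ true) (∈-cartesianProduct⁺ T∈ μ∈)
                  (compatible⁺ sum≡ g length-g T μ len compatible) ,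
        M≡

narrow⇒≈ : ∀ {m} → PeakComposition α → sum α ≡ suc m → Narrow α → Q̃ α ≈ S̃ α
narrow⇒≈ {α} {m} peakα sum≡ narrow e = by-weight (sum (omitZeros e) ≟ sum α)
  where
  open ≡-Reasoning
  by-weight : Dec (sum (omitZeros e) ≡ sum α) → Q̃ α e ≡ S̃ α e
  by-weight (no neq) = begin
    Q̃ α e                             ≡⟨ Q̃-coefficient α e ⟩
    length (weighted α (omitZeros e)) ≡⟨ weighted-vanishes α (omitZeros e) neq ⟩
    0                                 ≡⟨ S̃-vanishes {α} sum≡ e neq ⟨
    S̃ α e                             ∎
  by-weight (yes eq) =
    let g , length-g , dec = decode-surjective m (omitZeros-composition e) (trans eq sum≡) in begin
    Q̃ α e                             ≡⟨ Q̃-coefficient α e ⟩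
    length (weighted α (omitZeros e)) ≡⟨ cong (length ∘ weighted α) dec ⟨
    length (weighted α (decode g))    ≡⟨ length-weighted peakα narrow sum≡ g length-g ⟩
    # (λ (T , μ) → chains (descents T m) g μ) (cartesianProduct (SPYCT α) (bits (suc m)))
                                      ≡⟨ S̃-coefficient {α} sum≡ e g length-g dec ⟨
    S̃ α e                             ∎

-- Excess of marked tableaux for other shapes

far : ℕ → ℕ
far c = ind (does (3 ≤? c))

far≡0 : ∀ {c} → c ≤ 2 → far c ≡ 0
far≡0 {c} c≤2 = cong ind (dec-false (3 ≤? c) (<⇒≱ (s≤s c≤2)))

far≡1 : ∀ {c} → 3 ≤ c → far c ≡ 1
far≡1 {c} 3≤c = cong ind (dec-true (3 ≤? c) 3≤c)

-- Filling the first two columns, row by row, before all other boxes gives a standard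
-- filling that violates the triple condition unless the shape is narrow.
farKey : (α : List ℕ) → Box α → ℕ × ℤ × ℕ
farKey α b = far (col b) , ℤ.+ row b , col b

farKey-injective : (b b′ : Box α) → farKey α b ≡ farKey α b′ → b ≡ b′
farKey-injective b b′ eq = same-box (ℤ.+-injective (cong (proj₁ ∘ proj₂) eq)) (cong (proj₂ ∘ proj₂) eq)

module Far α = Standardization {α} (farKey α) farKey-injective

farTableau : ∀ α → Filling ℕ α
farTableau α = Far.standardization α

farTableau-standard : ∀ α → Standard (farTableau α)
farTableau-standard α = record
  { bijective = standardization-bijective
  ; rows      = λ b b′ r≡ c< → standardization-mono b b′ (rows b b′ r≡ c<)
  ; below     = λ b b′ r< c≤2 → standardization-mono b b′ (below b b′ r< c≤2)
  }
  where
  open Far α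
  rows : ∀ b b′ → row b ≡ row b′ → col b < col b′ → b ≺ b′
  rows b b′ r≡ c< with col b ≤? 2 | col b′ ≤? 2
  ... | yes c≤ | yes c′≤ = inj₂ (trans (far≡0 c≤) (sym (far≡0 c′≤)) , inj₂ (cong ℤ.+_ r≡ , c<))
  ... | yes c≤ | no c′≰  = inj₁ (subst₂ _<_ (sym (far≡0 c≤)) (sym (far≡1 (≰⇒> c′≰))) (s≤s z≤n))
  ... | no c≰  | yes c′≤ = contradiction (≤-trans (<⇒≤ c<) c′≤) c≰
  ... | no c≰  | no c′≰  =
          inj₂ (trans (far≡1 (≰⇒> c≰)) (sym (far≡1 (≰⇒> c′≰))) , inj₂ (cong ℤ.+_ r≡ , c<))

  below : ∀ b b′ → row b < row b′ → col b ≤ 2 → b ≺ b′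
  below b b′ r< c≤ with col b′ ≤? 2
  ... | yes c′≤ = inj₂ (trans (far≡0 c≤) (sym (far≡0 c′≤)) , inj₁ (ℤ.+<+ r<))
  ... | no c′≰  = inj₁ (subst₂ _<_ (sym (far≡0 c≤)) (sym (far≡1 (≰⇒> c′≰))) (s≤s z≤n))

box-in-row : (b : Box α) → ∀ c → c < col b → ∃[ d ] (row {α} d ≡ row b × col d ≡ suc c)
box-in-row (box r c′) c c< = box r (fromℕ< c<len) , refl , cong suc (toℕ-fromℕ< c<len)
  where c<len = <-≤-trans c< (toℕ<n c′)

-- Suppose a row with a box b in column 2 lies above a row with a box b′ in column 3. Then b has the
-- smaller entry, so the triple condition asks for a box in column 3 of the upper row with an entry
-- below that of b′. But from column 3 on the lower row is filled first.
triple⇒narrow : Triple (farTableau α) → Narrow α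
triple⇒narrow {α} triple b₀ b₀′ 3≤c 2≤c = ≮⇒≥ λ r< →
  let b , r , c   = box-in-row b₀ 1 2≤c
      b′ , r′ , c′ = box-in-row b₀′ 2 3≤c
      r′<r = subst₂ _<_ (sym r′) (sym r) r<
      T<   = standardization-mono b b′
          (inj₁ (subst₂ _<_ (sym (far≡0 (≤-reflexive c))) (sym (far≡1 (≤-reflexive (sym c′))))
              (s≤s z≤n)))
      d , rd , cd , Td< = triple b b′ (trans c′ (cong suc (sym c))) r′<r T<
      cd≡3 = trans cd (cong suc c)
  in  <-asym Td< (standardization-mono b′ d (inj₂
        ( trans (far≡1 (≤-reflexive (sym c′))) (sym (far≡1 (≤-reflexive (sym cd≡3))))
        , inj₁ (ℤ.+<+ (subst (row b′ <_) (sym rd) r′<r)))))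
  where open Far α

-- `decode (trues m)` has all parts 1: the exponents of x₁⋯xₙ for n = m + 1.
trues : ℕ → List Bool
trues m = replicate m true

omitZeros-trues : ∀ m → omitZeros (decode (trues m)) ≡ decode (trues m)
omitZeros-trues m = List.filter-all (λ u → ¬? (u ≟ 0))
    (All.map (λ 0<a → >⇒≢ 0<a) (decode-composition (trues m)))

wordIndex-trues : ∀ i m {k} → k ≤ m → wordIndex i (trues m) k ≡ k + i
wordIndex-trues i m       {zero}  _         = refl
wordIndex-trues i (suc m) {suc k} (s≤s k≤m) =
  trans (wordIndex-∷ i true (trues m) k) (trans (wordIndex-trues (suc i) m k≤m) (+-suc k i))

at-trues : ∀ m {i} → at (trues m) i ≡ false → m ≤ i
at-trues zero          _  = z≤n
at-trues (suc m) {suc i} eq = s≤s (at-trues m eq)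

compatible-trues : ∀ {m} ds μ → length ds ≡ m → length μ ≡ suc m → Compatible ds (trues m) μ
compatible-trues {m} ds μ len len′ i eq =
  (λ di → contradiction (trans (sym di) (at-beyond ds (subst (_≤ i) (sym len) m≤i))) λ ()) ,
  (λ _ → at-beyond μ (subst (_≤ suc i) (sym len′) (s≤s m≤i)))
  where m≤i = at-trues m eq

-- At this weight the index increases at every gap, so every marking is compatible with every T, and
-- the index of a letter is the entry that it replaces. Relabelling is therefore injective on pairs,
-- also after `farTableau` is added to `SPYCT α`, whereas the coefficient of S̃ is at most the
-- number of pairs from `SPYCT α` alone.
≈⇒narrow : ∀ {m} → PeakComposition α → sum α ≡ suc m → Q̃ α ≈ S̃ α → Narrow α
≈⇒narrow {α} {m} peakα sum≡ Q̃≈S̃ b b′ 3≤c 2≤c = ≮⇒≥ λ r< → excess λ bad∈ →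
  <⇒≱ r< (triple⇒narrow (IsStandardPeakYoungTableau.triple (∈-SPYCT⁻ {α} bad∈)) b b′ 3≤c 2≤c)
  where
  g  = trues m
  e  = decode g
  marks  = bits (suc m)
  Ts = farTableau α ∷ SPYCT α

  length-g : length g ≡ m
  length-g = List.length-replicate m

  test : Filling ℕ α × List Bool → Bool
  test (T , μ) = chains (descents T m) g μ

  Φ : Filling ℕ α × List Bool → Filling Letter α
  Φ (T , μ) = relabel g μ T

  Ts-standard : ∀ {T} → T ∈ Ts → Standard T
  Ts-standard (here refl) = farTableau-standard α
  Ts-standard (there T∈)  = standard⁺ (∈-SPYCT⁻ {α} T∈)

  ∈-pairs⁻ : ∀ {T μ} → (T , μ) ∈ cartesianProduct Ts marks → Standard T × length μ ≡ suc m
  ∈-pairs⁻ p∈ = let T∈ , μ∈ = ∈-cartesianProduct⁻ Ts marks p∈ in Ts-standard T∈ , ∈-bits⁻ (suc m) μ∈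

  into : ∀ {p} → p ∈ cartesianProduct Ts marks → Φ p ∈ weighted α e
  into {T , μ} p∈ = let std , len = ∈-pairs⁻ p∈ in
    relabel-weighted sum≡ g length-g std peakα μ
        (compatible-trues (descents T m) μ (length-descents sum≡ T) len)

  entry≡index : ∀ {T μ} → Standard T → ∀ b → T ! b ≡ index (relabel g μ T ! b)
  entry≡index {T} {μ} std b =
    let k , eq , k< = entry sum≡ g length-g std b in
    trans eq (sym (trans (relabel-index sum≡ g length-g std μ b)
      (trans (cong (λ t → wordIndex 1 g (t ∸ 1)) eq)
          (trans (wordIndex-trues 1 m (s≤s⁻¹ k<)) (+-comm k 1)))))

  injective : ∀ {p q} → p ∈ cartesianProduct Ts marks → q ∈ cartesianProduct Ts marks →
              Φ p ≡ Φ q → p ≡ q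
  injective {T , μ} {T′ , μ′} p∈ q∈ eq =
    let std , len   = ∈-pairs⁻ p∈
        std′ , len′ = ∈-pairs⁻ q∈
        T≡T′        = filling-ext λ b → trans (entry≡index {T} {μ} std b)
                        (trans (cong (λ M → index (M ! b)) eq) (sym (entry≡index {T′} {μ′} std′ b)))
    in  cong₂ _,_ T≡T′ (relabel-marks sum≡ g length-g std len len′ (trans eq (cong (relabel g μ′) (sym T≡T′))))

  length-weighted-≤ : length (weighted α e) ≤ length (cartesianProduct (SPYCT α) marks)
  length-weighted-≤ = begin
    length (weighted α e)                  ≡⟨ cong (length ∘ weighted α) (omitZeros-trues m) ⟨
    length (weighted α (omitZeros e))      ≡⟨ Q̃-coefficient α e ⟨
    Q̃ α e                                  ≡⟨ Q̃≈S̃ e ⟩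
    S̃ α e                                  ≡⟨ S̃-coefficient {α} sum≡ e g length-g
        (sym (omitZeros-trues m)) ⟩
    # test (cartesianProduct (SPYCT α) marks)  ≤⟨ #-≤-length test (cartesianProduct (SPYCT α) marks) ⟩
    length (cartesianProduct (SPYCT α) marks)  ∎
    where open ≤-Reasoning

  -- A double negation suffices here, as the goal is to refute an inequality between rows.
  excess : ¬ ¬ (farTableau α ∈ SPYCT α)
  excess bad∉ =
      contradiction (≤-trans (length-injection Φ pairs-unique into injective) length-weighted-≤)
          (<⇒≱ longer)
    where
    pairs-unique : Unique (cartesianProduct Ts marks)
    pairs-unique = Unique.cartesianProduct⁺ (All.¬Any⇒All¬ (SPYCT α) bad∉ ∷ SPYCT-unique α)
        (bits-unique (suc m))
    longer : length (cartesianProduct (SPYCT α) marks) < length (cartesianProduct Ts marks)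
    longer = begin-strict
      length (cartesianProduct (SPYCT α) marks)             <⟨ m<n+m _
          (∈-length (∈-map⁺ (farTableau α ,_) μ∈)) ⟩
      length (map (farTableau α ,_) marks) + length (cartesianProduct (SPYCT α) marks)
        ≡⟨ List.length-++ (map (farTableau α ,_) marks) ⟨
      length (cartesianProduct Ts marks)                    ∎
      where
      open ≤-Reasoning
      μ∈ : trues (suc m) ∈ marks
      μ∈ = subst (λ l → trues (suc m) ∈ bits (suc l)) length-g (∈-bits⁺ (trues (suc m)))

-- Narrow shapes

Form : List ℕ → Set
Form α = (∃[ j ] ∃[ a ] (α ≡ replicate j 2 ++ a ∷ []))
    ⊎ (∃[ j ] ∃[ a ] (α ≡ replicate j 2 ++ a ∷ 1 ∷ []))

-- The new bottom row has no box in column 3 and lies above no other row.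
narrow-2∷ : Narrow α → Narrow (2 ∷ α)
narrow-2∷ narrow (box zero c)    b′               3≤c 2≤c = s≤s z≤n
narrow-2∷ narrow (box (suc r) c) (box zero c′)    3≤c 2≤c = contradiction (toℕ<n c′) (≤⇒≯ (s≤s⁻¹ 3≤c))
narrow-2∷ narrow (box (suc r) c) (box (suc r′) c′) 3≤c 2≤c = s≤s (narrow (box r c) (box r′ c′) 3≤c 2≤c)

narrow-replicate : ∀ j → Narrow α → Narrow (replicate j 2 ++ α)
narrow-replicate zero    narrow = narrow
narrow-replicate (suc j) narrow = narrow-2∷ (narrow-replicate j narrow)

form⇒narrow : Form α → Narrow α
form⇒narrow (inj₁ (j , a , refl)) = narrow-replicate j single
  where
  single : Narrow (a ∷ [])
  single (box zero _) _ _ _ = s≤s z≤n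
form⇒narrow (inj₂ (j , a , refl)) = narrow-replicate j pair
  where
  pair : Narrow (a ∷ 1 ∷ [])
  pair (box zero _)          _ _   _   = s≤s z≤n
  pair (box (suc zero) zero) _ _   2≤c = contradiction 2≤c λ { (s≤s ()) }

2∷-form : Form α → Form (2 ∷ α)
2∷-form (inj₁ (j , a , eq)) = inj₁ (suc j , a , cong (2 ∷_) eq)
2∷-form (inj₂ (j , a , eq)) = inj₂ (suc j , a , cong (2 ∷_) eq)

-- If the first part is at least 3 and the second at least 2, box (2,2) lies above box (3,1). A
-- second part 1 has to be the last part of a peak composition.
narrow-parts : ∀ a b α → PeakComposition (a ∷ b ∷ α) → Narrow (a ∷ b ∷ α) → a ≡ 2 ⊎ (b ≡ 1 × α ≡ [])
narrow-parts a             zero          α       (_ ∷ () ∷ _ , _) _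
narrow-parts zero          (suc b)       α       (() ∷ _ , _)     _
narrow-parts (suc a)       1             []      _                _ = inj₂ (refl , refl)
narrow-parts (suc a)       1             (c ∷ α) (_ , α>1)        _ =
    contradiction (α>1 (suc zero) (s≤s (s≤s (s≤s z≤n)))) (n≮n 1)
narrow-parts 1             (suc (suc b)) α       (_ , α>1)        _ =
    contradiction (α>1 zero (s≤s (s≤s z≤n))) (n≮n 1)
narrow-parts 2             (suc (suc b)) α       _                _ = inj₁ refl
narrow-parts (suc (suc (suc a))) (suc (suc b)) α _ narrow =
  contradiction (narrow (box (suc zero) (suc zero)) (box zero (suc (suc zero))) (s≤s (s≤s (s≤s z≤n)))
      (s≤s (s≤s z≤n)))
                λ { (s≤s ()) }

narrow⇒form : PeakComposition α → 1 ≤ sum α → Narrow α → Form α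
narrow⇒form {[]}        _ () _
narrow⇒form {a ∷ []}    _ _  _ = inj₁ (0 , a , refl)
narrow⇒form {a ∷ b ∷ α} peakα@(_ ∷ b>0 ∷ α>0 , α>1) _ narrow =
  prepend (narrow-parts a b α peakα narrow)
    (narrow⇒form {b ∷ α} (b>0 ∷ α>0 , λ i i< → α>1 (suc i) (s≤s i<)) (≤-trans b>0 (m≤m+n b (sum α)))
      λ { (box r c) (box r′ c′) 3≤c 2≤c → s≤s⁻¹ (narrow (box (suc r) c) (box (suc r′) c′) 3≤c 2≤c) })
  where
  prepend : a ≡ 2 ⊎ (b ≡ 1 × α ≡ []) → Form (b ∷ α) → Form (a ∷ b ∷ α)
  prepend (inj₁ refl)          form = 2∷-form form
  prepend (inj₂ (refl , refl)) _    = inj₂ (0 , a , refl)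

proposition4p20 : (α : List ℕ) → 1 ≤ sum α → PeakComposition α →
    (Q̃ α ≈ S̃ α) ⇔ ((∃[ j ] ∃[ a ] (α ≡ replicate j 2 ++ a ∷ [])) ⊎ (∃[ j ] ∃[ a ] (α ≡ replicate j 2 ++ a ∷ 1 ∷ [])))
proposition4p20 α 1≤sum peakα = mk⇔
  (λ Q̃≈S̃ → narrow⇒form peakα 1≤sum (≈⇒narrow peakα sum≡ Q̃≈S̃))
  (λ form → narrow⇒≈ peakα sum≡ (form⇒narrow form))
  where
  sum≡ : sum α ≡ suc (pred (sum α))
  sum≡ = sym (suc-pred (sum α) {{>-nonZero 1≤sum}})
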